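{- Let $G$ be a finite simple graph with treewidth at most $6$. Then $\tau(G)\leq 2\,\nu(G)$.
   Context: A triangle transversal of a graph $G$ is a set of edges of $G$ whose removal leaves a triangle-free graph; a triangle packing of $G$ is a set of pairwise edge-disjoint triangles of $G$. $\tau(G)$ denotes the minimum size of a triangle transversal of $G$, and $\nu(G)$ the maximum size of a triangle packing of $G$. -}

module Defs where

open import Data.Bool.Properties using () renaming (_≟_ to _≟ᵇ_)
open import Data.Empty using (⊥-elim)
open import Data.Fin using (Fin; zero; suc; _<_)
open import Data.Fin.Properties using (any?; pigeonhole)
open import Data.Fin.Subset using (Subset; inside; outside; _∈_; _⊆_; _∪_; ⁅_⁆; ∣_∣)
open import Data.Fin.Subset.Properties using (anySubset?; _⊆?_; ∪-comm)
open import Data.List.Base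
  using (List; []; _∷_; _++_; _∷ʳ_; length; map; filter; foldr; tabulate; deduplicate; lookup)
open import Data.List.Membership.Propositional using () renaming (_∈_ to _∈ᴸ_; _∉_ to _∉ᴸ_)
open import Data.List.Membership.Propositional.Properties
  using (∈-map⁺; ∈-++⁺ˡ; ∈-++⁺ʳ; ∈-filter⁺; ∈-lookup; ∈-deduplicate⁺; ∈-deduplicate⁻; ∈-filter⁻)
open import Data.List.Relation.Unary.All as All using (All; [])
open import Data.List.Relation.Unary.AllPairs as AllPairs using (AllPairs; []; _∷_)
open import Data.List.Relation.Unary.Any using (here; index)
open import Data.List.Relation.Unary.Any.Properties using (lookup-index)
open import Data.List.Relation.Unary.Linked using (Linked)
open import Data.List.Relation.Unary.Unique.Propositional using (Unique)
open import Data.Nat using (ℕ; zero; suc; _≤_; _⊔_; _∸_; NonZero; z≤n; s≤s; s≤s⁻¹)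
open import Data.Nat.Properties
  using (≤∧≢⇒<; ≮⇒≥; n≤0⇒n≡0)
open import Data.Product using (Σ; ∃; ∃₂; _×_; _,_; proj₁; proj₂)
open import Data.Vec using ([]; _∷_)
open import Data.Vec.Properties using (≡-dec)
open import Level using (0ℓ)
open import Relation.Binary.Core using (Rel)
open import Relation.Binary.Definitions
  using (Symmetric; Irreflexive; DecidableEquality)
  renaming (Decidable to Decidable₂)
open import Relation.Binary.Construct.Closure.ReflexiveTransitive using (Star)
open import Relation.Binary.PropositionalEquality
  using (_≡_; _≢_; refl; sym; trans; cong; subst)
open import Relation.Nullary using (¬_; Dec; yes; no)
open import Relation.Nullary.Decidable using (map′; _×-dec_; ¬?; decidable-stable)
open import Relation.Unary using (Pred; Decidable)
import Data.List.Membership.DecPropositional as DecMembership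
import Data.List.Relation.Unary.Unique.DecPropositional as DecUnique
import Data.List.Relation.Unary.Unique.DecPropositional.Properties as DecUniqueProperties

record Graph (n : ℕ) : Set₁ where
  field
    Adj    : Rel (Fin n) 0ℓ
    adj?   : Decidable₂ Adj
    symm   : Symmetric Adj
    irrefl : Irreflexive _≡_ Adj

open Graph public

-- Edges and triangles are identified with their vertex sets {u , v} and
-- {u , v , w}; as adjacency is irreflexive, the vertices listed are distinct.
IsEdge : ∀ {n} → Graph n → Pred (Subset n) 0ℓ
IsEdge G e = ∃₂ λ u v → Adj G u v × e ≡ ⁅ u ⁆ ∪ ⁅ v ⁆

IsTriangle : ∀ {n} → Graph n → Pred (Subset n) 0ℓ
IsTriangle G t = ∃ λ u → ∃₂ λ v w →
  Adj G u v × Adj G v w × Adj G u w × t ≡ ⁅ u ⁆ ∪ ⁅ v ⁆ ∪ ⁅ w ⁆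

TriangleFree : ∀ {n} → Graph n → Set
TriangleFree G = ∀ t → ¬ IsTriangle G t

_≟ˢ_ : ∀ {n} → DecidableEquality (Subset n)
_≟ˢ_ = ≡-dec _≟ᵇ_

infixl 6 _∖_

_∖_ : ∀ {n} → Graph n → List (Subset n) → Graph n
G ∖ F = record
  { Adj    = λ u v → Adj G u v × (⁅ u ⁆ ∪ ⁅ v ⁆) ∉ᴸ F
  ; adj?   = λ u v → adj? G u v ×-dec ¬? (DecMembership._∈?_ _≟ˢ_ (⁅ u ⁆ ∪ ⁅ v ⁆) F)
  ; symm   = λ {u} {v} (uv , ∉F) →
               symm G uv , subst (_∉ᴸ F) (∪-comm ⁅ u ⁆ ⁅ v ⁆) ∉F
  ; irrefl = λ u≡v (uv , _) → irrefl G u≡v uv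
  }

-- Finite sets of edges, or of triangles, are duplicate-free lists.
record IsTransversal {n} (G : Graph n) (F : List (Subset n)) : Set where
  field
    unique       : Unique F
    edges        : All (IsEdge G) F
    triangleFree : TriangleFree (G ∖ F)

EdgeDisjoint : ∀ {n} → Graph n → Rel (Subset n) 0ℓ
EdgeDisjoint G s t = ∀ e → IsEdge G e → ¬ (e ⊆ s × e ⊆ t)

record IsPacking {n} (G : Graph n) (T : List (Subset n)) : Set where
  field
    unique    : Unique T
    triangles : All (IsTriangle G) T
    disjoint  : AllPairs (EdgeDisjoint G) T

HasTransversal : ∀ {n} → Graph n → ℕ → Set
HasTransversal G k = ∃ λ F → length F ≡ k × IsTransversal G F

HasPacking : ∀ {n} → Graph n → ℕ → Set
HasPacking G k = ∃ λ T → length T ≡ k × IsPacking G T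

record IsMinimum (P : ℕ → Set) (k : ℕ) : Set where
  field
    attained : P k
    least    : ∀ {j} → P j → k ≤ j

record IsMaximum (P : ℕ → Set) (k : ℕ) : Set where
  field
    attained : P k
    greatest : ∀ {j} → P j → j ≤ k

minimum : ∀ {P : ℕ → Set} → Decidable P → ∀ k → P k → ∃ (IsMinimum P)
minimum {P} P? k Pk with P? 0
... | yes P0 = 0 , record { attained = P0 ; least = λ _ → z≤n }
minimum {P} P? zero    Pk | no ¬P0 = ⊥-elim (¬P0 Pk)
minimum {P} P? (suc k) Pk | no ¬P0
  with m , m-min ← minimum (λ j → P? (suc j)) k Pk =
  suc m , record { attained = IsMinimum.attained m-min ; least = least }
  where
  least : ∀ {j} → P j → suc m ≤ j
  least {zero}  P0 = ⊥-elim (¬P0 P0)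
  least {suc j} Pj = s≤s (IsMinimum.least m-min Pj)

maximum : ∀ {P : ℕ → Set} → Decidable P → ∃ P →
          ∀ b → (∀ {j} → P j → j ≤ b) → ∃ (IsMaximum P)
maximum {P} P? ∃P b bound with P? b
... | yes Pb = b , record { attained = Pb ; greatest = bound }
maximum {P} P? (k , Pk) zero bound | no ¬Pb =
  ⊥-elim (¬Pb (subst P (n≤0⇒n≡0 (bound Pk)) Pk))
maximum {P} P? ∃P (suc b) bound | no ¬Pb =
  maximum P? ∃P b λ Pj → s≤s⁻¹ (≤∧≢⇒< (bound Pj) λ { refl → ¬Pb Pj })

anyList? : ∀ {n} k {P : Pred (List (Subset n)) 0ℓ} → Decidable P →
           Dec (∃ λ xs → length xs ≡ k × P xs)
anyList? zero P? =
  map′ (λ P[] → [] , refl , P[]) (λ { ([] , _ , P[]) → P[] }) (P? [])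
anyList? (suc k) P? =
  map′ (λ { (x , xs , refl , Pxs) → x ∷ xs , refl , Pxs })
       (λ { (x ∷ xs , refl , Pxs) → x , xs , refl , Pxs })
       (anySubset? λ x → anyList? k λ xs → P? (x ∷ xs))

allSubsets? : ∀ {n} {P : Pred (Subset n) 0ℓ} → Decidable P → Dec (∀ p → P p)
allSubsets? P? =
  map′ (λ ¬∃¬P p → decidable-stable (P? p) λ ¬Pp → ¬∃¬P (p , ¬Pp))
       (λ ∀P (p , ¬Pp) → ¬Pp (∀P p))
       (¬? (anySubset? λ p → ¬? (P? p)))

subsets : ∀ n → List (Subset n)
subsets zero    = [] ∷ []
subsets (suc n) = map (inside ∷_) (subsets n) ++ map (outside ∷_) (subsets n)

∈-subsets : ∀ {n} (p : Subset n) → p ∈ᴸ subsets n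
∈-subsets []            = here refl
∈-subsets (inside  ∷ p) = ∈-++⁺ˡ (∈-map⁺ (inside ∷_) (∈-subsets p))
∈-subsets {suc n} (outside ∷ p) =
  ∈-++⁺ʳ (map (inside ∷_) (subsets n)) (∈-map⁺ (outside ∷_) (∈-subsets p))

unique-lookup : ∀ {A : Set} {xs : List A} → Unique xs →
                ∀ {i j} → i < j → lookup xs i ≢ lookup xs j
unique-lookup {xs = x ∷ xs} (x∉ ∷ _) {zero}  {suc j} _ =
  All.lookup x∉ (∈-lookup j)
unique-lookup {xs = x ∷ xs} (_ ∷ u)  {suc i} {suc j} (s≤s i<j) =
  unique-lookup u i<j

unique⇒length≤ : ∀ {n} {xs : List (Subset n)} → Unique xs →
                 length xs ≤ length (subsets n)
unique⇒length≤ {n} {xs} u = ≮⇒≥ λ lt →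
  let position = λ i → ∈-subsets (lookup xs i)
      i , j , i<j , same = pigeonhole lt (λ i → index (position i))
  in unique-lookup u i<j
       (trans (lookup-index (position i))
         (trans (cong (lookup (subsets n)) same)
           (sym (lookup-index (position j)))))

isEdge? : ∀ {n} (G : Graph n) → Decidable (IsEdge G)
isEdge? G e = any? λ u → any? λ v → adj? G u v ×-dec (e ≟ˢ (⁅ u ⁆ ∪ ⁅ v ⁆))

isTriangle? : ∀ {n} (G : Graph n) → Decidable (IsTriangle G)
isTriangle? G t = any? λ u → any? λ v → any? λ w →
  adj? G u v ×-dec adj? G v w ×-dec adj? G u w ×-dec
  (t ≟ˢ (⁅ u ⁆ ∪ ⁅ v ⁆ ∪ ⁅ w ⁆))

isTransversal? : ∀ {n} (G : Graph n) → Decidable (IsTransversal G)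
isTransversal? G F =
  map′ (λ (u , e , f) → record { unique = u ; edges = e ; triangleFree = f })
       (λ r → let open IsTransversal r in unique , edges , triangleFree)
       (DecUnique.unique? _≟ˢ_ F ×-dec All.all? (isEdge? G) F ×-dec
        allSubsets? (λ t → ¬? (isTriangle? (G ∖ F) t)))

edgeDisjoint? : ∀ {n} (G : Graph n) → Decidable₂ (EdgeDisjoint G)
edgeDisjoint? G s t =
  map′ (λ h e e∈G e⊆ → h e (e∈G , e⊆)) (λ h e (e∈G , e⊆) → h e e∈G e⊆)
       (allSubsets? λ e → ¬? (isEdge? G e ×-dec (e ⊆? s) ×-dec (e ⊆? t)))

isPacking? : ∀ {n} (G : Graph n) → Decidable (IsPacking G)
isPacking? G T =
  map′ (λ (u , t , d) → record { unique = u ; triangles = t ; disjoint = d })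
       (λ r → let open IsPacking r in unique , triangles , disjoint)
       (DecUnique.unique? _≟ˢ_ T ×-dec All.all? (isTriangle? G) T ×-dec
        AllPairs.allPairs? (edgeDisjoint? G) T)

∃-transversal : ∀ {n} (G : Graph n) → ∃ (IsTransversal G)
∃-transversal {n} G = deduplicate _≟ˢ_ edgeList , record
  { unique       = DecUniqueProperties.deduplicate-! _≟ˢ_ edgeList
  ; edges        = All.tabulate λ e∈ →
      proj₂ (∈-filter⁻ (isEdge? G) {xs = subsets n} (∈-deduplicate⁻ _≟ˢ_ edgeList e∈))
  ; triangleFree = λ { t (u , v , w , (uv , uv∉) , _) → uv∉
      (∈-deduplicate⁺ _≟ˢ_ (∈-filter⁺ (isEdge? G) (∈-subsets _) (u , v , uv , refl))) }
  }
  where edgeList = filter (isEdge? G) (subsets n)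

abstract
  τ-exists : ∀ {n} (G : Graph n) → ∃ (IsMinimum (HasTransversal G))
  τ-exists G with F , F-transversal ← ∃-transversal G =
    minimum (λ k → anyList? k (isTransversal? G)) (length F) (F , refl , F-transversal)

  ν-exists : ∀ {n} (G : Graph n) → ∃ (IsMaximum (HasPacking G))
  ν-exists {n} G = maximum (λ k → anyList? k (isPacking? G))
    (0 , [] , refl , record { unique = [] ; triangles = [] ; disjoint = [] })
    (length (subsets n))
    (λ { (T , refl , T-pack) → unique⇒length≤ (IsPacking.unique T-pack) })

τ : ∀ {n} → Graph n → ℕ
τ G = proj₁ (τ-exists G)

ν : ∀ {n} → Graph n → ℕ
ν G = proj₁ (ν-exists G)

Connected : ∀ {n} → Graph n → Set
Connected G = ∀ u v → Star (Adj G) u v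

ConnectedOn : ∀ {n} → Graph n → Pred (Fin n) 0ℓ → Set
ConnectedOn G P =
  ∀ {u v} → P u → P v → Star (λ x y → P x × P y × Adj G x y) u v

-- A cycle x , y , … , z has at least three vertices, all distinct, with
-- consecutive ones adjacent and z adjacent to x.
IsCycle : ∀ {n} → Graph n → Fin n → Fin n → List (Fin n) → Fin n → Set
IsCycle G x y ys z = Unique vs × Linked (Adj G) vs × Adj G z x
  where vs = x ∷ y ∷ (ys ∷ʳ z)

Acyclic : ∀ {n} → Graph n → Set
Acyclic G = ∀ x y ys z → ¬ IsCycle G x y ys z

record IsTree {m} (T : Graph m) : Set where
  field
    nonEmpty  : NonZero m
    connected : Connected T
    acyclic   : Acyclic T

record TreeDecomposition {n} (G : Graph n) : Set₁ where
  field
    {size}       : ℕ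
    tree         : Graph size
    isTree       : IsTree tree
    bag          : Fin size → Subset n
    coversVertex : ∀ v → ∃ λ i → v ∈ bag i
    coversEdge   : ∀ {u v} → Adj G u v → ∃ λ i → u ∈ bag i × v ∈ bag i
    connectedAt  : ∀ v → ConnectedOn tree (λ i → v ∈ bag i)

-- Truncated subtraction only matters for the graph without vertices, whose
-- width is then 0 instead of -1.
width : ∀ {n} {G : Graph n} → TreeDecomposition G → ℕ
width D = foldr _⊔_ 0 (tabulate λ i → ∣ bag i ∣) ∸ 1
  where open TreeDecomposition D

-- The treewidth, i.e. the least width of a tree decomposition, is at most k.
TreewidthAtMost : ∀ {n} → ℕ → Graph n → Set₁
TreewidthAtMost k G = Σ (TreeDecomposition G) λ D → width D ≤ k

-- Induction on the number of edges.  Suppose that X and D are sets of edges of G and Y is a set of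
-- edge-disjoint triangles with |X| ≤ 2|Y|, such that X meets every triangle through an edge of D
-- and X ∪ D contains every edge of a triangle in Y.  A transversal and a packing of G - X - D
-- become ones of G by adding X and Y, so the bound is inherited from G - X - D (a variant of
-- Puleo's reducible sets).
--
-- A tree decomposition ranks the vertices so that the neighbours of v of at most its rank lie in a
-- bag containing v.  Call v a leaf if none of its neighbours has larger rank.  Either two leaves
-- are adjacent, or, for y of maximal rank among the non-leaves, the neighbours of y of larger rank
-- are leaves whose neighbours all lie in one bag of y.  Taking one, two or three of them leaves a
-- configuration on at most ten vertices, in which enough vertices have no neighbour outside it;
-- there X, D and Y are found by splitting on adjacencies.  With only two leaves u and v in view the
-- split would get stuck when their neighbourhoods are K₅'s sharing a triangle, whence the third
-- vertex y, or a third leaf, whose neighbourhood is also known.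

module Submission where

open import Defs
open import Data.Bool.Base using (Bool; true; false; T; _∧_; _∨_; not)
open import Data.Bool.ListAction using (all; any)
open import Data.Bool.Properties using (T-∧; T-∨)
open import Data.Char.Base using (Char; toℕ)
open import Data.Empty using (⊥-elim)
open import Data.Fin using (Fin; zero; suc)
open import Data.Fin.Properties using (any?; pigeonhole; suc-injective) renaming (_≟_ to _≟ᶠ_)
open import Data.Fin.Subset using (Subset; inside; outside; _∈_; _⊆_; _∪_; ⁅_⁆; ∣_∣)
  renaming (⊥ to ∅)
open import Data.Fin.Subset.Properties
  using (_∈?_; x∈⁅x⁆; x∈⁅y⁆⇒x≡y; x∈p∪q⁻; x∈p∪q⁺; ∪-comm)
open import Data.List.Base
  using (List; []; _∷_; _++_; _∷ʳ_; length; map; filter; foldr; mapMaybe; deduplicate; lookup;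
         allFin; upTo)
open import Data.List.Extrema.Nat using (argmax; f[xs]≤f[argmax]; argmax-all)
open import Data.List.Membership.Propositional
  using (find; lose) renaming (_∈_ to _∈ᴸ_; _∉_ to _∉ᴸ_)
open import Data.List.Membership.Propositional.Properties
  using (∈-++⁺ˡ; ∈-++⁺ʳ; ∈-++⁻; ∈-∃++; ∈-map⁺; ∈-map⁻; ∈-filter⁺; ∈-filter⁻; ∈-deduplicate⁺;
         ∈-lookup; ∈-allFin; ∈-upTo⁺; ∈-tabulate⁺)
open import Data.List.Properties
  using (length-++; length-map; length-filter; length-deduplicate; length-tabulate;
         filter-notAll; ++-assoc)
open import Data.List.Relation.Unary.All as All using (All; []; _∷_)
open import Data.List.Relation.Unary.AllPairs as AllPairs using (AllPairs; []; _∷_)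
open import Data.List.Relation.Unary.Any as Any using (Any; here; there; index)
open import Data.List.Relation.Unary.Any.Properties using (lookup-index)
open import Data.List.Relation.Unary.Linked using (Linked; []; [-]; _∷_)
open import Data.List.Relation.Unary.Unique.Propositional using (Unique)
open import Data.Maybe.Base using (Maybe; just; nothing; maybe′)
open import Data.Maybe.Properties using (just-injective)
open import Data.Nat
  using (ℕ; zero; suc; _+_; _*_; _∸_; _⊔_; _≤_; _<_; z≤n; s≤s; s≤s⁻¹)
  renaming (_≡ᵇ_ to infix 6.5 _≡ᵇ_; _≤ᵇ_ to infix 6.5 _≤ᵇ_)
open import Data.Nat.Properties
  using (≤-refl; ≤-reflexive; ≤-trans; <-irrefl; <⇒≤; <⇒≱; ≮⇒≥; _<?_; ≡ᵇ⇒≡; ≡⇒≡ᵇ; ≤ᵇ⇒≤;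
         m≤n⇒m≤1+n; m≤m+n; m≤m⊔n; m≤n⊔m; +-suc; +-mono-≤; +-monoʳ-≤; *-monoʳ-≤; *-distribˡ-+)
open import Data.Product using (∃; ∃₂; _×_; _,_; proj₁; proj₂)
open import Data.String.Base using (String; toList)
open import Data.Sum using (_⊎_; inj₁; inj₂; [_,_]′)
open import Data.Unit using (tt)
open import Data.Vec.Base using ([]; _∷_; here; there)
open import Function.Bundles using (Equivalence)
open import Level using (0ℓ)
open import Relation.Binary.Construct.Closure.ReflexiveTransitive as Star using (Star; ε; _◅_)
open import Relation.Binary.PropositionalEquality
  using (_≡_; _≢_; refl; sym; trans; cong; cong₂; subst)
open import Relation.Nullary using (¬_; Dec; yes; no; ¬?)
open import Relation.Nullary.Decidable using (_×-dec_; decidable-stable)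
open import Relation.Unary using (Pred; Decidable)
import Data.List.Membership.DecPropositional as DecMembership
import Data.List.Relation.Unary.All.Properties as Allₚ
import Data.List.Relation.Unary.AllPairs.Properties as AllPairsₚ
import Data.List.Relation.Unary.Any.Properties as Anyₚ
import Data.List.Relation.Unary.Unique.DecPropositional.Properties as DecUniqueₚ
import Data.List.Relation.Unary.Unique.Propositional.Properties as Uniqueₚ

-- The link of a vertex v is the graph induced on its neighbours; triangles at v correspond to edges
-- of the link. If D is the set of edges at v, then X can be made of link edges and of spokes vw, a
-- spoke covering all link edges at w. The price is that the link edge of every triangle of Y at v
-- must lie in X too. Positive degree at most four always works. The obstacle is a complete link:
-- deleting K₅ costs ten edges, but K₆ holds only four edge-disjoint triangles; deleting K₆ costs
-- fifteen, but K₇ holds only seven. Hence a second vertex has to share the cost: two leaves over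
-- the same K₅ need ten edges and yield five triangles, over the same K₆ fifteen edges and eight
-- triangles. Most of the case analysis is about how far two neighbourhoods overlap and about links
-- that are nearly complete.

edge : ∀ {n} → Fin n → Fin n → Subset n
edge u v = ⁅ u ⁆ ∪ ⁅ v ⁆

triangle : ∀ {n} → Fin n → Fin n → Fin n → Subset n
triangle u v w = ⁅ u ⁆ ∪ ⁅ v ⁆ ∪ ⁅ w ⁆

∈-edge⁻ : ∀ {n} {x u v : Fin n} → x ∈ edge u v → x ≡ u ⊎ x ≡ v
∈-edge⁻ {u = u} {v} x∈ with x∈p∪q⁻ ⁅ u ⁆ ⁅ v ⁆ x∈
... | inj₁ x∈u = inj₁ (x∈⁅y⁆⇒x≡y u x∈u)
... | inj₂ x∈v = inj₂ (x∈⁅y⁆⇒x≡y v x∈v)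

∈-edge⁺ˡ : ∀ {n} {u v : Fin n} → u ∈ edge u v
∈-edge⁺ˡ = x∈p∪q⁺ (inj₁ (x∈⁅x⁆ _))

∈-edge⁺ʳ : ∀ {n} {u v : Fin n} → v ∈ edge u v
∈-edge⁺ʳ = x∈p∪q⁺ (inj₂ (x∈⁅x⁆ _))

∈-triangle⁻ : ∀ {n} {x u v w : Fin n} → x ∈ triangle u v w → x ≡ u ⊎ x ≡ v ⊎ x ≡ w
∈-triangle⁻ {u = u} {v} {w} x∈ with x∈p∪q⁻ ⁅ u ⁆ (⁅ v ⁆ ∪ ⁅ w ⁆) x∈
... | inj₁ x∈u = inj₁ (x∈⁅y⁆⇒x≡y u x∈u)
... | inj₂ x∈vw = inj₂ (∈-edge⁻ x∈vw)

edge-injective : ∀ {n} {u v x y : Fin n} → edge u v ≡ edge x y →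
                 (u ≡ x × v ≡ y) ⊎ (u ≡ y × v ≡ x)
edge-injective {u = u} {v} {x} {y} eq
  with ∈-edge⁻ (subst (u ∈_) eq ∈-edge⁺ˡ) | ∈-edge⁻ (subst (v ∈_) eq ∈-edge⁺ʳ)
... | inj₁ u≡x  | inj₂ v≡y  = inj₁ (u≡x , v≡y)
... | inj₂ u≡y  | inj₁ v≡x  = inj₂ (u≡y , v≡x)
-- Both ends of the first edge are `x`, so the second edge has no other vertex and `y` is `x` as
-- well.
... | inj₁ refl | inj₁ refl with ∈-edge⁻ (subst (y ∈_) (sym eq) ∈-edge⁺ʳ)
...   | inj₁ refl = inj₁ (refl , refl)
...   | inj₂ refl = inj₁ (refl , refl)
edge-injective {u = u} {v} {x} {y} eq
    | inj₂ refl | inj₂ refl with ∈-edge⁻ (subst (x ∈_) (sym eq) ∈-edge⁺ˡ)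
...   | inj₁ refl = inj₁ (refl , refl)
...   | inj₂ refl = inj₁ (refl , refl)

edge-⊆-triangle : ∀ {n} (G : Graph n) {e u v w} → IsEdge G e → e ⊆ triangle u v w →
                  e ≡ edge u v ⊎ e ≡ edge v w ⊎ e ≡ edge u w
edge-⊆-triangle G (x , y , xy , refl) e⊆
  with ∈-triangle⁻ (e⊆ ∈-edge⁺ˡ) | ∈-triangle⁻ (e⊆ ∈-edge⁺ʳ)
... | inj₁ refl        | inj₁ refl        = ⊥-elim (irrefl G refl xy)
... | inj₁ refl        | inj₂ (inj₁ refl) = inj₁ refl
... | inj₁ refl        | inj₂ (inj₂ refl) = inj₂ (inj₂ refl)
... | inj₂ (inj₁ refl) | inj₁ refl        = inj₁ (∪-comm _ _)
... | inj₂ (inj₁ refl) | inj₂ (inj₁ refl) = ⊥-elim (irrefl G refl xy)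
... | inj₂ (inj₁ refl) | inj₂ (inj₂ refl) = inj₂ (inj₁ refl)
... | inj₂ (inj₂ refl) | inj₁ refl        = inj₂ (inj₂ (∪-comm _ _))
... | inj₂ (inj₂ refl) | inj₂ (inj₁ refl) = inj₂ (inj₁ (∪-comm _ _))
... | inj₂ (inj₂ refl) | inj₂ (inj₂ refl) = ⊥-elim (irrefl G refl xy)

triangle-edge : ∀ {n} (G H : Graph n) {t e} → IsTriangle H t → IsEdge G e → e ⊆ t → IsEdge H e
triangle-edge G H (u , v , w , uv , vw , uw , refl) e∈G e⊆
  with edge-⊆-triangle G e∈G e⊆
... | inj₁ refl        = u , v , uv , refl
... | inj₂ (inj₁ refl) = v , w , vw , refl
... | inj₂ (inj₂ refl) = u , w , uw , refl

-- Reductions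

Tuza : ∀ {n} → Graph n → Set
Tuza G = ∃₂ λ F T → IsTransversal G F × IsPacking G T × length F ≤ 2 * length T

-- The edges of `D` are deleted without being paid for, which is why `small` counts only `X`.
-- `D-hit` speaks of the first side of a triangle; the other sides are reached by permuting its
-- vertices.
record Reduction {n} (G : Graph n) : Set where
  field
    X D Y       : List (Subset n)
    X-edges     : All (IsEdge G) X
    Y-triangles : All (IsTriangle G) Y
    Y-disjoint  : AllPairs (EdgeDisjoint G) Y
    Y-edges     : ∀ {t e} → t ∈ᴸ Y → IsEdge G e → e ⊆ t → e ∈ᴸ X ++ D
    D-hit       : ∀ {u v w} → Adj G u v → Adj G v w → Adj G u w → edge u v ∈ᴸ D →
                  edge u v ∈ᴸ X ⊎ edge v w ∈ᴸ X ⊎ edge u w ∈ᴸ X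
    small       : length X ≤ 2 * length Y
    nontrivial  : ∃ λ e → IsEdge G e × e ∈ᴸ X ++ D

IsTriangle⇒edge : ∀ {n} (G : Graph n) {t} → IsTriangle G t → ∃ λ e → IsEdge G e × e ⊆ t
IsTriangle⇒edge G (u , v , w , uv , vw , uw , refl) =
  edge u v , (u , v , uv , refl) , λ x∈ → x∈p∪q⁺ (
    [ (λ { refl → inj₁ (x∈⁅x⁆ _) }) , (λ { refl → inj₂ (∈-edge⁺ˡ) }) ]′ (∈-edge⁻ x∈))

∖-edge : ∀ {n} (G : Graph n) F {e} → IsEdge (G ∖ F) e → IsEdge G e × e ∉ᴸ F
∖-edge G F (u , v , (uv , ∉F) , refl) = (u , v , uv , refl) , ∉F

∖-triangle : ∀ {n} (G : Graph n) F {t} → IsTriangle (G ∖ F) t → IsTriangle G t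
∖-triangle G F (u , v , w , (uv , _) , (vw , _) , (uw , _) , t≡) = u , v , w , uv , vw , uw , t≡

-- A triangle contains an edge, so it is never edge-disjoint from itself.
disjoint⇒unique : ∀ {n} (G : Graph n) {T} → All (IsTriangle G) T →
                  AllPairs (EdgeDisjoint G) T → AllPairs _≢_ T
disjoint⇒unique G []       []       = []
disjoint⇒unique G (t△ ∷ T△) (t# ∷ T#) =
  All.map (λ { t#s refl → let e , e∈G , e⊆t = IsTriangle⇒edge G t△ in t#s e e∈G (e⊆t , e⊆t) }) t#
  ∷ disjoint⇒unique G T△ T#

module _ {n} {G : Graph n} (R : Reduction G) where
  open Reduction R

  private
    G′ : Graph n
    G′ = G ∖ (X ++ D)

  remaining-avoids : ∀ {t e} → IsTriangle G′ t → IsEdge G e → e ⊆ t → e ∉ᴸ X ++ D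
  remaining-avoids t△ e∈G e⊆ =
    proj₂ (∖-edge G (X ++ D) (triangle-edge G G′ t△ e∈G e⊆))

  -- `D` stays out of the transversal: a triangle that avoids `X` has no side in `D` by `D-hit`, so
  -- it survives in `G′`, where `F` meets it. The two packings are disjoint because the sides of `Y`
  -- are gone from `G′`.
  extend : Tuza G′ → Tuza G
  extend (F , T , F-trans , T-pack , ∣F∣≤2∣T∣) =
    -- `X` may list an edge twice; deduplication can only improve the bound.
    deduplicate _≟ˢ_ (X ++ F) , Y ++ T ,
    record
      { unique       = DecUniqueₚ.deduplicate-! _≟ˢ_ (X ++ F)
      ; edges        = Allₚ.deduplicate⁺ _≟ˢ_ (Allₚ.++⁺ X-edges
          (All.map (λ e∈G′ → proj₁ (∖-edge G (X ++ D) e∈G′)) F.edges))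
      ; triangleFree = λ { t (u , v , w , (uv , uv∉) , (vw , vw∉) , (uw , uw∉) , refl) →
          F.triangleFree t (u , v , w ,
            ((uv , unhit uv vw uw (∉X uv∉) (∉X vw∉) (∉X uw∉)) , ∉F uv∉) ,
            ((vw , unhit vw (symm G uw) (symm G uv) (∉X vw∉) (flip∉ (∉X uw∉)) (flip∉ (∉X uv∉)))
              , ∉F vw∉) ,
            ((uw , unhit uw (symm G vw) uv (∉X uw∉) (flip∉ (∉X vw∉)) (∉X uv∉)) , ∉F uw∉) ,
            refl) }
      } ,
    record
      { unique    = disjoint⇒unique G triangles disjoint
      ; triangles = triangles
      ; disjoint  = disjoint
      } ,
    ≤-trans (length-deduplicate _≟ˢ_ (X ++ F))
      (≤-trans (≤-reflexive (length-++ X))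
        (≤-trans (+-mono-≤ small ∣F∣≤2∣T∣)
          (≤-reflexive (trans (sym (*-distribˡ-+ 2 (length Y) (length T)))
            (cong (2 *_) (sym (length-++ Y)))))))
    where
    module F = IsTransversal F-trans
    module T = IsPacking T-pack

    ∉X : ∀ {e} → e ∉ᴸ deduplicate _≟ˢ_ (X ++ F) → e ∉ᴸ X
    ∉X e∉ e∈X = e∉ (∈-deduplicate⁺ _≟ˢ_ (∈-++⁺ˡ e∈X))

    ∉F : ∀ {e} → e ∉ᴸ deduplicate _≟ˢ_ (X ++ F) → e ∉ᴸ F
    ∉F e∉ e∈F = e∉ (∈-deduplicate⁺ _≟ˢ_ (∈-++⁺ʳ X e∈F))

    unhit : ∀ {a b c} → Adj G a b → Adj G b c → Adj G a c →
            edge a b ∉ᴸ X → edge b c ∉ᴸ X → edge a c ∉ᴸ X → edge a b ∉ᴸ X ++ D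
    unhit ab bc ac ab∉ bc∉ ac∉ ab∈ =
      [ ab∉ , (λ ab∈D → [ ab∉ , [ bc∉ , ac∉ ]′ ]′ (D-hit ab bc ac ab∈D)) ]′ (∈-++⁻ X ab∈)

    flip∉ : ∀ {a b} → edge a b ∉ᴸ X → edge b a ∉ᴸ X
    flip∉ {a} {b} = subst (_∉ᴸ X) (∪-comm ⁅ a ⁆ ⁅ b ⁆)

    triangles : All (IsTriangle G) (Y ++ T)
    triangles = Allₚ.++⁺ Y-triangles (All.map (∖-triangle G (X ++ D)) T.triangles)
    disjoint : AllPairs (EdgeDisjoint G) (Y ++ T)
    disjoint = AllPairsₚ.++⁺ Y-disjoint
      (AllPairs.zipWith (λ { (h , s△ , t△) e e∈G (e⊆s , e⊆t) →
          h e (triangle-edge G G′ s△ e∈G e⊆s) (e⊆s , e⊆t) })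
        (T.disjoint , pairs T.triangles))
      (All.tabulate λ t∈Y → All.map (λ s△ e e∈G (e⊆t , e⊆s) →
          remaining-avoids s△ e∈G e⊆s (Y-edges t∈Y e∈G e⊆t)) T.triangles)
      where
      pairs : ∀ {P : Subset n → Set} {xs} → All P xs → AllPairs (λ x y → P x × P y) xs
      pairs []         = []
      pairs (px ∷ pxs) = All.map (px ,_) pxs ∷ pairs pxs

-- Induction on the number of edges

filter-length-mono : ∀ {A : Set} {P Q : Pred A 0ℓ} (P? : Decidable P) (Q? : Decidable Q) →
                     (∀ {x} → P x → Q x) → ∀ xs → length (filter P? xs) ≤ length (filter Q? xs)
filter-length-mono P? Q? P⊆Q []       = z≤n
filter-length-mono P? Q? P⊆Q (x ∷ xs) with P? x | Q? x
... | yes _  | yes _  = s≤s (filter-length-mono P? Q? P⊆Q xs)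
... | yes px | no ¬qx = ⊥-elim (¬qx (P⊆Q px))
... | no _   | yes _  = m≤n⇒m≤1+n (filter-length-mono P? Q? P⊆Q xs)
... | no _   | no _   = filter-length-mono P? Q? P⊆Q xs

filter-length-strict : ∀ {A : Set} {P Q : Pred A 0ℓ} (P? : Decidable P) (Q? : Decidable Q) →
                       (∀ {x} → P x → Q x) → ∀ {x xs} → x ∈ᴸ xs → Q x → ¬ P x →
                       length (filter P? xs) < length (filter Q? xs)
filter-length-strict P? Q? P⊆Q {x} {.x ∷ xs} (here refl) qx ¬px with P? x | Q? x
... | yes px | _      = ⊥-elim (¬px px)
... | no _   | yes _  = s≤s (filter-length-mono P? Q? P⊆Q xs)
... | no _   | no ¬qx = ⊥-elim (¬qx qx)
filter-length-strict P? Q? P⊆Q {x} {y ∷ xs} (there x∈) qx ¬px with P? y | Q? y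
... | yes _  | yes _  = s≤s (filter-length-strict P? Q? P⊆Q x∈ qx ¬px)
... | yes py | no ¬qy = ⊥-elim (¬qy (P⊆Q py))
... | no _   | yes _  = m≤n⇒m≤1+n (filter-length-strict P? Q? P⊆Q x∈ qx ¬px)
... | no _   | no _   = filter-length-strict P? Q? P⊆Q x∈ qx ¬px

edgeCount : ∀ {n} → Graph n → ℕ
edgeCount {n} G = length (filter (isEdge? G) (subsets n))

edgeCount-∖ : ∀ {n} (G : Graph n) F {e} → IsEdge G e → e ∈ᴸ F → edgeCount (G ∖ F) < edgeCount G
edgeCount-∖ G F e∈G e∈F =
  filter-length-strict (isEdge? (G ∖ F)) (isEdge? G) (λ e∈ → proj₁ (∖-edge G F e∈))
    (∈-subsets _) e∈G (λ e∈ → proj₂ (∖-edge G F e∈) e∈F)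

_⊑_ : ∀ {n} → Graph n → Graph n → Set
H ⊑ G = ∀ {u v} → Adj H u v → Adj G u v

-- The recursion moves to ever smaller subgraphs, so a reduction is asked of each of them and not of
-- `G` alone.
reducible⇒Tuza : ∀ {n} (G : Graph n) →
                 (∀ H → H ⊑ G → ∀ {u v} → Adj H u v → Reduction H) → Tuza G
reducible⇒Tuza {n} G reduce = go (edgeCount G) G (λ uv → uv) (≤-reflexive refl)
  where
  go : ∀ k H → H ⊑ G → edgeCount H ≤ k → Tuza H
  go k H H⊑G H≤k with any? (λ u → any? λ v → adj? H u v)
  ... | no ¬uv = [] , [] ,
    record { unique = [] ; edges = []
           ; triangleFree = λ { t (u , v , _ , (uv , _) , _) → ¬uv (u , v , uv) } } ,
    record { unique = [] ; triangles = [] ; disjoint = [] } , z≤n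
  ... | yes (u , v , uv) with reduce H H⊑G uv
  ...   | R with Reduction.nontrivial R
  ...     | e , e∈H , e∈ with k | ≤-trans (edgeCount-∖ H _ e∈H e∈) H≤k
  -- By `nontrivial` an edge disappears, so the bound `k` is positive and can decrease.
  ...       | suc k′ | s≤s H′≤k′ = extend R (go k′ _ (λ (xy , _) → H⊑G xy) H′≤k′)

Tuza⇒τ≤2ν : ∀ {n} (G : Graph n) → Tuza G → τ G ≤ 2 * ν G
Tuza⇒τ≤2ν G (F , T , F-trans , T-pack , F≤2T) =
  ≤-trans (IsMinimum.least (proj₂ (τ-exists G)) (F , refl , F-trans))
    (≤-trans F≤2T (*-monoʳ-≤ 2 (IsMaximum.greatest (proj₂ (ν-exists G)) (T , refl , T-pack))))

-- Configurations

∧-T : ∀ {x y} → T (x ∧ y) → T x × T y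
∧-T = Equivalence.to T-∧

∨-T : ∀ {x y} → T (x ∨ y) → T x ⊎ T y
∨-T = Equivalence.to T-∨

not-T : ∀ {x} → T (not x) → ¬ T x
not-T {false} _ ()

Pair Triple : Set
Pair   = ℕ × ℕ
Triple = ℕ × ℕ × ℕ

infix 6.5 _≈ᵇ_ _∈ᵇ_ _∈ᴾ_

_≈ᵇ_ : Pair → Pair → Bool
(i , j) ≈ᵇ (k , l) = (i ≡ᵇ k ∧ j ≡ᵇ l) ∨ (i ≡ᵇ l ∧ j ≡ᵇ k)

_∈ᵇ_ : ℕ → List ℕ → Bool
i ∈ᵇ is = any (i ≡ᵇ_) is

_∈ᴾ_ : Pair → List Pair → Bool
e ∈ᴾ es = any (e ≈ᵇ_) es

sides : Triple → List Pair
sides (i , j , k) = (i , j) ∷ (j , k) ∷ (i , k) ∷ []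

-- Vertices of a graph occupy numbered slots, some of which may stay vacant.  All neighbours of a
-- vertex in a closed slot occupy slots too; a vertex in a low slot has at most six neighbours.
record Configuration : Set where
  constructor config
  field
    slots          : ℕ
    closed low     : List ℕ
    present absent : List Pair

open Configuration

withPresent withAbsent : Pair → Configuration → Configuration
withPresent e (config s c l p a) = config s c l (e ∷ p) a
withAbsent  e (config s c l p a) = config s c l p (e ∷ a)

Slots : ℕ → Set
Slots n = ℕ → Maybe (Fin n)

module _ {n} (G : Graph n) where

  -- A pair with a vacant slot is not joined. The absent branch of a split therefore covers vacancy
  -- as well as non-adjacency, and one case tree serves all degrees and all bag sizes.
  Joined : Slots n → Pair → Set
  Joined f (i , j) = ∃₂ λ u v → f i ≡ just u × f j ≡ just v × Adj G u v

  joined? : ∀ f e → Dec (Joined f e)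
  joined? f (i , j) with f i | f j
  ... | nothing | _       = no λ { (_ , _ , () , _) }
  ... | just u  | nothing = no λ { (_ , _ , _ , () , _) }
  ... | just u  | just v  with adj? G u v
  ...   | yes uv = yes (u , v , refl , refl , uv)
  ...   | no ¬uv = no λ { (_ , _ , refl , refl , uv) → ¬uv uv }

  DegreeAtMost6 : Fin n → Set
  DegreeAtMost6 v = ∀ {ws} → Unique ws → All (Adj G v) ws → length ws ≤ 6

  record Realises (f : Slots n) (c : Configuration) : Set where
    field
      bounded    : ∀ {i v} → f i ≡ just v → i < slots c
      injective  : ∀ {i j v} → f i ≡ just v → f j ≡ just v → i ≡ j
      isClosed   : ∀ {i v w} → i ∈ᴸ closed c → f i ≡ just v → Adj G v w → ∃ λ j → f j ≡ just w
      isLow      : ∀ {i v} → i ∈ᴸ low c → f i ≡ just v → DegreeAtMost6 v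
      isPresent  : All (Joined f) (present c)
      isAbsent   : All (λ e → ¬ Joined f e) (absent c)

Reducible : Configuration → Set₁
Reducible c = ∀ {n} (G : Graph n) f → Realises G f c → Reduction G

isSide : Triple → Pair → Bool
isSide t e = e ∈ᴾ sides t

-- As slot i is closed, every triangle through the edge ij has its third vertex in a slot.
hit : Configuration → List Pair → Pair → Bool
hit c X (i , j) =
  i ∈ᵇ closed c ∧
  all (λ k → k ≡ᵇ i ∨ k ≡ᵇ j ∨ any blocked (sides (i , j , k))) (upTo (slots c))
  where
  blocked : Pair → Bool
  blocked e = e ∈ᴾ X ∨ e ∈ᴾ absent c

disjointᵇ : Triple → Triple → Bool
disjointᵇ s t = not (any (isSide s) (sides t))

pairwise : ∀ {A : Set} → (A → A → Bool) → List A → Bool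
pairwise r []       = true
pairwise r (x ∷ xs) = all (r x) xs ∧ pairwise r xs

-- Only the sides of `Y` have to be known present. Pairs in `D` and `X` may be undecided or absent,
-- since those that are not joined are dropped later, which only makes `X` smaller.
reduces : Configuration → List Pair → List Pair → List Triple → Bool
reduces c D X Y =
  all (λ t → all (_∈ᴾ present c) (sides t)) Y ∧
  pairwise disjointᵇ Y ∧
  all (λ t → all (λ e → e ∈ᴾ X ∨ e ∈ᴾ D) (sides t)) Y ∧
  all (hit c X) D ∧
  length X ≤ᵇ 2 * length Y ∧
  any (λ e → e ∈ᴾ X ∨ e ∈ᴾ D) (present c)

-- The default will be the number of slots, which is always vacant.
at : ℕ → List ℕ → ℕ → ℕ
at d []       _       = d
at d (x ∷ xs) zero    = x
at d (x ∷ xs) (suc i) = at d xs i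

-- The map σ sends the slots of d to slots of c.  Numbers from slots c on serve as vacant slots,
-- which is why they may repeat in σ.
fits : (d c : Configuration) → List ℕ → Bool
fits d c σ =
  length σ ≤ᵇ slots d ∧
  pairwise (λ i j → slots c ≤ᵇ i ∨ not (i ≡ᵇ j)) σ ∧
  all (λ i → s i ∈ᵇ closed c ∧
             all (λ k → k ∈ᵇ σ ∨ (s i , k) ∈ᴾ absent c) (upTo (slots c))) (closed d) ∧
  all (λ i → s i ∈ᵇ low c) (low d) ∧
  all (λ (i , j) → (s i , s j) ∈ᴾ present c) (present d) ∧
  all (λ (i , j) → slots c ≤ᵇ s i ∨ slots c ≤ᵇ s j ∨ (s i , s j) ∈ᴾ absent c) (absent d)
  where
  s : ℕ → ℕ
  s = at (slots c) σ

crowds : Configuration → ℕ → List ℕ → Bool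
crowds c i js =
  i ∈ᵇ low c ∧ 7 ≤ᵇ length js ∧ pairwise (λ j k → not (j ≡ᵇ k)) js ∧
  all (λ j → (i , j) ∈ᴾ present c) js

-- Slots are written as digits, and a vacant slot as x (any character of code above 57 would do).
digits : String → List ℕ
digits s = mapMaybe digit (toList s)
  where
  digit : Char → Maybe ℕ
  digit c with 48 ≤ᵇ toℕ c
  ... | true  = just (toℕ c ∸ 48)
  ... | false = nothing

pairs : List ℕ → List Pair
pairs (i ∷ j ∷ is) = (i , j) ∷ pairs is
pairs _            = []

triples : List ℕ → List Triple
triples (i ∷ j ∷ k ∷ is) = (i , j , k) ∷ triples is
triples _                = []

setup : ℕ → (closed low present absent : String) → Configuration
setup s c l p a = config s (digits c) (digits l) (pairs (digits p)) (pairs (digits a))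

-- `use` stores the proof of an earlier lemma, so only the renaming has to be tested and a repeated
-- subtree is checked once.
data Certificate : Set₁ where
  reduce : (D X Y : String) → Certificate
  split  : (i j : ℕ) (absent present : Certificate) → Certificate
  crowd  : ℕ → String → Certificate
  use    : ∀ {d} → Reducible d → String → Certificate

check : Configuration → Certificate → Bool
check c (reduce D X Y)    = reduces c (pairs (digits D)) (pairs (digits X)) (triples (digits Y))
check c (split i j t₀ t₁) = check (withAbsent (i , j) c) t₀ ∧ check (withPresent (i , j) c) t₁
check c (crowd i js)      = crowds c i (digits js)
check c (use {d} _ σ)     = fits d c (digits σ)

-- Soundness of the certificate check

∈ᵇ⇒∈ : ∀ {i is} → T (i ∈ᵇ is) → i ∈ᴸ is
∈ᵇ⇒∈ {i} {is} h = Any.map (λ {j} → ≡ᵇ⇒≡ i j) (Anyₚ.any⁻ (i ≡ᵇ_) is h)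

all-∈ : ∀ {A : Set} (p : A → Bool) {xs} → T (all p xs) → ∀ {x} → x ∈ᴸ xs → T (p x)
all-∈ p {xs} h = All.lookup (Allₚ.all⁺ p xs h)

pairwise-T : ∀ {A : Set} (r : A → A → Bool) {xs} → T (pairwise r xs) →
             AllPairs (λ x y → T (r x y)) xs
pairwise-T r {[]}     _ = []
pairwise-T r {x ∷ xs} h with ∧-T {all (r x) xs} h
... | hx , hxs = Allₚ.all⁺ (r x) xs hx ∷ pairwise-T r hxs

module _ {n} (G : Graph n) (f : Slots n) where

  private
    J : Pair → Set
    J = Joined G f

  joined-≈ : ∀ {e e′} → T (e ≈ᵇ e′) → J e → J e′
  joined-≈ {i , j} {k , l} h (u , v , fi , fj , uv) with ∨-T {i ≡ᵇ k ∧ j ≡ᵇ l} h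
  ... | inj₁ h₁ with ∧-T {i ≡ᵇ k} h₁
  ...   | a , b with ≡ᵇ⇒≡ i k a | ≡ᵇ⇒≡ j l b
  ...     | refl | refl = u , v , fi , fj , uv
  joined-≈ {i , j} {k , l} h (u , v , fi , fj , uv) | inj₂ h₂ with ∧-T {i ≡ᵇ l} h₂
  ...   | a , b with ≡ᵇ⇒≡ i l a | ≡ᵇ⇒≡ j k b
  ...     | refl | refl = v , u , fj , fi , symm G uv

  ≈ᵇ-sym : ∀ {e e′} → T (e ≈ᵇ e′) → T (e′ ≈ᵇ e)
  ≈ᵇ-sym {i , j} {k , l} h with ∨-T {i ≡ᵇ k ∧ j ≡ᵇ l} h
  ... | inj₁ h₁ with ∧-T {i ≡ᵇ k} h₁
  ...   | a , b with ≡ᵇ⇒≡ i k a | ≡ᵇ⇒≡ j l b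
  ...     | refl | refl = h
  ≈ᵇ-sym {i , j} {k , l} h | inj₂ h₂ with ∧-T {i ≡ᵇ l} h₂
  ...   | a , b with ≡ᵇ⇒≡ i l a | ≡ᵇ⇒≡ j k b
  ...     | refl | refl = Equivalence.from T-∨ (inj₂ (Equivalence.from T-∧ (b , a)))

  joined-∈ : ∀ {e es} → T (e ∈ᴾ es) → All J es → J e
  joined-∈ {e} {es} h js with Any.map (λ {e′} → ≈ᵇ-sym {e} {e′}) (Anyₚ.any⁻ (e ≈ᵇ_) es h)
  ... | found = go found js
    where
    go : ∀ {es} → Any (λ e′ → T (e′ ≈ᵇ e)) es → All J es → J e
    go {e′ ∷ _} (here e′≈e) (j ∷ _)  = joined-≈ {e′} e′≈e j
    go (there a)            (_ ∷ js) = go a js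

  ¬joined-∈ : ∀ {e es} → T (e ∈ᴾ es) → All (λ e → ¬ J e) es → ¬ J e
  ¬joined-∈ {e} {es} h js je = go (Anyₚ.any⁻ (e ≈ᵇ_) es h) js
    where
    go : ∀ {es} → Any (λ e′ → T (e ≈ᵇ e′)) es → ¬ All (λ e → ¬ J e) es
    go (here e≈e′) (¬j ∷ _)  = ¬j (joined-≈ {e} e≈e′ je)
    go (there a)   (_ ∷ js) = go a js

  -- The empty set for a vacant slot merely keeps the function total; facts about edges are drawn
  -- only from joined pairs.
  ⟦_⟧ : ℕ → Subset n
  ⟦ i ⟧ = maybe′ ⁅_⁆ ∅ (f i)

  ⟦_⟧ᴾ : Pair → Subset n
  ⟦ i , j ⟧ᴾ = ⟦ i ⟧ ∪ ⟦ j ⟧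

  ⟦_⟧ᵀ : Triple → Subset n
  ⟦ i , j , k ⟧ᵀ = ⟦ i ⟧ ∪ ⟦ j ⟧ ∪ ⟦ k ⟧

  ⟦⟧-just : ∀ {i v} → f i ≡ just v → ⟦ i ⟧ ≡ ⁅ v ⁆
  ⟦⟧-just eq rewrite eq = refl

  ⟦⟧-≈ : ∀ {e e′} → T (e ≈ᵇ e′) → ⟦ e ⟧ᴾ ≡ ⟦ e′ ⟧ᴾ
  ⟦⟧-≈ {i , j} {k , l} h with ∨-T {i ≡ᵇ k ∧ j ≡ᵇ l} h
  ... | inj₁ h₁ with ∧-T {i ≡ᵇ k} h₁
  ...   | a , b with ≡ᵇ⇒≡ i k a | ≡ᵇ⇒≡ j l b
  ...     | refl | refl = refl
  ⟦⟧-≈ {i , j} {k , l} h | inj₂ h₂ with ∧-T {i ≡ᵇ l} h₂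
  ...   | a , b with ≡ᵇ⇒≡ i l a | ≡ᵇ⇒≡ j k b
  ...     | refl | refl = ∪-comm _ _

  -- The filter is what permits undecided pairs in `D` and `X`.
  edges-of : List Pair → List (Subset n)
  edges-of es = map ⟦_⟧ᴾ (filter (joined? G f) es)

  edge-∈ : ∀ {e es} → T (e ∈ᴾ es) → J e → ⟦ e ⟧ᴾ ∈ᴸ edges-of es
  edge-∈ {e} {es} h je with find (Anyₚ.any⁻ (e ≈ᵇ_) es h)
  ... | e′ , e′∈ , e≈e′ = subst (_∈ᴸ edges-of es) (sym (⟦⟧-≈ {e} {e′} e≈e′))
    (∈-map⁺ ⟦_⟧ᴾ (∈-filter⁺ (joined? G f) e′∈ (joined-≈ {e} {e′} e≈e′ je)))

  ⟦⟧-edge : ∀ {e} ((u , v , _) : J e) → ⟦ e ⟧ᴾ ≡ edge u v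
  ⟦⟧-edge (u , v , fi , fj , _) = cong₂ _∪_ (⟦⟧-just fi) (⟦⟧-just fj)

  ⟦⟧-isEdge : ∀ {e} → J e → IsEdge G ⟦ e ⟧ᴾ
  ⟦⟧-isEdge je@(u , v , _ , _ , uv) = u , v , uv , ⟦⟧-edge je

  JoinedTriple : Triple → Set
  JoinedTriple t = All J (sides t)

  ⟦⟧-triangle : ∀ {t} → JoinedTriple t → ∃ λ u → ∃₂ λ v w →
                f (proj₁ t) ≡ just u × f (proj₁ (proj₂ t)) ≡ just v × f (proj₂ (proj₂ t)) ≡ just w ×
                Adj G u v × Adj G v w × Adj G u w × ⟦ t ⟧ᵀ ≡ triangle u v w
  ⟦⟧-triangle ((u , v , fi , fj , uv) ∷ (v′ , w , fj′ , fk , vw) ∷ (u′ , w′ , fi′ , fk′ , uw) ∷ [])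
    with just-injective (trans (sym fj) fj′) | just-injective (trans (sym fi) fi′)
       | just-injective (trans (sym fk) fk′)
  ... | refl | refl | refl = u , v , w , fi , fj , fk , uv , vw , uw ,
    cong₂ _∪_ (⟦⟧-just fi) (cong₂ _∪_ (⟦⟧-just fj) (⟦⟧-just fk))

  ⟦⟧-isTriangle : ∀ {t} → JoinedTriple t → IsTriangle G ⟦ t ⟧ᵀ
  ⟦⟧-isTriangle jt with ⟦⟧-triangle jt
  ... | u , v , w , _ , _ , _ , uv , vw , uw , eq = u , v , w , uv , vw , uw , eq

  side-of : ∀ {t e} → JoinedTriple t → IsEdge G e → e ⊆ ⟦ t ⟧ᵀ → ∃ λ s → s ∈ᴸ sides t × J s × e ≡ ⟦ s ⟧ᴾ
  side-of {i , j , k} jt e∈G e⊆ with ⟦⟧-triangle jt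
  ... | u , v , w , fi , fj , fk , uv , vw , uw , eq
    with edge-⊆-triangle G e∈G (λ x∈ → subst (_ ∈_) eq (e⊆ x∈)) | jt
  ... | inj₁ refl | juv ∷ _ =
    _ , here refl , juv , sym (cong₂ _∪_ (⟦⟧-just fi) (⟦⟧-just fj))
  ... | inj₂ (inj₁ refl) | _ ∷ jvw ∷ _ =
    _ , there (here refl) , jvw , sym (cong₂ _∪_ (⟦⟧-just fj) (⟦⟧-just fk))
  ... | inj₂ (inj₂ refl) | _ ∷ _ ∷ juw ∷ [] =
    _ , there (there (here refl)) , juw , sym (cong₂ _∪_ (⟦⟧-just fi) (⟦⟧-just fk))

module _ {n} {G : Graph n} {f : Slots n} {c : Configuration} (r : Realises G f c) where
  open Realises r

  private
    ≈ᵇ-intro : ∀ {i j k l} → (i ≡ k × j ≡ l) ⊎ (i ≡ l × j ≡ k) → T ((i , j) ≈ᵇ (k , l))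
    ≈ᵇ-intro {i} {j} (inj₁ (refl , refl)) =
      Equivalence.from (T-∨ {i ≡ᵇ i ∧ j ≡ᵇ j})
        (inj₁ (Equivalence.from T-∧ (≡⇒≡ᵇ i i refl , ≡⇒≡ᵇ j j refl)))
    ≈ᵇ-intro {i} {j} (inj₂ (refl , refl)) =
      Equivalence.from (T-∨ {i ≡ᵇ j ∧ j ≡ᵇ i})
        (inj₂ (Equivalence.from T-∧ (≡⇒≡ᵇ i i refl , ≡⇒≡ᵇ j j refl)))

  -- As no vertex fills two slots, an edge determines its pair of slots. This turns the test that
  -- two triples have no common side into edge-disjointness of the triangles.
  pair-injective : ∀ {e e′} → Joined G f e → Joined G f e′ → ⟦_⟧ᴾ G f e ≡ ⟦_⟧ᴾ G f e′ → T (e ≈ᵇ e′)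
  pair-injective je@(_ , _ , fi , fj , _) je′@(_ , _ , fk , fl , _) eq
    with edge-injective (trans (sym (⟦⟧-edge G f je)) (trans eq (⟦⟧-edge G f je′)))
  ... | inj₁ (refl , refl) = ≈ᵇ-intro (inj₁ (injective fi fk , injective fj fl))
  ... | inj₂ (refl , refl) = ≈ᵇ-intro (inj₂ (injective fi fl , injective fj fk))

  reduces-sound : ∀ D X Y → T (reduces c D X Y) → Reduction G
  reduces-sound D X Y h
    with h₁ , h  ← ∧-T {all (λ t → all (_∈ᴾ present c) (sides t)) Y} h
    with h₂ , h  ← ∧-T {pairwise disjointᵇ Y} h
    with h₃ , h  ← ∧-T {all (λ t → all (λ e → e ∈ᴾ X ∨ e ∈ᴾ D) (sides t)) Y} h
    with h₄ , h  ← ∧-T {all (hit c X) D} h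
    with h₅ , h₆ ← ∧-T {length X ≤ᵇ 2 * length Y} h
    = record
    { X           = edges-of G f X
    ; D           = edges-of G f D
    ; Y           = map (⟦_⟧ᵀ G f) Y
    ; X-edges     = Allₚ.map⁺ (All.map (⟦⟧-isEdge G f) (Allₚ.all-filter (joined? G f) X))
    ; Y-triangles = Allₚ.map⁺ (All.tabulate λ t∈Y → ⟦⟧-isTriangle G f (joinedY t∈Y))
    ; Y-disjoint  = AllPairsₚ.map⁺ (disjoint Y (λ t∈ → joinedY t∈) (pairwise-T disjointᵇ h₂))
    ; Y-edges     = Y-edges
    ; D-hit       = D-hit
    ; small       = ≤-trans (≤-reflexive (length-map (⟦_⟧ᴾ G f) (filter (joined? G f) X)))
                      (≤-trans (length-filter (joined? G f) X) (≤-trans (≤ᵇ⇒≤ (length X) _ h₅)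
                        (≤-reflexive (cong (2 *_) (sym (length-map (⟦_⟧ᵀ G f) Y))))))
    ; nontrivial  = nontrivial (present c) isPresent (Anyₚ.any⁻ _ (present c) h₆)
    }
    where
    joinedY : ∀ {t} → t ∈ᴸ Y → JoinedTriple G f t
    joinedY {t} t∈Y = All.map (λ e∈ → joined-∈ G f e∈ isPresent)
      (Allₚ.all⁺ (_∈ᴾ present c) (sides t) (all-∈ (λ t → all (_∈ᴾ present c) (sides t)) h₁ t∈Y))

    inXD : ∀ {e} → T (e ∈ᴾ X ∨ e ∈ᴾ D) → Joined G f e →
           ⟦_⟧ᴾ G f e ∈ᴸ edges-of G f X ++ edges-of G f D
    inXD {e} e∈ je with ∨-T {e ∈ᴾ X} e∈
    ... | inj₁ e∈X = ∈-++⁺ˡ (edge-∈ G f {es = X} e∈X je)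
    ... | inj₂ e∈D = ∈-++⁺ʳ (edges-of G f X) (edge-∈ G f {es = D} e∈D je)

    disjoint : ∀ Y → (∀ {t} → t ∈ᴸ Y → JoinedTriple G f t) → AllPairs (λ s t → T (disjointᵇ s t)) Y →
               AllPairs (λ s t → EdgeDisjoint G (⟦_⟧ᵀ G f s) (⟦_⟧ᵀ G f t)) Y
    disjoint []      j []       = []
    disjoint (t ∷ Y) j (# ∷ #s) = All.tabulate sep ∷ disjoint Y (λ t∈ → j (there t∈)) #s
      where
      sep : ∀ {s} → s ∈ᴸ Y → EdgeDisjoint G (⟦_⟧ᵀ G f t) (⟦_⟧ᵀ G f s)
      sep {s} s∈Y e e∈G (e⊆t , e⊆s)
        with side-of G f (j (here refl)) e∈G e⊆t | side-of G f (j (there s∈Y)) e∈G e⊆s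
      -- A common edge would be a side of both triples, against `disjointᵇ`.
      ... | p , p∈t , jp , e≡p | q , q∈s , jq , e≡q =
        not-T (All.lookup # s∈Y) (Anyₚ.any⁺ (isSide t) (Any.map
          (λ { refl → Anyₚ.any⁺ (q ≈ᵇ_) (Any.map
            (λ { refl → pair-injective jq jp (trans (sym e≡q) e≡p) }) p∈t) }) q∈s))

    Y-edges : ∀ {t e} → t ∈ᴸ map (⟦_⟧ᵀ G f) Y → IsEdge G e → e ⊆ t →
              e ∈ᴸ edges-of G f X ++ edges-of G f D
    Y-edges t∈ e∈G e⊆ with ∈-map⁻ (⟦_⟧ᵀ G f) t∈
    ... | t , t∈Y , refl with side-of G f (joinedY t∈Y) e∈G e⊆
    ...   | s , s∈t , js , refl = inXD (all-∈ (λ e → e ∈ᴾ X ∨ e ∈ᴾ D)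
            (all-∈ (λ t → all (λ e → e ∈ᴾ X ∨ e ∈ᴾ D) (sides t)) h₃ t∈Y) s∈t) js

    nontrivial : ∀ es → All (Joined G f) es → Any (λ e → T (e ∈ᴾ X ∨ e ∈ᴾ D)) es →
                 ∃ λ e → IsEdge G e × e ∈ᴸ edges-of G f X ++ edges-of G f D
    nontrivial (e ∷ _) (je ∷ _) (here e∈)  = ⟦_⟧ᴾ G f e , ⟦⟧-isEdge G f je , inXD e∈ je
    nontrivial (_ ∷ es) (_ ∷ js) (there a) = nontrivial es js a

    hit-sound : ∀ {i j u v w} → (i , j) ∈ᴸ D → f i ≡ just u → f j ≡ just v →
                Adj G u v → Adj G v w → Adj G u w →
                edge u v ∈ᴸ edges-of G f X ⊎ edge v w ∈ᴸ edges-of G f X ⊎ edge u w ∈ᴸ edges-of G f X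
    hit-sound {i} {j} {u} {v} {w} ij∈D fi fj uv vw uw
      with hi , hk ← ∧-T {i ∈ᵇ closed c} (all-∈ (hit c X) h₄ ij∈D)
      with k , fk ← isClosed (∈ᵇ⇒∈ hi) fi uw
      with ∨-T {k ≡ᵇ i} (all-∈ _ hk (∈-upTo⁺ (bounded fk)))
    -- The exempt values of `k` would make the third vertex of the triangle equal to one of the
    -- first two.
    ... | inj₁ k≡i rewrite ≡ᵇ⇒≡ k i k≡i =
      ⊥-elim (irrefl G (just-injective (trans (sym fi) fk)) uw)
    ... | inj₂ h with ∨-T {k ≡ᵇ j} h
    ...   | inj₁ k≡j rewrite ≡ᵇ⇒≡ k j k≡j =
      ⊥-elim (irrefl G (just-injective (trans (sym fj) fk)) vw)
    ...   | inj₂ h′ = blocked⇒ (Anyₚ.any⁻ _ (sides (i , j , k)) h′)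
      where
      member : ∀ {e} → T (e ∈ᴾ X ∨ e ∈ᴾ absent c) → (je : Joined G f e) →
               edge (proj₁ je) (proj₁ (proj₂ je)) ∈ᴸ edges-of G f X
      member {e} b je with ∨-T {e ∈ᴾ X} b
      ... | inj₁ e∈X = subst (_∈ᴸ edges-of G f X) (⟦⟧-edge G f je) (edge-∈ G f {es = X} e∈X je)
      ... | inj₂ e∈A = ⊥-elim (¬joined-∈ G f e∈A isAbsent je)
      blocked⇒ : Any (λ e → T (e ∈ᴾ X ∨ e ∈ᴾ absent c)) (sides (i , j , k)) → _
      blocked⇒ (here b)                 = inj₁ (member {i , j} b (u , v , fi , fj , uv))
      blocked⇒ (there (here b))         = inj₂ (inj₁ (member {j , k} b (v , w , fj , fk , vw)))
      blocked⇒ (there (there (here b))) = inj₂ (inj₂ (member {i , k} b (u , w , fi , fk , uw)))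

    D-hit : ∀ {u v w} → Adj G u v → Adj G v w → Adj G u w → edge u v ∈ᴸ edges-of G f D →
            edge u v ∈ᴸ edges-of G f X ⊎ edge v w ∈ᴸ edges-of G f X ⊎ edge u w ∈ᴸ edges-of G f X
    D-hit {u} {v} {w} uv vw uw uv∈ with ∈-map⁻ (⟦_⟧ᴾ G f) uv∈
    ... | (i , j) , ij∈ , eq with ∈-filter⁻ (joined? G f) {xs = D} ij∈
    ...   | ij∈D , jij@(x , y , fi , fj , _) with edge-injective (trans eq (⟦⟧-edge G f jij))
    ...     | inj₁ (refl , refl) = hit-sound ij∈D fi fj uv vw uw
    ...     | inj₂ (refl , refl) with hit-sound ij∈D fi fj (symm G uv) uw vw
    ...       | inj₁ m        = inj₁ (subst (_∈ᴸ edges-of G f X) (∪-comm ⁅ v ⁆ ⁅ u ⁆) m)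
    ...       | inj₂ (inj₁ m) = inj₂ (inj₂ m)
    ...       | inj₂ (inj₂ m) = inj₂ (inj₁ m)

  neighbours : ∀ {i v} → f i ≡ just v → ∀ js → All (λ j → T ((i , j) ∈ᴾ present c)) js →
               AllPairs (λ j k → T (not (j ≡ᵇ k))) js →
               ∃ λ ws → Unique ws × All (Adj G v) ws × length ws ≡ length js ×
                        All (λ w → ∃ λ j → j ∈ᴸ js × f j ≡ just w) ws
  neighbours fi []       _        _        = [] , [] , [] , refl , []
  neighbours {i} fi (j ∷ js) (h ∷ hs) (# ∷ #s)
    with ws , ws! , adj , len , from ← neighbours fi js hs #s
    with v′ , w , fi′ , fj , vw ← joined-∈ G f {i , j} h isPresent
    with refl ← just-injective (trans (sym fi) fi′)
    = w ∷ ws ,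
      All.map (λ { (k , k∈ , fk) refl →
        not-T (All.lookup # k∈) (≡⇒≡ᵇ j k (injective fj fk)) }) from ∷ ws! ,
      vw ∷ adj , cong suc len ,
      (j , here refl , fj) ∷ All.map (λ (k , k∈ , fk) → k , there k∈ , fk) from

  crowds-sound : ∀ i js → T (crowds c i js) → Reduction G
  -- The vertex in slot `i` is obtained from the first joined pair, so the empty list, which fails
  -- the test, is treated apart.
  crowds-sound i []       h = ⊥-elim (proj₂ (∧-T {i ∈ᵇ low c} h))
  crowds-sound i js@(j₀ ∷ js′) h
    with h₁ , h  ← ∧-T {i ∈ᵇ low c} h
    with h₂ , h  ← ∧-T {7 ≤ᵇ length js} h
    with h₃ , h₄ ← ∧-T {pairwise (λ j k → not (j ≡ᵇ k)) js} h
    with joined-∈ G f {i , j₀} (all-∈ (λ j → (i , j) ∈ᴾ present c) {js} h₄ (here refl)) isPresent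
  ... | v , _ , fi , _
    with ws , ws! , adj , len , _ ← neighbours fi js (Allₚ.all⁺ _ js h₄) (pairwise-T _ {js} h₃)
    = ⊥-elim (<⇒≱ (≤ᵇ⇒≤ 7 (length js) h₂)
        (subst (_≤ 6) len (isLow (∈ᵇ⇒∈ {i} {low c} h₁) fi ws! adj)))

  -- By `bounded`, `f` is vacant from `slots c` on. So an occupied slot has its image below
  -- `slots c`, where the entries of `σ` do not repeat.
  fits-sound : ∀ d σ → T (fits d c σ) → Realises G (λ i → f (at (slots c) σ i)) d
  fits-sound d σ h
    with h₁ , h  ← ∧-T {length σ ≤ᵇ slots d} h
    with h₂ , h  ← ∧-T {pairwise (λ i j → slots c ≤ᵇ i ∨ not (i ≡ᵇ j)) σ} h
    with h₃ , h  ← ∧-T {all _ (closed d)} h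
    with h₄ , h  ← ∧-T {all _ (low d)} h
    with h₅ , h₆ ← ∧-T {all _ (present d)} h
    = record
    { bounded   = λ fi → ≤-trans (at-< σ fi) (≤ᵇ⇒≤ (length σ) _ h₁)
    ; injective = λ fi fj →
        at-injective σ (pairwise-T _ h₂) _ _ (bounded fi) (bounded fj) (injective fi fj)
    ; isClosed  = closed-sound
    ; isLow     = λ i∈ → isLow (∈ᵇ⇒∈ (all-∈ _ h₄ i∈))
    ; isPresent = All.tabulate λ { {i , j} e∈ → joined-∈ G f (all-∈ _ h₅ e∈) isPresent }
    ; isAbsent  = All.tabulate λ { {i , j} e∈ → absent-sound (all-∈ _ h₆ e∈) }
    }
    where
    s : ℕ → ℕ
    s = at (slots c) σ

    at-< : ∀ σ {i v} → f (at (slots c) σ i) ≡ just v → i < length σ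
    at-< []      {i}     fi = ⊥-elim (<-irrefl refl (bounded fi))
    at-< (_ ∷ σ) {zero}  fi = s≤s z≤n
    at-< (_ ∷ σ) {suc i} fi = s≤s (at-< σ fi)

    at-∈ : ∀ σ i → at (slots c) σ i < slots c → at (slots c) σ i ∈ᴸ σ
    at-∈ []      i       lt = ⊥-elim (<-irrefl refl lt)
    at-∈ (x ∷ σ) zero    lt = here refl
    at-∈ (x ∷ σ) (suc i) lt = there (at-∈ σ i lt)

    ∈-at : ∀ {x} σ → x ∈ᴸ σ → ∃ λ i → at (slots c) σ i ≡ x
    ∈-at (x ∷ σ) (here refl) = 0 , refl
    ∈-at (x ∷ σ) (there x∈)  with ∈-at σ x∈
    ... | i , eq = suc i , eq

    clash : ∀ {x y} → T (slots c ≤ᵇ x ∨ not (x ≡ᵇ y)) → x < slots c → x ≢ y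
    clash {x} {y} h lt x≡y with ∨-T {slots c ≤ᵇ x} h
    ... | inj₁ le  = <⇒≱ lt (≤ᵇ⇒≤ (slots c) x le)
    ... | inj₂ neq = not-T neq (≡⇒≡ᵇ x y x≡y)

    at-injective : ∀ σ → AllPairs (λ i j → T (slots c ≤ᵇ i ∨ not (i ≡ᵇ j))) σ → ∀ i j →
                   at (slots c) σ i < slots c → at (slots c) σ j < slots c →
                   at (slots c) σ i ≡ at (slots c) σ j → i ≡ j
    at-injective []      _        i       j       lt _  _ = ⊥-elim (<-irrefl refl lt)
    at-injective (x ∷ σ) _        zero    zero    _  _  _ = refl
    at-injective (x ∷ σ) (# ∷ _)  zero    (suc j) lt lt′ eq =
      ⊥-elim (clash (All.lookup # (at-∈ σ j lt′)) lt eq)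
    at-injective (x ∷ σ) (# ∷ _)  (suc i) zero    lt lt′ eq =
      ⊥-elim (clash (All.lookup # (at-∈ σ i lt)) lt′ (sym eq))
    at-injective (x ∷ σ) (_ ∷ #s) (suc i) (suc j) lt lt′ eq =
      cong suc (at-injective σ #s i j lt lt′ eq)

    closed-sound : ∀ {i v w} → i ∈ᴸ closed d → f (s i) ≡ just v → Adj G v w →
                   ∃ λ j → f (s j) ≡ just w
    closed-sound {i} {v} {w} i∈ fi vw
      with hc , hk ← ∧-T {s i ∈ᵇ closed c} (all-∈ _ h₃ i∈)
      with k , fk ← isClosed (∈ᵇ⇒∈ hc) fi vw
      -- The neighbour sits in some slot `k` of `c`: either `σ` reaches `k`, or the pair was known
      -- to be absent.
      with ∨-T {k ∈ᵇ σ} (all-∈ _ hk (∈-upTo⁺ (bounded fk)))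
    ... | inj₁ k∈σ with ∈-at σ (∈ᵇ⇒∈ {k} {σ} k∈σ)
    ...   | j , eq = j , trans (cong f eq) fk
    closed-sound {i} {v} {w} i∈ fi vw | inj₂ ik∈A =
      ⊥-elim (¬joined-∈ G f ik∈A isAbsent (v , w , fi , fk , vw))

    absent-sound : ∀ {i j} → T (slots c ≤ᵇ s i ∨ slots c ≤ᵇ s j ∨ (s i , s j) ∈ᴾ absent c) →
                   ¬ Joined G f (s i , s j)
    absent-sound {i} {j} h jij@(u , v , fi , fj , _) with ∨-T {slots c ≤ᵇ s i} h
    ... | inj₁ le = <⇒≱ (bounded fi) (≤ᵇ⇒≤ (slots c) (s i) le)
    ... | inj₂ h′ with ∨-T {slots c ≤ᵇ s j} h′
    ...   | inj₁ le = <⇒≱ (bounded fj) (≤ᵇ⇒≤ (slots c) (s j) le)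
    ...   | inj₂ ∈A = ¬joined-∈ G f ∈A isAbsent jij

-- Proof by reflection: on a concrete certificate `check` evaluates to `true`, so each of the lemmas
-- below is proved by `tt`.
certify : ∀ c t → T (check c t) → Reducible c
certify c (reduce D X Y)    h G f r =
  reduces-sound r (pairs (digits D)) (pairs (digits X)) (triples (digits Y)) h
certify c (crowd i js)      h G f r = crowds-sound r i (digits js) h
certify c (use {d} red σ)   h G f r = red G _ (fits-sound r d (digits σ) h)
certify c (split i j t₀ t₁) h G f r
  with h₀ , h₁ ← ∧-T {check (withAbsent (i , j) c) t₀} h
  with joined? G f (i , j)
... | yes ij = certify (withPresent (i , j) c) t₁ h₁ G f (record
  { bounded = bounded ; injective = injective ; isClosed = isClosed ; isLow = isLow
  ; isPresent = ij ∷ isPresent ; isAbsent = isAbsent })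
  where open Realises r
... | no ¬ij = certify (withAbsent (i , j) c) t₀ h₀ G f (record
  { bounded = bounded ; injective = injective ; isClosed = isClosed ; isLow = isLow
  ; isPresent = isPresent ; isAbsent = ¬ij ∷ isAbsent })
  where open Realises r

-- Each lemma splits on whether two slots are joined until X, D and Y can be given or an earlier
-- lemma applies under a renaming of the slots.  The case trees were found by a computer search.

reducible1 : Reducible (setup 7 "0" "" "01 04 14" "03 05 06")
-- The undecided pair 02 is put in X against the triangles 012 and 024; 14 is there as a side of the
-- packed triangle.
reducible1 = certify _ (reduce "01 04" "02 14" "014") tt

reducible2 : Reducible (setup 7 "0" "" "01 04" "02 03 05 06")
-- The first branch of a split is the one where the pair is absent. Here 01 then lies in no triangle
-- and is deleted at no cost.
reducible2 = certify _ (split 1 4 (reduce "01" "" "") (use reducible1 "0123456")) tt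

reducible3 : Reducible (setup 7 "0" "" "01 03 04" "02 05 06")
reducible3 = certify _
  (split 3 4
   (split 1 3 (reduce "03" "" "") (use reducible1 "0142356"))
   (use reducible1 "0312456")) tt

reducible4 : Reducible (setup 7 "0" "" "01 03" "02 05 06")
reducible4 = certify _ (split 0 4 (use reducible2 "0124356") (use reducible3 "0123456")) tt

reducible5 : Reducible (setup 7 "0" "" "01 02 03 04" "05 06 12 14")
reducible5 = certify _
  (split 1 3
   (reduce "01" "" "")
   (split 2 4
    (reduce "01 02 03 04" "03 13" "013")
    (reduce "01 02 03 04" "13 23 24 34" "013 024"))) tt

reducible6 : Reducible (setup 7 "0" "" "01 02 03 04" "05 06 12")
reducible6 = certify _
  (split 1 4
   (use reducible5 "0123456")
   (split 2 3 (use reducible5 "0214356") (reduce "01 02 03 04" "03 14 23 24" "014 023"))) tt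

reducible7 : Reducible (setup 7 "0" "" "01 02 03 04 12 34" "05 06")
-- A perfect matching 12, 34 in the link: the spokes 01 and 02 cover every link edge but 34, and 12
-- is added as a side of 012.
reducible7 = certify _ (reduce "01 02 03 04" "01 02 12 34" "012 034") tt

reducible8 : Reducible (setup 7 "0" "" "01 02 03 04" "05 06")
reducible8 = certify _
  (split 1 2
   (use reducible6 "0123456")
   (split 3 4 (use reducible6 "0341256") (use reducible7 "0123456"))) tt

reducible9 : Reducible (setup 7 "0" "" "01 02 03" "05 06")
reducible9 = certify _ (split 0 4 (use reducible3 "0142356") (use reducible8 "0123456")) tt

reducible10 : Reducible (setup 7 "0" "" "01 02" "05 06")
reducible10 = certify _ (split 0 3 (use reducible4 "0132456") (use reducible9 "0123456")) tt

-- From here on a closed vertex that has a neighbour may be taken to have degree at least five.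
reducible11 : Reducible (setup 7 "0" "" "01" "05 06")
reducible11 = certify _
  (split 0 2
   (split 0 3
    (split 0 4 (reduce "01" "" "") (use reducible2 "0123456"))
    (use reducible4 "0123456"))
   (use reducible10 "0123456")) tt

-- The link of a closed vertex of degree five

reducible12 : Reducible (setup 7 "0" "" "01 03 04 05 14 35" "12 13 15 23 25")
-- The spokes 04 and 06 leave only the link edge 35 on slots 1, 2, 3, 5; the fourth element 14 is a
-- side of 014. Since 06 may be present, the lemma serves degree six too.
reducible12 = certify _ (reduce "01 02 03 04 05" "04 06 14 35" "014 035") tt

reducible13 : Reducible (setup 7 "0" "" "01 02 03 04 05 14" "06 12 13 15 16 23 26 56")
reducible13 = certify _
  (split 2 5
   (split 3 5 (reduce "01 02 03 04 05" "04 14" "014") (use reducible12 "0123456"))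
   (use reducible12 "0162453")) tt

reducible14 : Reducible (setup 7 "0" "" "01 02 03 04 05" "06 12 13 15 16 26 36 56")
reducible14 = certify _
  (split 1 4
   (reduce "01" "" "")
   (split 2 3 (use reducible13 "0123456") (use reducible12 "0162435"))) tt

reducible15 : Reducible (setup 7 "0" "" "01 02 03 04 05 15" "06 12 13 16 26 36 46 56")
reducible15 = certify _
  (split 2 3
   (split 1 4
    (use reducible13 "0123546")
    (split 2 5 (use reducible14 "0213456") (reduce "01 02 03 04 05" "04 05 14 25" "025 014")))
   (use reducible12 "0162534")) tt

reducible16 : Reducible (setup 7 "0" "" "01 02 03 04 05" "06 12 13 16 26 36 46 56")
reducible16 = certify _ (split 1 5 (use reducible14 "0123456") (use reducible15 "0123456")) tt

-- With this, each neighbour of a closed vertex of degree five misses at most one other neighbour: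
-- the complement of the link is a matching.
reducible17 : Reducible (setup 9 "0" "" "02 05 06 07 08" "01 03 04 25 26")
-- Slot 6 of `reducible16` is left vacant, which settles its absent pairs 06, 16, 26, 36, 46 and 56.
reducible17 = certify _ (use reducible16 "025678x") tt

-- The link is K₅ less two disjoint edges. Its eight edges meet every triangle at 0, and four
-- edge-disjoint triangles exist, two of them inside the link.
reducible18 : Reducible (setup 7 "0" "" "01 02 03 04 13 14 15 23 24 25 35 45" "06 12 34")
reducible18 = certify _ (reduce "01 02 03 04 05" "13 14 15 23 24 25 35 45" "013 145 024 235") tt

reducible19 : Reducible (setup 7 "0" "" "01 02 03 04 05 13 14 15 23 24 25 35" "06 12 34 36 46 56")
reducible19 = certify _ (split 4 5 (use reducible12 "0463152") (use reducible18 "0123456")) tt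

reducible20 : Reducible
  (setup 7 "0" "" "01 02 03 04 05 13 14 15 23 24 25" "06 12 16 26 34 36 46 56")
reducible20 = certify _ (split 3 5 (use reducible15 "0345216") (use reducible19 "0123456")) tt

reducible21 : Reducible (setup 7 "0" "" "01 02 03 04 05 13 14 15" "06 12 16 26 34 36 46 56")
reducible21 = certify _
  (split 2 3
   (use reducible15 "0324516")
   (split 2 4
    (use reducible12 "0261345")
    (split 2 5 (use reducible12 "0261354") (use reducible20 "0123456")))) tt

-- Two disjoint missing pairs are now excluded as well, so the link of a closed vertex of degree
-- five may be taken to be K₅ or K₅ minus an edge.
reducible22 : Reducible (setup 9 "0" "" "02 05 06 07 08 26 27 28" "01 03 04 25 67")
reducible22 = certify _ (use reducible21 "025678x") tt

-- Two vertices of degree five with the same neighbourhood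

reducible23 : Reducible
  (setup 9 "01" "" "02 05 06 07 12 15 16 17 26 27 56 57 67 68 78" "03 04 13 14 25")
reducible23 = certify _
  -- The pair 01 is undecided and therefore in X, so that the lemma can also be applied to adjacent
  -- vertices.
  (reduce "02 05 06 07 08 12 15 16 17 18" "01 26 27 28 56 57 58 67 68 78" "056 157 027 678 126") tt

reducible24 : Reducible
  (setup 9 "01" "" "02 05 06 07 08 12 15 16 17 26 27 28 67 68" "01 03 04 13 14 25")
reducible24 = certify _
  (split 7 8
   (use reducible21 "025786x")
   (split 5 6
    (use reducible16 "052678x")
    (split 5 7 (use reducible12 "05x2678") (use reducible23 "012345678")))) tt

reducible25 : Reducible (setup 9 "01" "" "02 05 06 07 08 12 15 16 17 26 27 28" "01 03 04 13 14 25")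
reducible25 = certify _
  (split 6 7
   (use reducible22 "012345678")
   (split 6 8 (use reducible21 "025687x") (use reducible24 "012345678"))) tt

reducible26 : Reducible (setup 9 "01" "" "02 05 06 07 08 12 15 16 17 26 27" "01 03 04 13 14 25")
reducible26 = certify _ (split 2 8 (use reducible15 "025876x") (use reducible25 "012345678")) tt

reducible27 : Reducible (setup 9 "01" "" "02 05 06 07 08 12 15 16 17 26" "01 03 04 13 14 25")
reducible27 = certify _
  (split 2 7 (use reducible17 "012345768") (use reducible26 "012345678")) tt

reducible28 : Reducible (setup 9 "01" "" "02 05 06 07 08 12 15 16" "01 03 04 13 14")
reducible28 = certify _
  (split 1 7
   (use reducible9 "1256803")
   (split 1 8
    (use reducible8 "1256703")
    (split 2 5
     (split 2 6 (use reducible17 "012345678") (use reducible27 "012345678"))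
     (split 2 6
      (use reducible27 "012346578")
      (split 2 7
       (use reducible26 "012347568")
       (split 2 8
        (use reducible25 "012348567")
        (split 5 7
         (use reducible27 "015347268")
         (split 6 7
          (use reducible26 "017346258")
          (split 7 8
           (use reducible24 "017348256")
           -- The common link has at most ten edges, and five triangles are found in K₇ minus the
           -- edge 01.
           (reduce "02 05 06 07 08 12 15 16 17 18"
            "25 26 27 28 56 57 58 67 68 78" "025 067 157 126 278")))))))))) tt

-- Every neighbour of 1 is one of 0, because both miss slots 3 and 4. As degree at most four is
-- settled, the two neighbourhoods coincide.
reducible29 : Reducible (setup 9 "01" "" "02 05 06 07 08 12" "01 03 04 13 14")
reducible29 = certify _
  (split 1 5
   (use reducible11 "1267803")
   (split 1 6 (use reducible10 "1257803") (use reducible28 "012345678"))) tt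

-- Two vertices of degree five with four common neighbours

reducible30 : Reducible (setup 9 "2" "" "02 07 12 14 24 25 27 28 58" "01 04 23 26")
-- The link of slot 2 has the perfect matching 07, 14, 58. The spokes 25, 27, 28 cover all link
-- edges except 14, as 01 and 04 are absent; 07 and 58 are added as sides of packed triangles. Pairs
-- of D start with 2 because `hit` needs a closed slot first.
reducible30 = certify _ (reduce "20 21 24 25 27 28" "07 14 25 27 28 58" "124 027 258") tt

reducible31 : Reducible (setup 9 "02" "" "02 05 06 07 08 12 14 24 25 27" "01 03 04 23 26")
reducible31 = certify _
  (split 2 8
   (use reducible12 "20x1547")
   (split 5 8 (use reducible21 "026587x") (use reducible30 "012345678"))) tt

reducible32 : Reducible (setup 9 "2" "" "02 08 12 14 24 25 27 28 57" "01 03 04 13 26 34")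
reducible32 = certify _ (reduce "20 21 23 24 25 27 28" "08 14 25 27 28 57" "124 028 257") tt

reducible33 : Reducible (setup 9 "02" "" "02 05 06 07 08 12 14 24 25 27" "01 03 04 13 26 34")
reducible33 = certify _
  (split 2 8
   (use reducible12 "2031547")
   (split 5 7 (use reducible21 "026578x") (use reducible32 "012345678"))) tt

reducible34 : Reducible (setup 9 "2" "" "02 05 07 08 12 17 23 25 27 28 35 57" "01 03 13 15 26 37")
reducible34 = certify _
  (reduce "20 21 23 24 25 27 28" "05 07 08 17 24 28 35 57" "127 057 028 235") tt

reducible35 : Reducible (setup 9 "2" "" "02 05 12 14 23 24 25 27 37" "01 04 15 26 45")
reducible35 = certify _ (reduce "20 21 23 24 25 27 28" "05 14 23 27 28 37" "025 124 237") tt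

reducible36 : Reducible (setup 9 "012" "" "02 05 06 07 08 12 14 16 17 18" "01 03 04 13 15 26")
reducible36 = certify _
  (split 2 5
   (use reducible17 "012345678")
   (split 2 7
    (use reducible17 "012346758")
    (split 2 4
     (use reducible17 "102354678")
     (split 2 3
      (use reducible31 "012345678")
      (split 3 4
       (use reducible33 "012345678")
       (split 3 5
        (use reducible33 "102354678")
        (split 3 7
         (split 2 8
          (use reducible15 "026875x")
          (split 5 7 (use reducible21 "026578x") (use reducible34 "012345678")))
         (split 4 5 (use reducible35 "012345678") (use reducible34 "302184657"))))))))) tt

reducible37 : Reducible
  (setup 9 "01" "" "02 06 07 08 12 16 17 18 25 26 27 28 58 68 78" "01 03 04 13 57")
reducible37 = certify _
  (reduce "02 05 06 07 08 12 14 16 17 18" "14 25 26 27 28 56 58 67 68 78" "258 026 078 127 168") tt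

reducible38 : Reducible
  (setup 9 "01" "" "02 05 06 07 08 12 16 17 18 25 26 27 28 58 67 78" "01 03 04 13 57")
reducible38 = certify _
  (split 6 8 (use reducible22 "017345682") (use reducible37 "012345678")) tt

reducible39 : Reducible
  (setup 9 "01" "" "02 05 06 07 08 12 16 17 18 25 26 27 28 58" "01 03 04 13 57")
reducible39 = certify _
  (split 6 7
   (use reducible17 "017345628")
   (split 7 8 (use reducible12 "07x5286") (use reducible38 "012345678"))) tt

reducible40 : Reducible (setup 9 "01" "" "02 05 06 07 08 12 16 17 18 25 26 27 28" "01 03 04 13 57")
reducible40 = certify _
  (split 5 8 (use reducible17 "015347826") (use reducible39 "012345678")) tt

reducible41 : Reducible (setup 9 "01" "" "02 05 06 07 08 12 16 17 18 26 27 28" "01 03 04 13 57")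
reducible41 = certify _
  (split 2 5 (use reducible17 "015342768") (use reducible40 "012345678")) tt

reducible42 : Reducible (setup 9 "01" "" "02 05 06 07 08 12 16 17 18 26 27 28 57" "01 03 04 13 67")
reducible42 = certify _
  (split 2 5
   (use reducible22 "012345678")
   (split 5 6
    (use reducible12 "06x5278")
    (split 5 8
     (use reducible22 "015348672")
     (split 6 8
      (use reducible17 "016347825")
      (reduce "02 05 06 07 08 12 14 16 17 18"
       "14 25 26 27 28 56 57 58 68 78" "127 057 168 026 258"))))) tt

reducible43 : Reducible (setup 9 "01" "" "02 05 06 07 08 12 14 16 17 18 26 27 28" "01 03 04 13 15")
reducible43 = certify _
  (split 5 7
   (use reducible41 "012345678")
   (split 6 7
    (use reducible42 "012345678")
    (split 7 8
     (use reducible42 "012345876")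
     (split 6 8
      (split 2 5
       (use reducible22 "012345687")
       (reduce "02 05 06 07 08 12 14 16 17 18"
        "14 25 26 27 28 56 57 58 67 78" "257 026 078 128 167"))
      (split 2 4
       (use reducible41 "106354728")
       (split 4 6
        (use reducible40 "102354768")
        (split 4 8
         (use reducible37 "102354786")
         -- Ten pairs form the link of 1. The spoke 05 covers what the link of 0 has beyond them,
         -- and 57 is a side of 057: twelve against six triangles.
         (reduce "02 05 06 07 08 12 14 16 17 18"
          "05 24 26 27 28 46 47 48 57 67 68 78" "057 026 124 278 167 468")))))))) tt

reducible44 : Reducible (setup 9 "012" "" "02 05 06 07 08 12 14 16 17 18" "01 03 04 13 15")
reducible44 = certify _
  (split 2 6
   (use reducible36 "012345678")
   (split 2 7
    (use reducible36 "012345768")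
    (split 2 8 (use reducible36 "012345867") (use reducible43 "012345678")))) tt

reducible45 : Reducible (setup 9 "012" "" "02 05 06 07 08 12 14 16 17" "01 03 04 13 15")
reducible45 = certify _ (split 1 8 (use reducible8 "1246703") (use reducible44 "012345678")) tt

reducible46 : Reducible (setup 9 "012" "" "02 05 06 07 08 12 14 16" "01 03 04 13 15")
reducible46 = certify _ (split 1 7 (use reducible9 "1246803") (use reducible45 "012345678")) tt

-- A neighbourhood of size five contained in the other one

reducible47 : Reducible (setup 9 "01" "" "02 05 06 07 08 12 15 16 17 26 27 28" "01 03 04 13 25")
reducible47 = certify _
  (split 5 6
   (use reducible17 "015342678")
   (split 6 7 (use reducible22 "012345678") (use reducible42 "016348527"))) tt

reducible48 : Reducible (setup 9 "01" "" "02 05 06 07 08 12 15 16 17 26 27" "01 03 04 13 25")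
reducible48 = certify _
  (split 2 8 (use reducible17 "012345867") (use reducible47 "012345678")) tt

reducible49 : Reducible (setup 9 "01" "" "02 05 06 07 08 12 15 16 17 26" "01 03 04 13 25")
reducible49 = certify _
  (split 2 7 (use reducible17 "012345768") (use reducible48 "012345678")) tt

reducible50 : Reducible (setup 9 "01" "" "02 05 06 07 08 12 15 16 17" "01 03 04 13 25")
reducible50 = certify _
  (split 2 6 (use reducible17 "012345678") (use reducible49 "012345678")) tt

reducible51 : Reducible
  (setup 9 "01" "" "02 05 06 07 12 15 16 17 25 26 27 28 56 57 58 67 68 78" "03 04 13")
reducible51 = certify _
  -- Ten pairs in the common link, the spoke 14 for the possible sixth neighbour of 1, and 01 so
  -- that adjacent vertices are covered too.
  (reduce "02 05 06 07 08 12 14 15 16 17 18"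
   "01 14 25 26 27 28 56 57 58 67 68 78" "025 067 126 278 157 568") tt

reducible52 : Reducible (setup 9 "01" "" "02 05 06 07 08 12 15 16 17 18" "01 03 04 13")
reducible52 = certify _
  (split 2 5
   (use reducible50 "012345678")
   (split 2 6
    (use reducible49 "012346578")
    (split 2 7
     (use reducible48 "012347568")
     (split 2 8
      (use reducible47 "012348567")
      (split 5 6
       (use reducible40 "012346758")
       (split 5 8
        (use reducible39 "012345786")
        (split 6 7
         (use reducible39 "012346875")
         (split 6 8
          (use reducible38 "012348765")
          (split 7 8
           (use reducible37 "012348576")
           (split 5 7 (use reducible37 "012347856") (use reducible51 "012345678"))))))))))) tt

reducible53 : Reducible (setup 9 "012" "" "02 05 06 07 08 12 14" "01 03 04 13")
reducible53 = certify _
  (split 1 5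
   (split 1 6 (use reducible10 "1247803") (use reducible46 "012345678"))
   (split 1 6
    (use reducible46 "012346578")
    (split 1 7
     (use reducible45 "012347568")
     (split 1 8 (use reducible44 "012348567") (use reducible52 "012345678"))))) tt

-- Two vertices of degree five with three common neighbours

reducible54 : Reducible
  (setup 9 "01" "" "02 05 07 08 12 13 17 18 23 26 27 28 56 57 58 67 68 78" "01 03 04 15 16 25 37")
reducible54 = certify _
  (reduce "02 05 06 07 08 12 13 14 17 18"
   "14 23 26 27 28 38 56 57 58 67 68 78" "123 178 027 268 058 567") tt

reducible55 : Reducible
  (setup 9 "01" "" "02 05 07 08 12 13 14 17 18 26 27 28 56 57 58 67 68 78" "01 03 04 15 16 25 37")
reducible55 = certify _ (split 2 3 (use reducible16 "132748x") (use reducible54 "012345678")) tt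

reducible56 : Reducible
  (setup 9 "01" "" "02 05 07 08 12 13 14 17 24 26 27 28 37 47 48 56 57 58 67 68 78" "01 03 04 15 16 25")
reducible56 = certify _
  (reduce "02 05 06 07 08 12 13 14 17 18"
   "13 24 26 27 28 37 47 48 56 57 58 67 68 78" "137 124 478 027 268 058 567") tt

reducible57 : Reducible
  (setup 9 "01" "" "02 05 07 08 12 13 14 17 18 24 26 27 28 37 47 56 57 58 67 68 78" "01 03 04 15 16 25")
reducible57 = certify _
  (split 4 8 (use reducible54 "012435687") (use reducible56 "012345678")) tt

reducible58 : Reducible
  (setup 9 "012" "" "02 05 06 07 08 12 13 14 17 18 26 27 28" "01 03 04 15 16 25")
reducible58 = certify _
  (split 5 6
   (use reducible17 "015342678")
   (split 5 7
    (use reducible12 "05x2678")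
    (split 5 8
     (use reducible12 "05x2687")
     (split 6 7
      (use reducible22 "012345678")
      (split 6 8
       (use reducible19 "025687x")
       (split 7 8
        (use reducible18 "0257861")
        (split 2 4
         (use reducible31 "102567483")
         (split 3 7
          (use reducible55 "012345678")
          (split 4 7 (use reducible54 "012435678") (use reducible57 "012345678")))))))))) tt

reducible59 : Reducible (setup 9 "012" "" "02 05 06 07 08 12 13 14 17 18 26" "01 03 04 15 16 25")
reducible59 = certify _
  (split 2 7
   (use reducible17 "012345768")
   (split 2 8 (use reducible17 "012345867") (use reducible58 "012345678"))) tt

reducible60 : Reducible (setup 9 "012" "" "02 05 06 07 08 12 13 14 17 18" "01 03 04 15 16 25")
reducible60 = certify _
  (split 2 6 (use reducible17 "012345678") (use reducible59 "012345678")) tt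

reducible61 : Reducible
  (setup 9 "01" "" "02 05 06 07 12 13 14 17 18 26 28 57 67 68 78" "01 03 04 15 16 27")
reducible61 = certify _
  (split 2 3
   (use reducible17 "102563748")
   (split 2 4
    (use reducible17 "102564738")
    (split 4 7
     (use reducible12 "17x2843")
     (split 4 8
      (use reducible22 "102567483")
      (reduce "02 05 06 07 08 12 13 14 17 18"
       "05 13 23 24 26 28 47 48 57 67 68 78" "026 057 248 123 147 678"))))) tt

reducible62 : Reducible
  (setup 9 "01" "" "02 05 06 07 08 12 13 14 17 18 25 26 28" "01 03 04 15 16 27")
reducible62 = certify _
  (split 5 7
   (use reducible17 "017342568")
   (split 6 7
    (use reducible12 "07x2568")
    (split 6 8
     (use reducible22 "012347685")
     (split 7 8 (use reducible12 "07x2586") (use reducible61 "012345678"))))) tt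

reducible63 : Reducible (setup 9 "01" "" "02 05 06 07 08 12 13 14 17 18 25 26" "01 03 04 15 16 27")
reducible63 = certify _
  (split 2 8 (use reducible17 "012347856") (use reducible62 "012345678")) tt

reducible64 : Reducible
  (setup 9 "01" "" "05 06 07 08 12 14 17 18 24 25 26 27 28 57 58 67 68 78" "01 03 04 15 16 47 56")
reducible64 = certify _
  (reduce "02 05 06 07 08 12 13 14 17 18"
   "13 24 25 26 27 28 48 57 58 67 68 78" "124 178 057 258 068 267") tt

reducible65 : Reducible
  (setup 9 "012" "" "02 05 06 07 08 12 13 14 17 18 25 26 27 28 57 58 67" "01 03 04 15 16 56")
reducible65 = certify _
  (split 6 8
   (use reducible12 "06x5287")
   (split 7 8
    (use reducible18 "0567821")
    (split 2 3
     (use reducible60 "102563478")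
     (split 2 4
      (use reducible58 "102564378")
      (split 4 7
       (use reducible64 "012345678")
       (split 4 8
        (use reducible64 "017345682")
        (reduce "02 05 06 07 08 12 13 14 17 18"
         "13 23 24 25 26 27 28 47 48 57 58 67 68 78" "123 147 248 025 267 068 578"))))))) tt

reducible66 : Reducible
  (setup 9 "01" "" "02 05 07 08 12 13 14 17 18 25 26 27 28 56 58 67 68" "01 03 04 15 16 57")
reducible66 = certify _
  (split 7 8
   (use reducible12 "07x5286")
   (split 2 3
    (use reducible55 "017345628")
    (split 2 4
     (use reducible55 "017435628")
     (split 4 8
      (use reducible55 "017435682")
      (split 4 7
       (split 3 4
        (use reducible15 "143782x")
        (split 3 7 (use reducible12 "17x3248") (use reducible57 "017435628")))
       (use reducible56 "017345628")))))) tt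

reducible67 : Reducible
  (setup 9 "01" "" "02 05 06 07 08 12 13 14 17 18 25 26 27 28 56 58" "01 03 04 15 16 57")
reducible67 = certify _
  (split 6 7
   (use reducible12 "07x5268")
   (split 6 8 (use reducible22 "015347682") (use reducible66 "012345678"))) tt

reducible68 : Reducible
  (setup 9 "01" "" "02 05 06 07 08 12 13 14 17 18 25 26 27 28 56" "01 03 04 15 16 57")
reducible68 = certify _
  (split 5 8 (use reducible17 "015347826") (use reducible67 "012345678")) tt

reducible69 : Reducible
  (setup 9 "01" "" "02 05 06 07 08 12 13 14 17 18 23 24 27 28" "01 03 04 15 16 47")
reducible69 = certify _
  (split 3 4 (use reducible17 "104563728") (use reducible68 "102564378")) tt

reducible70 : Reducible
  (setup 9 "02" "" "02 05 06 08 12 14 23 24 25 26 27 28 34 37 38 47 57 58 67 68 78" "01 03 04 35 36 45 46")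
reducible70 = certify _
  (reduce "02 05 06 07 08 21 23 24 25 26 27 28"
   "02 12 14 34 37 38 47 48 56 57 58 67 68 78" "347 238 124 025 267 068 578") tt

reducible71 : Reducible
  (setup 9 "012" "" "02 05 06 07 08 12 13 14 17 18 23 24 25 26 27 28 34 38 47 48 56 57 58 68 78" "01 03 04 15 16 35 36")
reducible71 = certify _
  (split 6 7 (use reducible56 "017346528") (use reducible70 "042135687")) tt

reducible72 : Reducible
  (setup 9 "02" "" "02 05 07 08 12 14 17 18 23 24 25 26 27 28 38 45 46 47 48 56 57 58 68 78" "01 03 15 16")
reducible72 = certify _
  (reduce "02 05 06 07 08 21 23 24 25 26 27 28"
   "02 14 17 18 23 38 45 46 47 48 56 57 58 67 68 78" "124 178 457 468 027 058 256 238") tt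

reducible73 : Reducible
  (setup 9 "012" "" "02 05 06 07 08 12 13 14 17 18 23 24 25 26 27 28 38 47 48 56 57 58 68 78" "01 03 04 15 16 36")
reducible73 = certify _
  (split 4 5
   (split 3 4
    (use reducible65 "102564387")
    (split 3 5
     (use reducible71 "012345678")
     (split 4 6
      (use reducible71 "102654378")
      (reduce "20 21 23 24 25 26 27 28"
       "05 06 07 13 14 18 27 28 34 35 46 56" "235 056 134 246 027 128"))))
   (split 4 6
    (split 3 4 (use reducible65 "102564387") (use reducible71 "102654378"))
    (use reducible72 "012345678"))) tt

reducible74 : Reducible (setup 9 "012" "" "02 05 06 07 08 12 13 14 17 18" "01 03 04 15 16")
reducible74 = certify _
  (split 2 5
   (use reducible60 "012345678")
   (split 2 6
    (use reducible59 "012346578")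
    (split 2 7
     (use reducible63 "012345678")
     (split 2 8
      (use reducible62 "012345687")
      (split 5 6
       (split 5 7
        (use reducible17 "015346728")
        (split 5 8
         (use reducible17 "015346827")
         (split 6 7 (use reducible12 "06x5278") (use reducible65 "012345678"))))
       (split 5 7
        (use reducible68 "012345678")
        (split 5 8
         (use reducible67 "012345687")
         (split 6 8
          (use reducible68 "012346587")
          (split 7 8
           (use reducible61 "017346582")
           (split 2 3
            (use reducible60 "102563478")
            (split 2 4
             (use reducible58 "102564378")
             (split 4 7
              (use reducible69 "012345678")
              (split 4 8
               (use reducible69 "012345687")
               (split 3 6
                (split 3 8 (use reducible69 "012435687") (use reducible73 "012345678"))
                (split 4 5
                 (split 3 7
                  (use reducible69 "012435678")
                  (split 3 8
                   (use reducible69 "012435687")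
                   (split 3 5 (use reducible70 "162053478") (use reducible72 "012435678"))))
                 (split 4 6
                  (split 3 7
                   (use reducible69 "012435678")
                   (split 3 8 (use reducible69 "012435687") (use reducible73 "012435678")))
                  -- D consists of the edges at 0 and at y, in slot 2, in place of those at 1.
                  (reduce "02 05 06 07 08 21 23 24 25 26 27 28"
                   "02 14 17 18 23 36 45 46 47 48 56 57 58 67 68 78" "124 178 457 468 027 056 236 258"))))))))))))))))) tt

reducible75 : Reducible (setup 9 "012" "" "02 05 06 07 08 12 13 14 17" "01 03 04 15 16")
reducible75 = certify _ (split 1 8 (use reducible8 "1234705") (use reducible74 "012345678")) tt

-- A closed vertex of degree six

reducible76 : Reducible (setup 7 "0" "" "01 04 05 06 15 46" "12 13 14 23 24 34")
reducible76 = certify _ (reduce "01 02 03 04 05 06" "05 06 15 46" "015 046") tt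

reducible77 : Reducible (setup 7 "0" "" "01 03 04 05 06 15 46" "12 13 14 23 24")
reducible77 = certify _ (split 3 4 (use reducible76 "0123456") (use reducible12 "0123546")) tt

reducible78 : Reducible (setup 7 "0" "" "02" "12 23 24 25 26")
reducible78 = certify _ (reduce "02" "" "") tt

reducible79 : Reducible (setup 7 "0" "" "01 02 03 04 05 06 13 45 46" "12 23 24")
reducible79 = certify _
  (split 2 6
   (split 2 5 (use reducible78 "0123456") (use reducible30 "210x34x56"))
   (use reducible30 "210x34x65")) tt

reducible80 : Reducible (setup 7 "0" "" "01 02 03 04 05 06 15 45 46" "12 14 23 24")
reducible80 = certify _ (split 1 3 (use reducible77 "0123456") (use reducible79 "0123456")) tt

reducible81 : Reducible (setup 7 "0" "" "01 02 03 04 05 06 15 16 24 56" "12 14 23 25")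
reducible81 = certify _
  (split 1 3
   (split 3 5 (use reducible12 "0231456") (use reducible30 "120x43x65"))
   (use reducible30 "120x45x36")) tt

reducible82 : Reducible (setup 7 "0" "" "01 02 03 04 05 06 15 24 56" "12 14 23 34")
reducible82 = certify _ (split 1 3 (use reducible12 "0132546") (use reducible30 "120x45x36")) tt

reducible83 : Reducible (setup 7 "0" "" "01 02 03 04 05 06 16 24 25 26 34 46" "12 14")
reducible83 = certify _
  (reduce "01 02 03 04 05 06" "03 05 16 24 25 26 34 46" "034 016 025 246") tt

reducible84 : Reducible (setup 7 "0" "" "01 02 03 04 05 06 15 16 45 46 56" "12 14 23")
reducible84 = certify _
  (split 2 4
   (use reducible80 "0123456")
   (split 2 5
    (use reducible81 "0123456")
    (split 2 6
     (use reducible81 "0123465")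
     (split 3 4 (use reducible82 "0123456") (use reducible83 "0123456"))))) tt

reducible85 : Reducible (setup 7 "0" "" "01 02 03 04 05 06 15 23 46" "12 14 24")
reducible85 = certify _ (reduce "01 02 03 04 05 06" "03 05 06 15 23 46" "023 015 046") tt

reducible86 : Reducible (setup 7 "0" "" "01 02 03 04 05 06 16 23 45" "12 26")
reducible86 = certify _ (reduce "01 02 03 04 05 06" "03 04 05 16 23 45" "023 016 045") tt

reducible87 : Reducible (setup 7 "0" "" "01 02 03 04 05 06 16 23 24 45 46" "12 14")
reducible87 = certify _ (split 2 6 (use reducible86 "0123456") (use reducible83 "0125436")) tt

reducible88 : Reducible (setup 7 "0" "" "01 02 03 04 05 06 15 16 23 45 46" "12 14")
reducible88 = certify _ (split 2 4 (use reducible85 "0123456") (use reducible87 "0123456")) tt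

reducible89 : Reducible (setup 7 "0" "" "01 02 03 04 05 06 15 16 45 46 56" "12 14")
reducible89 = certify _ (split 2 3 (use reducible84 "0123456") (use reducible88 "0123456")) tt

reducible90 : Reducible (setup 7 "0" "" "01 02 03 04 05 06 12 13 16 24 26 34 36 46 56" "14 23")
-- The spoke 05 covers the link edges at 5. On the other neighbours the link is K₅ less two disjoint
-- edges, which makes eight pairs; 56 is a side of 056.
reducible90 = certify _
  (reduce "01 02 03 04 05 06" "05 12 13 16 24 26 34 36 46 56" "012 136 034 056 246") tt

reducible91 : Reducible (setup 7 "0" "" "01 02 03 04 05 06 12 13 16 24 26 34 46 56" "14 23")
reducible91 = certify _ (split 3 6 (use reducible83 "0325641") (use reducible90 "0123456")) tt

reducible92 : Reducible (setup 7 "0" "" "01 02 03 04 05 06 12 13 16 24 34 46 56" "14 23")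
reducible92 = certify _ (split 2 6 (use reducible88 "0265314") (use reducible91 "0123456")) tt

-- Degrees five and six with four common neighbours

reducible93 : Reducible
  (setup 9 "01" "" "02 05 06 07 12 13 14 16 17 18 27 28 34 36 38 56 57 58 67 68 78" "01 03 04 15 26 37")
reducible93 = certify _
  (reduce "02 05 06 07 08 12 13 14 16 17 18"
   "14 23 25 27 28 34 36 38 56 57 58 67 68 78" "027 056 578 167 368 128 134") tt

reducible94 : Reducible
  (setup 9 "01" "" "02 05 06 07 08 12 13 14 16 17 18 23 24 27 28 36 56 57 58 67 68 78" "01 03 04 15 26")
reducible94 = certify _
  (split 4 6
   (use reducible30 "621047538")
   (split 3 4
    (use reducible92 "1234687")
    (split 3 7
     (split 3 8 (use reducible30 "371084526") (use reducible93 "012345678"))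
     (split 3 8
      (use reducible93 "012345687")
      (split 4 7
       (use reducible90 "1247683")
       (split 4 8
        (use reducible90 "1248673")
        (reduce "02 05 06 07 08 12 13 14 16 17 18"
         "23 24 25 27 28 34 36 37 38 46 47 48 56 57 58 67 68 78" "027 058 567 123 248 146 178 347 368"))))))) tt

reducible95 : Reducible (setup 9 "012" "" "02 05 06 07 08 12 13 14 16 17 18 27 28" "01 03 04 15 26")
reducible95 = certify _
  (split 5 6
   (use reducible17 "016342578")
   (split 6 7
    (use reducible12 "06x2578")
    (split 6 8
     (use reducible12 "06x2587")
     (split 5 7
      (use reducible22 "016342578")
      (split 5 8
       (use reducible22 "016342587")
       (split 7 8
        (use reducible19 "078625x")
        (split 2 3
         (use reducible89 "1234678")
         (split 2 4
          (use reducible31 "012437685")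
          (split 3 6 (use reducible89 "1634278") (use reducible94 "012345678")))))))))) tt

reducible96 : Reducible (setup 9 "012" "" "02 05 06 07 08 12 13 14 16 17 18 27" "01 03 04 15 26")
reducible96 = certify _
  (split 2 8 (use reducible17 "012346857") (use reducible95 "012345678")) tt

reducible97 : Reducible (setup 7 "0" "" "01 02 03 04 05 06 13 45 46 56" "12 23")
reducible97 = certify _ (split 2 6 (use reducible79 "0123645") (use reducible86 "0126453")) tt

reducible98 : Reducible
  (setup 9 "012" "" "02 05 06 07 08 12 13 14 16 17 18 25 26 27 28 56 58 67 68" "01 03 04 15 23 57")
reducible98 = certify _
  (split 7 8
   (use reducible12 "07x5286")
   (split 2 4
    (use reducible23 "025347681")
    (split 3 4
     (use reducible97 "1234678")
     (split 3 7
      (use reducible30 "321076548")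
      (reduce "02 05 06 07 08 12 13 14 16 17 18"
       "14 24 25 26 27 28 36 37 38 56 58 67 68 78" "124 137 168 056 258 078 267"))))) tt

reducible99 : Reducible (setup 7 "0" "" "01 02 03 04 05 06 12 13 14 15 16 45 46" "23 24")
reducible99 = certify _
  (split 2 6
   (split 5 6
    (use reducible84 "0623514")
    (split 3 6 (use reducible80 "0324615") (use reducible79 "0326415")))
   (use reducible89 "0235416")) tt

reducible100 : Reducible
  (setup 9 "01" "" "02 05 06 07 08 12 13 14 16 17 18 24 25 26 27 28 34 56 58 67 68" "01 03 04 15 36 57")
reducible100 = certify _
  (split 7 8
   (use reducible12 "07x5286")
   (split 3 7
    (use reducible30 "361072548")
    (reduce "02 05 06 07 08 12 13 14 16 17 18"
     "14 23 24 25 26 27 28 37 38 56 58 67 68 78" "124 137 168 056 258 078 267"))) tt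

reducible101 : Reducible
  (setup 9 "01" "" "02 05 06 07 08 12 13 14 16 17 18 23 25 26 27 28 34 36 56 58 68" "01 03 04 15 37 57")
reducible101 = certify _
  (split 7 8
   (use reducible12 "07x5286")
   (reduce "02 05 06 07 08 12 13 14 16 17 18"
    "14 23 25 26 27 28 34 36 38 56 58 67 68 78" "236 134 127 168 056 078 258")) tt

reducible102 : Reducible
  (setup 9 "01" "" "02 05 06 07 12 13 14 16 17 18 23 24 25 26 27 28 36 37 56 58 68" "01 03 04 15 38 57")
reducible102 = certify _
  (reduce "02 05 06 07 08 12 13 14 16 17 18"
   "14 23 24 25 26 27 28 36 37 56 58 67 68 78" "027 056 258 168 236 124 137") tt

reducible103 : Reducible
  (setup 9 "012" "" "02 05 06 07 08 12 13 14 16 17 18 25 26 27 28 56" "01 03 04 15 57")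
reducible103 = certify _
  (split 5 8
   (use reducible17 "015347826")
   (split 6 7
    (use reducible12 "07x5268")
    (split 6 8
     (use reducible22 "015347682")
     (split 2 3
      (use reducible98 "012345678")
      (split 2 4
       (use reducible98 "012435678")
       (split 3 4
        (split 3 6
         (use reducible99 "1234678")
         (split 3 7
          (use reducible89 "1348726")
          (split 3 8
           (use reducible89 "1347826")
           (split 4 6
            (use reducible83 "1437682")
            (split 4 7
             (use reducible30 "431076528")
             (reduce "02 05 06 07 08 12 13 14 16 17 18"
              "18 23 24 25 26 27 28 36 37 46 47 56 58 67 68 78" "027 056 258 168 123 147 246 367"))))))
        (split 3 6
         (use reducible100 "012345678")
         (split 4 6
          (use reducible100 "012435678")
          (split 3 7
           (use reducible101 "012345678")
           (split 4 7
            (use reducible101 "012435678")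
            (split 3 8
             (use reducible102 "012345678")
             (split 4 8
              (use reducible102 "012435678")
              (reduce "02 05 06 07 08 12 13 14 16 17 18"
               "23 24 25 26 27 28 34 36 37 38 46 47 48 56 58 67 68 78" "027 056 258 123 246 147 168 348 367"))))))))))))) tt

reducible104 : Reducible
  (setup 9 "012" "" "02 05 06 07 08 12 13 14 16 17 18 26 27 28" "01 03 04 15 57")
reducible104 = certify _
  (split 2 5
   (use reducible17 "015342768")
   (split 5 6 (use reducible17 "015346728") (use reducible103 "012345678"))) tt

reducible105 : Reducible
  (setup 9 "01" "" "02 05 06 07 08 12 13 14 16 17 18 25 26 27 28 57 58 68 78" "01 03 04 15 67")
reducible105 = certify _
  (split 3 6
   (use reducible89 "1634728")
   (split 3 7
    (use reducible89 "1734628")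
    (split 4 6 (use reducible89 "1643728") (use reducible94 "016345728")))) tt

reducible106 : Reducible
  (setup 9 "012" "" "02 05 06 07 08 12 13 14 16 17 18 26 27 28 57" "01 03 04 15 67")
reducible106 = certify _
  (split 2 5
   (use reducible22 "012345678")
   (split 5 8
    (use reducible103 "012345786")
    (split 6 8
     (use reducible17 "016347825")
     (split 7 8 (use reducible12 "07x6285") (use reducible105 "012345678"))))) tt

reducible107 : Reducible
  (setup 9 "01" "" "02 05 06 07 08 12 13 14 16 17 18 26 27 28 57 67 78" "01 03 04 15 68")
reducible107 = certify _
  (split 2 5
   (use reducible22 "012345687")
   (split 5 8 (use reducible17 "018345627") (use reducible105 "012345687"))) tt

reducible108 : Reducible (setup 7 "0" "" "01 02 03 04 05 06 14 16 25" "12 13 23 24 26")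
reducible108 = certify _
  (split 3 4 (use reducible12 "0231546") (use reducible30 "210x63x54")) tt

reducible109 : Reducible (setup 7 "0" "" "01 02 03 04 05 06 14 15 26" "12 13 23 24")
reducible109 = certify _
  (split 3 4 (use reducible12 "0231645") (use reducible30 "230x41x65")) tt

reducible110 : Reducible (setup 7 "0" "" "01 02 03 04 05 06 14 15 16" "12 13 23 24")
reducible110 = certify _
  (split 2 6
   (split 2 5 (use reducible78 "0123456") (use reducible108 "0123456"))
   (use reducible109 "0123456")) tt

reducible111 : Reducible (setup 7 "0" "" "01 02 03 04 05 06 14 15 16 45 56" "12 13")
reducible111 = certify _
  (split 2 3
   (split 2 4
    (use reducible110 "0123456")
    (split 2 5 (use reducible109 "0123564") (use reducible89 "0136245")))
   (use reducible86 "0214563")) tt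

reducible112 : Reducible (setup 7 "0" "" "01 02 03 04 05 06 12 14 15 23 25 35 45 46 56" "13 24")
reducible112 = certify _ (split 3 4 (use reducible83 "0316425") (use reducible90 "0124365")) tt

reducible113 : Reducible
  (setup 9 "01" "" "02 05 06 07 12 13 14 16 17 18 23 26 27 28 34 36 37 38 47 48 57 67 68 78" "01 15 24")
reducible113 = certify _
  (reduce "02 05 06 07 08 12 13 14 16 17 18"
   "05 23 26 27 28 34 36 37 38 46 47 48 57 67 68 78" "057 026 123 278 147 168 348 367") tt

reducible114 : Reducible
  (setup 9 "01" "" "02 05 06 07 12 13 14 16 17 18 23 26 27 28 34 57 67 68 78" "01 15 24")
reducible114 = certify _
  (split 4 7
   (use reducible30 "421076538")
   (split 4 8
    (use reducible30 "421086537")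
    (split 3 7
     (use reducible91 "1273468")
     (split 3 8
      (use reducible90 "1238467")
      (split 3 6 (use reducible112 "1234678") (use reducible113 "012345678")))))) tt

reducible115 : Reducible
  (setup 9 "01" "" "02 05 06 07 12 13 14 16 17 18 23 26 27 28 57 67 68 78" "01 15 24")
reducible115 = certify _
  (split 3 4 (use reducible97 "1243678") (use reducible114 "012345678")) tt

reducible116 : Reducible
  (setup 9 "01" "" "02 05 06 07 12 13 14 16 17 18 26 27 28 57 67 68 78" "01 15 24")
reducible116 = certify _
  (split 2 3 (use reducible111 "1234768") (use reducible115 "012345678")) tt

reducible117 : Reducible
  (setup 9 "012" "" "02 05 06 07 08 12 13 14 16 17 18 26 27 28 67 68 78" "01 03 04 15 37")
reducible117 = certify _
  (split 5 6 (use reducible104 "012345768") (use reducible116 "017435268")) tt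

reducible118 : Reducible
  (setup 9 "01" "" "02 05 06 07 12 13 14 16 17 18 24 26 27 28 37 46 47 57 67 68 78" "01 03 15")
reducible118 = certify _
  (reduce "02 05 06 07 08 12 13 14 16 17 18"
   "05 13 24 26 27 28 37 46 47 48 57 67 68 78" "026 057 124 278 467 137 168") tt

reducible119 : Reducible (setup 9 "012" "" "02 05 06 07 08 12 13 14 16 17 18" "01 03 04 15")
reducible119 = certify _
  (split 2 6
   (split 2 7 (use reducible17 "012346758") (use reducible96 "012345678"))
   (split 2 7
    (use reducible96 "012345768")
    (split 2 8
     (use reducible95 "012345867")
     (split 5 7
      (use reducible104 "012345678")
      (split 6 7
       (use reducible106 "012345678")
       (split 7 8
        (use reducible106 "012345876")
        (split 6 8
         (use reducible107 "012345678")
         (split 2 4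
          (use reducible116 "012345678")
          (split 4 6
           (use reducible116 "016345278")
           (split 3 7
            (use reducible117 "012345678")
            (split 4 7 (use reducible117 "012435678") (use reducible118 "012345678")))))))))))) tt

reducible120 : Reducible (setup 9 "012" "" "02 05 06 07 08 12 13 14 16 17" "01 03 04 15")
reducible120 = certify _
  (split 1 8 (use reducible74 "012345867") (use reducible119 "012345678")) tt

reducible121 : Reducible (setup 9 "012" "" "02 05 06 07 08 12 13 14 16" "01 03 04 15")
reducible121 = certify _
  (split 1 7 (use reducible75 "012345768") (use reducible120 "012345678")) tt

-- Never realised: a leaf and its neighbours share a bag of size seven, so a leaf has at most six
-- neighbours. This closes the branch in which every slot is joined to a leaf.
reducible122 : Reducible (setup 9 "" "1" "12 13 14 15 16 17 18" "")
reducible122 = certify _ (crowd 1 "2345678") tt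

-- Two leaves, one of degree at most five

reducible123 : Reducible (setup 9 "012" "1" "02 05 06 07 08 12" "01 03 04")
-- The pairs 13 and 14 tell how many neighbours of 1 lie outside the neighbourhood of 0, and thereby
-- which overlap lemma applies.
reducible123 = certify _
  (split 1 3
   (split 1 4 (use reducible29 "012345678") (use reducible53 "012345678"))
   (split 1 4
    (use reducible53 "012435678")
    (split 1 5
     (split 1 6
      (split 1 7 (use reducible9 "1234805") (use reducible75 "012345678"))
      (use reducible121 "012345678"))
     (split 1 6
      (use reducible121 "012346578")
      (split 1 7
       (use reducible120 "012347568")
       (split 1 8 (use reducible119 "012348567") (use reducible122 "012345678"))))))) tt

reducible124 : Reducible (setup 9 "012" "1" "02 05 06 07 12" "01 03 04")
reducible124 = certify _
  (split 0 8 (use reducible8 "0256713") (use reducible123 "012345678")) tt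

reducible125 : Reducible (setup 9 "012" "1" "02 05 06 12" "01 03 04")
reducible125 = certify _
  (split 0 7 (use reducible9 "0256813") (use reducible124 "012345678")) tt

reducible126 : Reducible (setup 9 "012" "1" "02 05 12" "01 03 04")
reducible126 = certify _
  (split 0 6 (use reducible10 "0257813") (use reducible125 "012345678")) tt

reducible127 : Reducible (setup 9 "012" "1" "02 12" "01 03 04")
reducible127 = certify _
  (split 0 5 (use reducible11 "0267813") (use reducible126 "012345678")) tt

-- The link of a closed vertex of degree six

reducible128 : Reducible (setup 7 "0" "" "01 02 03 04 05 06 14 26" "12 13 15 23 25")
reducible128 = certify _ (split 3 5 (use reducible76 "0135246") (use reducible12 "0123456")) tt

reducible129 : Reducible (setup 7 "0" "" "01 02 03 04 05 06 14 23" "12 13 15 16 25")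
reducible129 = certify _
  (split 2 6 (use reducible128 "0125463") (use reducible108 "0215346")) tt

reducible130 : Reducible (setup 7 "0" "" "01 02 03 04 05 06 14" "12 13 15 16 25")
reducible130 = certify _
  (split 2 3
   (split 2 6
    (split 5 6
     (split 3 5
      (split 3 6 (reduce "01 02 03 04 05 06" "04 14" "014") (use reducible12 "0123465"))
      (use reducible12 "0123456"))
     (use reducible12 "0125463"))
    (use reducible128 "0123456"))
   (use reducible129 "0123456")) tt

reducible131 : Reducible (setup 7 "0" "" "01 02 03 04 05 06" "12 13 15 16")
reducible131 = certify _
  (split 1 4
   (use reducible78 "0213456")
   (split 2 5
    (use reducible130 "0123456")
    (split 3 6 (use reducible130 "0132465") (use reducible30 "120x53x46")))) tt

reducible132 : Reducible (setup 7 "0" "" "01 02 03 04 05 06 15" "12 13 16 23")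
reducible132 = certify _
  (split 2 4
   (split 2 6
    (use reducible131 "0213546")
    (split 3 4 (use reducible77 "0234165") (use reducible30 "120x63x54")))
   (split 2 6 (use reducible128 "0123564") (use reducible109 "0213645"))) tt

reducible133 : Reducible (setup 7 "0" "" "01 02 03 05 15 23" "12 13 25 35")
reducible133 = certify _ (reduce "01 02 03 04 05 06" "04 06 15 23" "015 023") tt

reducible134 : Reducible (setup 7 "0" "" "01 02 03 04 05 06 15 23 36" "12 13 16 35")
reducible134 = certify _
  (split 2 6
   (use reducible132 "0126453")
   (split 2 5
    (use reducible133 "0123456")
    (split 5 6 (use reducible133 "0136254") (use reducible89 "0314526")))) tt

reducible135 : Reducible (setup 7 "0" "" "01 02 03 04 05 06 15 23" "12 13 16")
reducible135 = certify _
  (split 3 6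
   (use reducible132 "0136452")
   (split 3 5
    (use reducible134 "0123456")
    (split 4 6
     (split 1 4
      (use reducible129 "0163542")
      (split 2 4 (use reducible82 "0216435") (use reducible30 "130x62x54")))
     (use reducible86 "0215463")))) tt

reducible136 : Reducible (setup 7 "0" "" "01 02 03 04 05 06 14 15 16 23" "12 13 24")
reducible136 = certify _
  (split 2 6
   (use reducible134 "0241536")
   (split 3 4 (use reducible133 "0123546") (use reducible87 "0243156"))) tt

reducible137 : Reducible (setup 7 "0" "" "01 02 03 04 05 06 14 16 23" "12 13 24")
reducible137 = certify _
  (split 1 5 (use reducible135 "0123645") (use reducible136 "0123456")) tt

reducible138 : Reducible (setup 7 "0" "" "01 02 03 04 05 06 16 23" "12 13 24")
reducible138 = certify _
  (split 1 4 (use reducible132 "0124563") (use reducible137 "0123456")) tt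

reducible139 : Reducible (setup 7 "0" "" "01 02 03 04 05 06 16 23 24 26" "12 13")
reducible139 = certify _ (split 3 5 (use reducible138 "0132546") (use reducible87 "0135246")) tt

reducible140 : Reducible (setup 7 "0" "" "01 02 03 04 05 06 16" "12 13")
reducible140 = certify _
  (split 2 3
   (split 1 4
    (use reducible132 "0123564")
    (split 1 5
     (use reducible132 "0123645")
     (split 2 4
      (use reducible110 "0123456")
      (split 2 5
       (use reducible109 "0123564")
       (split 3 4 (use reducible79 "0234156") (use reducible85 "0125364"))))))
   (split 2 4
    (use reducible138 "0123456")
    (split 2 6 (use reducible137 "0216354") (use reducible139 "0123456")))) tt

-- The analogue of `reducible17` for degree six: afterwards the complement of the link is a
-- matching.
reducible141 : Reducible (setup 7 "0" "" "01 02 03 04 05 06" "12 13")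
reducible141 = certify _
  (split 1 6
   (split 1 5
    (use reducible131 "0123456")
    (split 2 3 (use reducible132 "0123456") (use reducible135 "0123456")))
   (use reducible140 "0123456")) tt

-- Two leaves of degree six with the same neighbourhood

reducible142 : Reducible
  (setup 9 "01" "" "02 04 05 06 07 08 12 14 16 18 25 26 27 28 45 46 48 58" "01 03 13 24 56")
reducible142 = certify _
  (split 6 8
   (use reducible30 "650182347")
   (split 7 8
    (reduce "02 04 05 06 07 08 12 14 15 16 17 18"
     "25 26 27 28 45 46 47 48 57 58 67 68" "027 045 068 126 148 258")
    (use reducible90 "0256478"))) tt

reducible143 : Reducible
  (setup 9 "01" "" "02 04 05 06 07 08 12 14 16 18 25 26 27 28 46 48" "01 03 13 24 56")
reducible143 = certify _
  (split 4 5
   (use reducible137 "0452678")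
   (split 5 8 (use reducible140 "0568472") (use reducible142 "012345678"))) tt

reducible144 : Reducible
  (setup 9 "01" "" "02 04 05 06 07 08 12 14 15 16 17 18 25 26 27" "01 03 13 24")
reducible144 = certify _
  (split 2 8
   (use reducible140 "0248675")
   (split 4 6
    (use reducible141 "0426578")
    (split 4 8
     (use reducible139 "0428576")
     (split 5 6
      (use reducible143 "012345678")
      (split 7 8
       (use reducible143 "012347856")
       (split 6 8
        (split 4 7 (use reducible30 "420175386") (use reducible142 "012348657"))
        (reduce "02 04 05 06 07 08 12 14 15 16 17 18"
         "25 26 27 28 45 46 47 48 56 57 58 67 68 78" "046 025 078 148 156 127 268"))))))) tt

reducible145 : Reducible (setup 9 "01" "" "02 04 05 06 07 08 12 14 15 16 17 18 25 26" "01 03 13 24")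
reducible145 = certify _
  (split 2 7 (use reducible140 "0247685") (use reducible144 "012345678")) tt

reducible146 : Reducible (setup 9 "01" "" "02 04 05 06 07 08 12 14 15 16 17 18 25" "01 03 13 24")
reducible146 = certify _
  (split 2 6 (use reducible140 "0246785") (use reducible145 "012345678")) tt

reducible147 : Reducible (setup 9 "01" "" "02 04 05 06 07 08 12 14 15 16 17" "01 03 13")
reducible147 = certify _
  (split 1 8
   (use reducible52 "102384567")
   (split 2 4
    (split 2 5 (use reducible141 "0245678") (use reducible146 "012345678"))
    (split 2 5
     (use reducible146 "012354678")
     (split 2 6
      (use reducible145 "012364578")
      (split 2 7
       (use reducible144 "012374568")
       (split 4 5
        (use reducible146 "014352678")
        (split 4 7
         (use reducible145 "014372568")
         (split 4 8
          (use reducible144 "014382576")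
          (split 5 6
           (use reducible145 "015362478")
           (split 5 8
            (use reducible144 "015382467")
            (split 6 7
             (use reducible145 "016372548")
             (split 6 8
              (use reducible144 "016382574")
              (split 7 8
               (use reducible144 "017382465")
               -- The common link has at most fifteen edges, against eight triangles in K₈ minus the
               -- edge 01.
               (reduce "02 04 05 06 07 08 12 14 15 16 17 18"
                "01 24 25 26 27 28 45 46 47 48 56 57 58 67 68 78" "024 056 078 125 267 168 147 458")))))))))))))) tt

-- Two leaves of degree six with five common neighbours

reducible148 : Reducible
  (setup 9 "01" "" "02 04 05 06 07 08 12 15 16 18 24 25 27 28 46 48 56 57 58 67 68" "03 26 45 78")
reducible148 = certify _
  (reduce "02 04 05 06 07 08 12 13 15 16 17 18"
   "01 13 24 25 27 28 46 47 48 56 57 58 67 68" "024 468 058 067 156 128 257") tt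

reducible149 : Reducible
  (setup 9 "01" "" "02 04 05 06 07 08 12 15 16 18 24 25 27 28 56 67 68" "01 03 26 45")
reducible149 = certify _
  (split 4 6
   (use reducible136 "0642578")
   (split 4 8
    (use reducible140 "0458672")
    (split 5 8
     (use reducible30 "540186327")
     (split 7 8
      (split 5 7 (use reducible30 "750184326") (use reducible148 "012345678"))
      (use reducible90 "0245678"))))) tt

reducible150 : Reducible (setup 9 "01" "" "02 04 05 06 07 08 12 13 15 16 17 18" "01 03 14 26")
reducible150 = certify _
  (split 2 4
   (use reducible141 "0246578")
   (split 2 5
    (use reducible140 "0256784")
    (split 2 7
     (use reducible140 "0267584")
     (split 2 8
      (use reducible140 "0268574")
      (split 5 6
       (use reducible141 "0625478")
       (split 6 7
        (use reducible139 "0627485")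
        (split 6 8
         (use reducible139 "0628475")
         (split 4 5
          (use reducible149 "012345678")
          (split 4 7
           (use reducible149 "012347685")
           (split 4 8
            (use reducible149 "012348675")
            (split 5 7
             (use reducible91 "0526784")
             (split 5 8
              (use reducible91 "0258647")
              (split 7 8 (use reducible90 "0278645") (use reducible116 "012364758")))))))))))))) tt

reducible151 : Reducible
  (setup 9 "01" "" "02 04 05 06 07 08 12 13 15 16 17 18 24 25 26 27 28 46 56 57 58 67 68 78" "01 03 14 45")
reducible151 = certify _
  (split 4 7
   (use reducible30 "450176328")
   (split 4 8
    (use reducible30 "450186327")
    (split 2 3 (use reducible115 "012834567") (use reducible113 "105743628")))) tt

reducible152 : Reducible (setup 9 "01" "" "02 04 05 06 07 08 12 13 15 16 17 18" "01 03 14")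
reducible152 = certify _
  (split 2 6
   (use reducible150 "012345678")
   (split 2 7
    (use reducible150 "012345768")
    (split 2 8
     (use reducible150 "012345867")
     (split 5 6
      (use reducible150 "015342678")
      (split 5 7
       (use reducible150 "015342768")
       (split 5 8
        (use reducible150 "015342867")
        (split 6 7
         (use reducible150 "016342758")
         (split 6 8
          (use reducible150 "016342857")
          (split 7 8
           (use reducible150 "017342856")
           (split 4 5
            (split 2 4
             (use reducible141 "0425678")
             (split 2 5
              (use reducible30 "520147368")
              (split 4 6 (use reducible30 "450167328") (use reducible151 "012345678"))))
            (split 4 6
             (split 2 4
              (use reducible30 "420167358")
              (split 2 5 (use reducible91 "0264587") (use reducible151 "012346578")))
             (split 2 3
              (use reducible116 "012534768")
              (split 3 6 (use reducible114 "016234758") (use reducible118 "017324865")))))))))))))) tt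

reducible153 : Reducible (setup 9 "012" "" "02 04 05 06 07 08 12 13 15 16 17" "01 03 14")
reducible153 = certify _
  (split 1 8 (use reducible119 "102483567") (use reducible152 "012345678")) tt

reducible154 : Reducible (setup 9 "012" "0" "02 04 05 06 07 08 12 13 15 16" "01 03 14")
reducible154 = certify _
  (split 1 7 (use reducible124 "102473568") (use reducible153 "012345678")) tt

reducible155 : Reducible (setup 9 "012" "0" "02 04 05 06 07 08 12 13 15" "01 03 14")
reducible155 = certify _
  (split 1 6 (use reducible125 "102463578") (use reducible154 "012345678")) tt

reducible156 : Reducible (setup 9 "01" "1" "02 04 05 06 07 08 12 13 14 15 16 17" "01 03")
reducible156 = certify _
  (split 1 8 (use reducible152 "012384567") (use reducible122 "x12345678")) tt

-- If 1 has degree at most five, the roles of 0 and 1 are exchanged and the earlier lemmas apply.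
-- Otherwise both have degree six, and each misses one slot of the bag: the same one or different
-- ones.
reducible157 : Reducible (setup 9 "012" "01" "02 04 05 06 07 08 12" "01 03")
reducible157 = certify _
  (split 1 3
   (split 1 4
    (use reducible127 "102345678")
    (split 1 5
     (use reducible126 "102354678")
     (split 1 6
      (use reducible125 "102364578")
      (split 1 7 (use reducible124 "102374568") (use reducible147 "012345678")))))
   (split 1 4
    (split 1 5 (use reducible126 "102453678") (use reducible155 "012345678"))
    (split 1 5
     (use reducible155 "012354678")
     (split 1 6
      (use reducible154 "012364578")
      (split 1 7 (use reducible153 "012374568") (use reducible156 "012345678")))))) tt

reducible158 : Reducible (setup 9 "012" "01" "02 04 05 06 07 12" "01 03")
reducible158 = certify _
  (split 0 8 (use reducible123 "012384567") (use reducible157 "012345678")) tt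

reducible159 : Reducible (setup 9 "012" "01" "02 04 05 06 12" "01 03")
reducible159 = certify _
  (split 0 7 (use reducible124 "012374568") (use reducible158 "012345678")) tt

reducible160 : Reducible (setup 9 "012" "01" "02 04 05 12" "01 03")
reducible160 = certify _
  (split 0 6 (use reducible125 "012364578") (use reducible159 "012345678")) tt

reducible161 : Reducible (setup 9 "012" "01" "02 04 12" "01 03")
reducible161 = certify _
  (split 0 5 (use reducible126 "012354678") (use reducible160 "012345678")) tt

-- Slot 2 is y and slots 3 to 8 are the rest of its bag. Leaf 0 has at most six neighbours among
-- these seven, so it misses a slot, which is renamed to 3.
reducible-two : Reducible (setup 9 "012" "01" "02 12" "01")
reducible-two = certify _
  (split 0 3
   (split 0 4 (use reducible127 "012345678") (use reducible161 "012345678"))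
   (split 0 4
    (use reducible161 "012435678")
    (split 0 5
     (use reducible160 "012534678")
     (split 0 6
      (use reducible159 "012634578")
      (split 0 7
       (use reducible158 "012734568")
       (split 0 8 (use reducible157 "012834567") (use reducible122 "x02345678"))))))) tt

-- Three leaves with a common neighbour

reducible163 : Reducible (setup 10 "01" "" "03 06 07 08 09 13 15 17 18 19" "01 02 04 05 12 14 16")
reducible163 = certify _
  (split 3 7
   (use reducible50 "013257896")
   (split 3 8
    (use reducible49 "013258796")
    (split 3 9 (use reducible48 "013259786") (use reducible43 "013256789")))) tt

reducible164 : Reducible (setup 10 "01" "" "03 06 07 08 09 13 15 17 18" "01 02 04 05 12 14 16")
reducible164 = certify _
  (split 1 9 (use reducible9 "1357802") (use reducible163 "0123456789")) tt

reducible165 : Reducible (setup 10 "01" "" "03 06 07 08 09 13 15 17" "01 02 04 05 12 14 16")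
reducible165 = certify _
  (split 1 8 (use reducible9 "1357902") (use reducible164 "0123456789")) tt

reducible166 : Reducible (setup 10 "01" "" "03 06 07 08 09 13 15 16 17" "01 02 04 05 12 14")
reducible166 = certify _
  (split 1 8
   (use reducible164 "0123458679")
   (split 1 9 (use reducible163 "0123459678") (use reducible52 "013256789"))) tt

reducible167 : Reducible (setup 10 "01" "" "03 06 07 08 09 13 15" "01 02 04 05 12 14")
reducible167 = certify _
  (split 1 6
   (split 1 7 (use reducible10 "1358902") (use reducible165 "0123456789"))
   (split 1 7 (use reducible165 "0123457689") (use reducible166 "0123456789"))) tt

-- Both leaves miss slot 4, so their neighbourhoods lie in six slots. The two-leaf lemmas that close
-- only 0 and 1 apply; those closing y cannot, as y in slot 3 is not closed here.
reducible168 : Reducible (setup 10 "01" "" "03 06 07 08 09 13" "01 02 04 05 12 14")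
reducible168 = certify _
  (split 1 5 (use reducible29 "013246789") (use reducible167 "0123456789")) tt

reducible169 : Reducible
  (setup 10 "02" "" "03 06 07 08 09 23 24 25 26 27 37" "01 02 04 05 12 28 29 36")
reducible169 = certify _
  (split 3 8
   (use reducible15 "036897x")
   (split 3 9 (use reducible15 "036987x") (use reducible62 "023458967"))) tt

reducible170 : Reducible
  (setup 10 "02" "" "03 06 07 08 09 23 24 25 26 27" "01 02 04 05 12 28 29 36")
reducible170 = certify _
  (split 3 7 (use reducible16 "036789x") (use reducible169 "0123456789")) tt

reducible171 : Reducible
  (setup 10 "02" "" "03 06 07 08 09 23 24 25 26 27 29 37 39" "01 02 04 05 12 28 36")
reducible171 = certify _
  (split 3 8
   (use reducible15 "036897x")
   (split 6 7
    (use reducible16 "063789x")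
    (split 6 8
     (use reducible12 "06x3789")
     (split 6 9
      (use reducible12 "06x3798")
      (split 7 8
       (use reducible20 "036789x")
       (split 7 9 (use reducible19 "036798x") (use reducible107 "029458376"))))))) tt

reducible172 : Reducible
  (setup 10 "02" "" "03 06 07 08 09 23 24 25 26 27 29 39" "01 02 04 05 12 28 36")
reducible172 = certify _
  (split 3 7 (use reducible15 "036789x") (use reducible171 "0123456789")) tt

reducible173 : Reducible
  (setup 10 "012" "" "03 06 07 08 09 13 14 15 18 19 23 24 25 26 27 29 36 37 39 67 69 79" "01 02 04 05 12 16 17 28 56")
reducible173 = certify _
  (split 7 8
   (split 3 8 (use reducible16 "083769x") (use reducible67 "013457689"))
   (use reducible116 "026458379")) tt

reducible174 : Reducible
  (setup 10 "012" "" "03 06 07 08 09 13 14 15 18 19 23 24 25 26 27 29" "01 02 04 05 12 16 17 28")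
reducible174 = certify _
  (split 3 9
   (use reducible170 "0213459867")
   (split 3 6
    (use reducible172 "0123456789")
    (split 3 7
     (use reducible171 "0123457689")
     (split 6 7
      (use reducible172 "0126457983")
      (split 6 9
       (use reducible171 "0126459387")
       (split 7 9
        (use reducible171 "0127459386")
        (split 3 5
         (use reducible172 "1023675489")
         (split 4 5
          (use reducible172 "1025674983")
          (split 5 9
           (use reducible171 "1025679384")
           (split 5 6
            (use reducible173 "0123456789")
            (split 5 7
             (use reducible173 "0123457689")
             (reduce "03 06 07 08 09 23 24 25 26 27 29"
              "01 08 24 35 36 37 39 45 56 57 59 67 69 79" "036 079 237 359 567 245 269")))))))))))) tt

-- Leaves of which one has degree five and which miss a common slot are settled. As 0 misses 4, 5
-- and 1 misses 6, 7, leaf 2 is left with 4, 5, 6, 7 as neighbours and misses 8 or 9. If it misses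
-- both, any two of the neighbourhoods share exactly three slots.
reducible175 : Reducible
  (setup 10 "012" "2" "03 06 07 08 09 13 14 15 18 19 23" "01 02 04 05 12 16 17")
reducible175 = certify _
  (split 2 4
   (use reducible168 "0213456789")
   (split 2 5
    (use reducible167 "0213546789")
    (split 2 6
     (split 2 7 (use reducible28 "123064589") (use reducible166 "1203674589"))
     (split 2 7
      (use reducible166 "1203764589")
      (split 2 8
       (split 2 9
        (split 3 6
         (use reducible170 "0123456789")
         (split 3 7
          (use reducible169 "0123457689")
          (split 3 8
           (use reducible63 "013456789")
           (split 3 9
            (use reducible62 "013456798")
            (split 6 7
             (use reducible169 "0126457389")
             (split 6 8
              (use reducible68 "013456789")
              (split 6 9
               (use reducible67 "013456798")
               (split 7 8
                (use reducible68 "013457689")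
                (split 7 9
                 (use reducible66 "013457698")
                 (split 8 9
                  (use reducible61 "019457683")
                  (split 3 4
                   (use reducible63 "123678945")
                   (split 3 5
                    (use reducible62 "123678954")
                    (split 4 5
                     (use reducible169 "1024675389")
                     (split 4 8
                      (use reducible68 "103674589")
                      (split 4 9
                       (use reducible67 "103674598")
                       (split 5 8
                        (use reducible67 "123678954")
                        (split 5 9
                         (use reducible56 "109765438")
                         (split 4 6
                          (use reducible68 "203894567")
                          (split 4 7
                           (use reducible67 "203894576")
                           -- The three links cover all 21 pairs of slots 3 to 9, one too many for
                           -- ten triangles. The spoke 25 replaces 56 and 57, which occur in the
                           -- link of 2 only.
                           (reduce "03 06 07 08 09 13 14 15 18 19 23 24 25 26 27"
                            "25 34 35 36 37 38 39 45 46 47 48 49 58 59 67 68 69 78 79 89" "235 246 134 158 459 478 037 679 068 389"))))))))))))))))))))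
        (use reducible174 "0123456789"))
       (split 2 9 (use reducible174 "0123456798") (use reducible122 "x23456789"))))))) tt

reducible176 : Reducible (setup 10 "012" "2" "03 06 07 08 09 13 14 15 18 23" "01 02 04 05 12 16 17")
reducible176 = certify _
  (split 1 9 (use reducible9 "1345802") (use reducible175 "0123456789")) tt

reducible177 : Reducible (setup 10 "012" "2" "03 06 07 08 09 13 14 15 23" "01 02 04 05 12 16 17")
reducible177 = certify _
  (split 1 8 (use reducible9 "1345902") (use reducible176 "0123456789")) tt

reducible178 : Reducible
  (setup 10 "012" "" "03 06 07 08 09 13 14 15 17 18 19 23 24 25 26 28" "01 02 04 05 12 16 27")
reducible178 = certify _
  (split 2 9 (use reducible174 "0213457968") (use reducible152 "123674589")) tt

reducible179 : Reducible
  (setup 10 "012" "12" "03 06 07 08 09 13 14 15 17 18 19 23" "01 02 04 05 12 16")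
reducible179 = certify _
  (split 2 4
   (use reducible168 "0213456789")
   (split 2 5
    (use reducible167 "0213546789")
    (split 2 6
     (split 2 7
      (use reducible177 "0213456789")
      (split 2 8 (use reducible176 "0213456879") (use reducible147 "123045789")))
     (split 2 7
      (split 2 8 (use reducible176 "0213457869") (use reducible178 "0123456789"))
      (split 2 8 (use reducible178 "0123456879") (use reducible156 "123645789")))))) tt

reducible180 : Reducible
  (setup 10 "012" "12" "03 06 07 08 09 13 14 15 17 18 23" "01 02 04 05 12 16")
reducible180 = certify _
  (split 1 9 (use reducible175 "0123456978") (use reducible179 "0123456789")) tt

reducible181 : Reducible (setup 10 "012" "12" "03 06 07 08 09 13 14 15 17 23" "01 02 04 05 12 16")
reducible181 = certify _
  (split 1 8 (use reducible176 "0123456879") (use reducible180 "0123456789")) tt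

reducible182 : Reducible (setup 10 "012" "12" "03 06 07 08 09 13 23" "01 02 04 05 12")
reducible182 = certify _
  (split 1 4
   (use reducible168 "0123456789")
   (split 1 5
    (use reducible167 "0123546789")
    (split 1 6
     (split 1 7 (use reducible177 "0123456789") (use reducible181 "0123456789"))
     (split 1 7
      (use reducible181 "0123457689")
      (split 1 8
       (use reducible180 "0123458679")
       (split 1 9 (use reducible179 "0123459678") (use reducible122 "x13456789"))))))) tt

reducible183 : Reducible (setup 10 "012" "12" "03 06 07 08 13 23" "01 02 04 05 12")
reducible183 = certify _
  (split 0 9 (use reducible8 "0367812") (use reducible182 "0123456789")) tt

reducible184 : Reducible (setup 10 "012" "12" "03 06 07 13 23" "01 02 04 05 12")
reducible184 = certify _
  (split 0 8 (use reducible9 "0367912") (use reducible183 "0123456789")) tt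

reducible185 : Reducible (setup 10 "012" "12" "03 06 13 23" "01 02 04 05 12")
reducible185 = certify _
  (split 0 7 (use reducible10 "0368912") (use reducible184 "0123456789")) tt

reducible186 : Reducible (setup 10 "012" "12" "03 13 23" "01 02 04 05 12")
reducible186 = certify _
  (split 0 6 (use reducible11 "0378912") (use reducible185 "0123456789")) tt

reducible187 : Reducible
  (setup 10 "012" "02" "03 05 06 07 08 09 13 14 16 17 18 23" "01 02 04 12 15")
reducible187 = certify _
  (split 1 9 (use reducible179 "1023594678") (use reducible152 "013456789")) tt

reducible188 : Reducible (setup 10 "012" "02" "03 05 06 07 08 09 13 14 16 17 23" "01 02 04 12 15")
reducible188 = certify _
  (split 1 8 (use reducible183 "1023584679") (use reducible187 "0123456789")) tt

reducible189 : Reducible (setup 10 "012" "02" "03 05 06 07 08 09 13 14 16 23" "01 02 04 12 15")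
reducible189 = certify _
  (split 1 7 (use reducible184 "1023574689") (use reducible188 "0123456789")) tt

reducible190 : Reducible (setup 10 "012" "012" "03 05 06 07 08 09 13 23" "01 02 04 12")
reducible190 = certify _
  (split 1 4
   (split 1 5
    (use reducible186 "1023456789")
    (split 1 6
     (use reducible185 "1023465789")
     (split 1 7
      (use reducible184 "1023475689")
      (split 1 8 (use reducible183 "1023485679") (use reducible147 "013256789")))))
   (split 1 5
    (split 1 6 (use reducible185 "1023564789") (use reducible189 "0123456789"))
    (split 1 6
     (use reducible189 "0123465789")
     (split 1 7
      (use reducible188 "0123475689")
      (split 1 8 (use reducible187 "0123485679") (use reducible156 "013456789")))))) tt

reducible191 : Reducible (setup 10 "012" "012" "03 05 06 07 08 13 23" "01 02 04 12")
reducible191 = certify _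
  (split 0 9 (use reducible182 "0123495678") (use reducible190 "0123456789")) tt

reducible192 : Reducible (setup 10 "012" "012" "03 05 06 07 13 23" "01 02 04 12")
reducible192 = certify _
  (split 0 8 (use reducible183 "0123485679") (use reducible191 "0123456789")) tt

reducible193 : Reducible (setup 10 "012" "012" "03 05 06 13 23" "01 02 04 12")
reducible193 = certify _
  (split 0 7 (use reducible184 "0123475689") (use reducible192 "0123456789")) tt

reducible194 : Reducible (setup 10 "012" "012" "03 05 13 23" "01 02 04 12")
reducible194 = certify _
  (split 0 6 (use reducible185 "0123465789") (use reducible193 "0123456789")) tt

reducible-three : Reducible (setup 10 "012" "012" "03 13 23" "01 02 12")
reducible-three = certify _
  (split 0 4
   (split 0 5 (use reducible186 "0123456789") (use reducible194 "0123456789"))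
   (split 0 5
    (use reducible194 "0123546789")
    (split 0 6
     (use reducible193 "0123645789")
     (split 0 7
      (use reducible192 "0123745689")
      (split 0 8
       (use reducible191 "0123845679")
       (split 0 9 (use reducible190 "0123945678") (use reducible122 "x03456789"))))))) tt

-- Two adjacent closed vertices

reducible196 : Reducible (setup 8 "0" "" "01 04 05 06 07" "02 03 14 15")
reducible196 = certify _ (use reducible17 "0213x4567") tt

reducible197 : Reducible (setup 8 "01" "" "01 04 05 06 07 15 16 17" "02 03 12 14")
reducible197 = certify _
  (split 4 5
   (use reducible17 "0243x1567")
   (split 4 6
    (use reducible12 "04x1567")
    (split 4 7
     (use reducible12 "04x1576")
     (split 5 6
      (use reducible22 "0213x4567")
      (split 5 7
       (use reducible22 "0213x4576")
       (split 1 3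
        (use reducible7 "1065723")
        (split 3 5
         (use reducible17 "1234x0567")
         (split 3 6
          (use reducible12 "13x0567")
          (split 3 7
           (use reducible12 "13x0576")
           (reduce "01 04 05 06 07 13 15 16 17"
            "01 35 36 37 45 46 47 56 57 67" "136 357 015 047 456")))))))))) tt

reducible198 : Reducible (setup 8 "01" "" "01 04 05 06 07 15 16 17" "02 03 14")
reducible198 = certify _
  (split 1 2
   (use reducible197 "01234567")
   (split 1 3 (use reducible197 "01324567") (use reducible140 "1023675"))) tt

reducible199 : Reducible (setup 8 "01" "" "01 04 05 06 07 15 16" "02 03 14")
reducible199 = certify _
  (split 1 7 (use reducible196 "01234756") (use reducible198 "01234567")) tt

reducible200 : Reducible (setup 8 "01" "" "01 04 05 06 07 15" "02 03 14")
reducible200 = certify _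
  (split 1 6 (use reducible196 "01234657") (use reducible199 "01234567")) tt

reducible201 : Reducible (setup 8 "01" "" "01 04 05 06 07 14 15 16 17 46 56 57 67" "02 03 12 45")
reducible201 = certify _
  (split 4 7
   (use reducible12 "04x5176")
   (split 1 3
    (reduce "01 04 05 06 07 14 15 16 17" "01 46 47 56 57 67" "014 467 056")
    (split 3 4
     (use reducible84 "1430567")
     (split 3 5 (use reducible30 "301256x47") (use reducible91 "1403576"))))) tt

reducible202 : Reducible (setup 8 "1" "" "12" "02 23 24 25 26 27")
reducible202 = certify _ (reduce "12" "" "") tt

reducible203 : Reducible
  (setup 8 "1" "" "01 04 05 06 12 13 14 15 16 17 25 34 46 47" "02 03 23 24 36")
reducible203 = certify _
  (split 2 6 (use reducible32 "201364x75") (use reducible34 "021374x65")) tt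

reducible204 : Reducible
  (setup 8 "01" "" "01 04 05 06 12 14 15 16 17 25 34 35 36 37 46 56 57 67" "02 45")
reducible204 = certify _
  (reduce "01 04 05 06 07 12 13 14 15 16 17"
   "01 12 25 34 35 36 37 46 47 56 57 67" "014 056 346 167 125 357") tt

reducible205 : Reducible
  (setup 8 "01" "" "01 04 05 06 07 12 13 14 15 16 17 25 34 35 46 47 56 57 67" "02 03 23 24 45")
reducible205 = certify _
  (split 3 6
   (use reducible203 "01234567")
   (split 3 7 (use reducible203 "01234576") (use reducible204 "01234567"))) tt

reducible206 : Reducible
  (setup 8 "01" "" "01 04 05 06 07 12 13 14 15 16 17 25 46 47 56 57 67" "02 03 23 24 45")
reducible206 = certify _
  (split 3 4
   (use reducible32 "201346x75")
   (split 3 5 (use reducible35 "231045x67") (use reducible205 "01234567"))) tt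

reducible207 : Reducible
  (setup 8 "01" "" "01 04 05 06 07 12 13 14 15 16 17 46 47 56 57 67" "02 03 23 24 45")
reducible207 = certify _
  (split 2 5
   (split 2 7
    (split 2 6
     (use reducible202 "01234567")
     (split 3 4
      (use reducible32 "201345x76")
      (split 3 5
       (use reducible32 "201354x76")
       (split 3 7
        (use reducible32 "301275x64")
        (reduce "10 12 13 14 15 16 17" "04 05 07 16 26 34 35 37 47 57" "126 014 057 135 347")))))
    (split 3 4
     (use reducible32 "201345x67")
     (split 3 5
      (use reducible32 "201354x67")
      (split 3 7
       (use reducible34 "021364x75")
       (reduce "10 12 13 14 15 16 17" "04 05 07 16 27 34 35 37 47 57" "127 014 057 135 347")))))
   (use reducible206 "01234567")) tt

reducible208 : Reducible
  (setup 8 "01" "" "01 04 05 06 07 12 13 14 15 16 17 24 34 35 46 47 56 57 67" "02 03 23 26 45")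
reducible208 = certify _
  (split 3 6
   (use reducible32 "201365x74")
   (split 3 7 (use reducible203 "01236475") (use reducible204 "01235467"))) tt

reducible209 : Reducible
  (setup 8 "01" "" "01 04 05 06 07 12 13 14 15 16 17 23 37 46 47 56 57 67" "02 03 26 27 34 45")
reducible209 = certify _
  (split 3 6
   (use reducible35 "021436x75")
   (reduce "01 04 05 06 07 12 13 14 15 16 17"
    "01 23 24 25 35 36 37 46 47 56 57 67" "123 367 046 147 057 156")) tt

reducible210 : Reducible
  (setup 8 "01" "" "01 04 05 06 12 13 14 16 17 23 24 26 35 37 46 56 57 67" "02 25 27 34 45")
reducible210 = certify _
  (reduce "01 04 05 06 07 12 13 14 15 16 17"
   "01 23 24 26 35 36 37 46 47 56 57 67" "123 246 357 014 056 167") tt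

reducible211 : Reducible
  (setup 8 "01" "" "01 04 05 06 07 12 13 14 15 16 17 23 24 35 46 47 56 57 67" "02 03 25 27 34 45")
reducible211 = certify _
  (split 3 7
   (use reducible35 "021437x65")
   (split 2 6 (use reducible209 "01234567") (use reducible210 "01234567"))) tt

reducible212 : Reducible
  (setup 8 "01" "" "01 04 05 06 07 12 13 14 15 16 17 23 24 25 46 47 56 57 67" "02 03 26 34 45")
reducible212 = certify _
  (split 3 6
   (use reducible35 "021436x75")
   (split 3 5
    (split 2 7
     (use reducible209 "01234576")
     (reduce "01 04 05 06 07 12 13 14 15 16 17"
      "01 23 24 25 27 36 37 46 47 56 57 67" "136 124 257 017 056 467"))
    (split 3 7
     (reduce "01 04 05 06 07 12 13 14 15 16 17"
      "01 23 24 25 27 35 36 46 47 56 57 67" "124 235 136 015 567 046")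
     (use reducible204 "01274563")))) tt

reducible213 : Reducible (setup 8 "01" "" "01 04 05 06 13 14 15 16 17 36 46 47 56 57 67" "34 35 45")
reducible213 = certify _
  (reduce "01 04 05 06 07 12 13 14 15 16 17"
   "01 02 12 36 37 46 47 56 57 67" "136 046 147 015 567") tt

reducible214 : Reducible
  (setup 8 "01" "" "01 04 05 06 07 12 13 14 15 16 17 23 46 47 56 57 67" "02 03 34 45")
reducible214 = certify _
  (split 2 4
   (use reducible35 "021534x67")
   (split 2 5
    (split 3 5
     (use reducible35 "021435x67")
     (split 2 7
      (use reducible211 "01234567")
      (split 3 6
       (use reducible211 "01325476")
       (split 3 7
        (use reducible210 "01325467")
        (reduce "01 04 05 06 07 12 13 14 15 16 17"
         "01 02 12 27 35 36 37 46 47 56 57 67" "014 467 056 136 127 357")))))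
    (split 2 6
     (use reducible212 "01234567")
     (split 2 7
      (use reducible212 "01234576")
      (split 3 5
       (split 3 6
        (reduce "01 04 05 06 07 12 13 14 15 16 17"
         "01 23 24 25 26 27 37 46 47 56 57 67" "123 246 257 014 056 167")
        (use reducible213 "01234567"))
       (use reducible204 "01324567")))))) tt

reducible215 : Reducible
  (setup 8 "01" "" "01 04 05 06 07 12 13 14 15 16 17 23 34 35 46 47 56 57 67" "02 03 36 45")
reducible215 = certify _
  (split 2 4
   (use reducible212 "01324567")
   (split 2 5
    (use reducible212 "01325467")
    (split 2 6
     (use reducible35 "021436x75")
     (split 2 7
      (split 3 7 (use reducible35 "021437x65") (use reducible148 "104x36527"))
      (use reducible204 "01325467"))))) tt

reducible216 : Reducible (setup 8 "01" "" "01 04 05 06 07 14 15 16 17 46 56 57 67" "02 03 45")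
reducible216 = certify _
  (split 1 2
   (use reducible201 "01234567")
   (split 1 3
    (use reducible201 "01324567")
    (split 2 3
     (split 4 7
      (use reducible12 "04x5176")
      (split 2 4
       (use reducible207 "01234567")
       (split 2 5
        (use reducible206 "01235467")
        (split 3 4
         (use reducible207 "01324567")
         (split 3 5
          (use reducible205 "01325467")
          (split 2 6
           (use reducible208 "01234567")
           (split 2 7 (use reducible208 "01234576") (use reducible204 "01325467"))))))))
     (split 3 4
      (split 4 7 (use reducible12 "04x5176") (use reducible214 "01234567"))
      (split 3 5
       (split 4 7 (use reducible12 "04x5176") (use reducible214 "01235467"))
       (split 3 6
        (split 4 7 (use reducible12 "04x5176") (use reducible215 "01234567"))
        (split 3 7
         (split 4 7 (use reducible12 "04x5176") (use reducible215 "01234576"))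
         (reduce "01 04 05 06 07 12 13 14 15 16 17"
          "01 12 23 34 35 36 37 46 47 56 57 67" "014 056 346 167 357 123")))))))) tt

reducible217 : Reducible (setup 8 "01" "" "01 04 05 06 07 14 15 16 17 46 56" "02 03 45")
reducible217 = certify _
  (split 5 7
   (use reducible196 "05234716")
   (split 6 7 (use reducible22 "0253x4671") (use reducible216 "01234567"))) tt

reducible218 : Reducible (setup 8 "01" "" "01 04 05 06 07 14 15 16 17 46" "02 03 45")
reducible218 = certify _
  (split 5 6 (use reducible196 "05234617") (use reducible217 "01234567")) tt

reducible219 : Reducible (setup 8 "01" "" "01 04 05 06 14 15 17 46 47 56 57 67" "03 12 13")
reducible219 = certify _
  (reduce "01 04 05 06 07 14 15 16 17" "01 02 45 46 47 56 57 67" "014 056 157 467") tt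

reducible220 : Reducible
  (setup 8 "01" "" "04 05 06 07 12 13 14 15 16 17 23 24 27 35 36 45 46 47 56 57 67" "26 34")
reducible220 = certify _
  (reduce "01 04 05 06 07 12 13 14 15 16 17"
   "01 23 24 25 27 35 36 37 45 46 47 56 57 67" "123 247 356 045 146 067 157") tt

reducible221 : Reducible
  (setup 8 "01" "" "01 04 05 06 07 12 13 14 15 16 17 23 24 36 45 46 47 56 57 67" "02 03 25 26 34")
reducible221 = certify _
  (split 3 5
   (use reducible35 "021435x67")
   (split 2 7
    (reduce "01 04 05 06 07 12 13 14 15 16 17"
     "01 23 24 35 36 37 45 46 47 56 57 67" "123 356 015 457 046 167")
    (use reducible220 "01234567"))) tt

reducible222 : Reducible
  (setup 8 "01" "" "01 04 05 06 07 12 13 14 15 16 17 45 46 47 56 57 67" "02 03 26 34")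
reducible222 = certify _
  (split 2 3
   (split 2 4
    (split 2 7
     (split 2 5 (use reducible202 "01234567") (use reducible32 "201346x75"))
     (use reducible32 "201345x67"))
    (split 3 6
     (use reducible32 "201365x74")
     (reduce "10 12 13 14 15 16 17" "04 05 06 15 17 24 36 46" "124 046 136 015")))
   (split 2 4
    (use reducible35 "021534x67")
    (split 3 6
     (use reducible35 "021436x57")
     (split 2 5
      (use reducible221 "01234567")
      (split 3 7 (use reducible221 "01326745") (use reducible220 "01234765")))))) tt

reducible223 : Reducible
  (setup 8 "01" "" "01 04 05 06 07 12 13 14 15 16 17 24 26 45 46 47 56 57 67" "02 03 34")
reducible223 = certify _
  (split 2 5
   (use reducible222 "01234657")
   (split 2 7 (use reducible222 "01234576") (use reducible51 "014x35672"))) tt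

reducible224 : Reducible
  (setup 8 "01" "" "01 04 05 06 07 12 13 14 15 16 17 26 45 46 47 56 57 67" "02 03 34 35")
reducible224 = certify _
  (split 2 4 (use reducible222 "01324657") (use reducible223 "01234567")) tt

reducible225 : Reducible
  (setup 8 "01" "" "01 04 05 06 07 13 14 15 16 17 45 46 47 56 57 67" "02 03 34")
reducible225 = certify _
  (split 1 2
   (use reducible97 "1034567")
   (split 2 6
    (use reducible222 "01234567")
    (split 3 5
     (use reducible224 "01234567")
     (split 3 7
      (use reducible224 "01234765")
      (split 3 6
       (split 2 4 (use reducible222 "01324567") (use reducible223 "01234567"))
       (reduce "01 04 05 06 07 12 13 14 15 16 17"
        "01 12 26 35 36 37 45 46 47 56 57 67" "135 367 056 457 014 126")))))) tt

reducible226 : Reducible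
  (setup 8 "01" "" "01 04 05 06 13 14 15 16 17 34 35 36 45 46 47 56 57 67" "02")
-- Ten pairs of slots 3 to 7, the edge 01, and the spoke 12 for the neighbour that 1 may have in
-- slot 2.
reducible226 = certify _
  (reduce "01 04 05 06 07 12 13 14 15 16 17"
   "01 12 34 35 36 37 45 46 47 56 57 67" "014 056 345 467 136 157") tt

reducible227 : Reducible (setup 8 "01" "" "01 04 05 06 07 14 15 16 17 45 46" "02 03")
reducible227 = certify _
  (split 4 7
   (use reducible218 "01234756")
   (split 5 6
    (use reducible217 "01235647")
    (split 5 7
     (use reducible216 "01237546")
     (split 6 7
      (use reducible216 "01237645")
      (split 1 3
       (use reducible219 "10234567")
       (split 3 4
        (use reducible225 "01234567")
        (split 3 5
         (use reducible225 "01235467")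
         (split 3 6 (use reducible225 "01236457") (use reducible226 "01234567"))))))))) tt

reducible228 : Reducible (setup 8 "01" "" "01 04 05 06 07" "02 03")
reducible228 = certify _
  (split 1 4
   (split 1 5 (use reducible196 "01234567") (use reducible200 "01234567"))
   (split 1 5
    (use reducible200 "01235467")
    (split 1 6
     (use reducible199 "01236457")
     (split 1 7
      (use reducible198 "01237456")
      (split 4 5
       (split 4 6 (use reducible196 "04235617") (use reducible218 "01234567"))
       (split 4 6 (use reducible218 "01234657") (use reducible227 "01234567"))))))) tt

reducible229 : Reducible (setup 8 "01" "" "01 04 05 06" "02 03")
reducible229 = certify _ (split 0 7 (use reducible8 "0145623") (use reducible228 "01234567")) tt

reducible230 : Reducible (setup 8 "01" "" "01 04 05" "02 03")
reducible230 = certify _ (split 0 6 (use reducible9 "0145723") (use reducible229 "01234567")) tt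

reducible231 : Reducible (setup 8 "01" "" "01 04" "02 03")
reducible231 = certify _
  (split 0 5 (use reducible10 "0146723") (use reducible230 "01234567")) tt

reducible232 : Reducible
  (setup 8 "01" "" "01 03 04 05 06 07 14 15 16 17 34 35 36 37 47 57" "02 13 45")
reducible232 = certify _
  (split 6 7
   (split 4 6
    (use reducible30 "640273x15")
    (split 5 6
     (use reducible30 "540263x17")
     (split 1 2
      (use reducible18 "1456702")
      (split 2 4
       (use reducible89 "1427506")
       (split 2 5
        (use reducible30 "521340x67")
        (split 2 6
         (use reducible30 "201365x47")
         (reduce "01 03 04 05 06 07 12 14 15 16 17"
          "01 02 24 25 26 27 34 35 36 37 46 47 56 57" "124 256 016 157 035 047 346")))))))
   (use reducible90 "0145367")) tt

reducible233 : Reducible (setup 8 "01" "" "01 03 04 05 06 07 14 15 16 17 34 35 36 37 47" "02 13 45")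
reducible233 = certify _
  (split 5 7 (use reducible30 "540273x16") (use reducible232 "01234567")) tt

reducible234 : Reducible (setup 8 "01" "" "01 03 04 05 06 07 14 15 16" "02 13")
reducible234 = certify _
  (split 1 7
   (use reducible140 "0137564")
   (split 3 4
    (use reducible141 "0314567")
    (split 3 5
     (use reducible139 "0315674")
     (split 3 6
      (use reducible139 "0316574")
      (split 3 7
       (use reducible139 "0317564")
       (split 4 5
        (split 4 7 (use reducible140 "0457361") (use reducible233 "01234567"))
        (split 4 6
         (use reducible233 "01234675")
         (split 5 7
          (use reducible91 "0157364")
          (split 6 7
           (use reducible91 "0167354")
           (split 4 7
            (use reducible232 "01234765")
            (split 5 6 (use reducible90 "0156374") (use reducible51 "014x25673")))))))))))) tt

reducible235 : Reducible (setup 8 "01" "" "01 03 04 05 06 07 14 15" "02 13")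
reducible235 = certify _
  (split 1 6 (use reducible140 "0136574") (use reducible234 "01234567")) tt

reducible236 : Reducible (setup 8 "01" "" "01 03 04 05 06 07 14" "02 13")
reducible236 = certify _
  (split 1 5 (use reducible140 "0135674") (use reducible235 "01234567")) tt

reducible237 : Reducible (setup 8 "01" "" "01 03 04 05 06 07 13 14 15 36 37 45 46 57 67" "02 12 34")
reducible237 = certify _
  (reduce "01 03 04 05 06 07 13 14 15 16 17"
   "01 35 36 37 45 46 47 56 57 67" "013 145 057 046 367") tt

reducible238 : Reducible
  (setup 8 "01" "" "01 03 04 05 06 07 12 13 14 15 16 35 36 37 45 46 47 57 67" "02 23 34")
reducible238 = certify _
  (split 5 6
   (split 1 7 (use reducible89 "1326405") (use reducible90 "0356471"))
   (split 2 4
    (split 2 5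
     (split 2 6
      (split 1 7 (use reducible78 "1023456") (use reducible226 "01235674"))
      (use reducible213 "01723465"))
     (use reducible213 "01723456"))
    (use reducible204 "01273456"))) tt

reducible239 : Reducible
  (setup 8 "01" "" "01 03 04 05 06 07 12 13 14 15 17 23 24 27 35 36 37 45 46 47 67" "26 34")
reducible239 = certify _
  (reduce "01 03 04 05 06 07 12 13 14 15 16 17"
   "01 23 24 25 27 35 36 37 45 46 47 56 57 67" "123 247 035 367 017 046 145") tt

reducible240 : Reducible
  (setup 8 "01" "" "01 03 04 05 06 07 12 13 14 15 16 23 24 26 35 36 37 45 46 47 67" "25 34")
reducible240 = certify _
  (reduce "01 03 04 05 06 07 12 13 14 15 16 17"
   "01 23 24 26 27 35 36 37 45 46 47 56 57 67" "123 246 016 145 047 035 367") tt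

-- All fifteen pairs of slots 2 to 7 together with 01 meet every triangle at 0 or 1; this is just
-- paid for by eight triangles, the most that K₈ holds.
reducible241 : Reducible
  (setup 8 "01" "" "01 03 04 05 06 07 12 13 14 15 16 23 24 25 26 27 35 36 37 45 46 47 57 67" "")
reducible241 = certify _
  (reduce "01 03 04 05 06 07 12 13 14 15 16 17"
   "01 23 24 25 26 27 34 35 36 37 45 46 47 56 57 67" "013 045 067 125 146 247 236 357") tt

reducible242 : Reducible
  (setup 8 "01" "" "01 03 04 05 06 07 12 13 14 15 16 35 36 37 45 46 47 57 67" "02 34")
reducible242 = certify _
  (split 2 3
   (use reducible238 "01234567")
   (split 2 4
    (use reducible238 "01243567")
    (split 2 5
     (split 2 6
      (split 1 7
       (use reducible30 "201754x36")
       (split 2 7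
        (reduce "01 03 04 05 06 07 12 13 14 15 16 17"
         "01 23 24 35 36 37 45 46 47 56 57 67" "123 035 367 016 047 145")
        (use reducible239 "01234567")))
      (use reducible240 "01234567"))
     (split 2 6
      (use reducible240 "01234657")
      (split 2 7 (use reducible239 "01234675") (use reducible241 "01234567")))))) tt

reducible243 : Reducible (setup 8 "01" "" "01 03 04 05 06 07 13 14 15 16 35 36" "02 34")
reducible243 = certify _
  (split 3 7
   (use reducible111 "0347516")
   (split 4 5
    (use reducible139 "0435671")
    (split 4 6
     (use reducible87 "0461375")
     (split 4 7
      (use reducible86 "0345167")
      (split 5 7
       (use reducible91 "0357461")
       (split 6 7
        (use reducible91 "0367451")
        (split 1 2 (use reducible237 "01234567") (use reducible242 "01234567")))))))) tt

reducible244 : Reducible (setup 8 "01" "" "01 03 04 05 06 07 13 14 15 16 35" "02 34")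
reducible244 = certify _
  (split 3 6 (use reducible140 "0346571") (use reducible243 "01234567")) tt

reducible245 : Reducible (setup 8 "01" "" "01 03 04 05 06 07 13 14 16 34 36" "02 37")
reducible245 = certify _
  (split 1 7 (use reducible141 "0713456") (use reducible243 "01237465")) tt

reducible246 : Reducible
  (setup 8 "01" "" "01 03 04 05 06 07 12 13 14 15 16 34 35 36 37 45 47 56 57 67" "02")
reducible246 = certify _
  (split 4 6 (use reducible242 "01246357") (use reducible51 "013x24567")) tt

reducible247 : Reducible
  (setup 8 "01" "" "01 03 04 05 06 07 12 13 14 15 16 34 36 37 45 47 56 57 67" "02 23")
reducible247 = certify _
  (split 3 5 (use reducible238 "01235467") (use reducible246 "01234567")) tt

reducible248 : Reducible (setup 8 "01" "" "01 03 04 05 06 07" "02")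
reducible248 = certify _
  (split 1 3
   (split 1 4 (use reducible141 "0134567") (use reducible236 "01234567"))
   (split 1 4
    (use reducible236 "01243567")
    (split 1 5
     (use reducible235 "01253467")
     (split 1 6
      (use reducible234 "01263457")
      (split 3 4
       (split 3 5 (use reducible140 "0345671") (use reducible244 "01234567"))
       (split 3 6
        (use reducible244 "01236457")
        (split 4 5
         (use reducible244 "01245367")
         (split 5 6
          (use reducible244 "01256437")
          (split 3 7
           (use reducible245 "01234567")
           (split 4 7
            (use reducible245 "01243657")
            (split 5 7
             (use reducible245 "01254367")
             (split 6 7
              (use reducible245 "01263457")
              (split 1 2
               (split 1 7
                (use reducible227 "10273465")
                (split 4 6 (use reducible237 "01246357") (use reducible226 "01234675")))
               (split 2 3
                (use reducible247 "01234567")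
                (split 2 4
                 (use reducible247 "01243657")
                 (split 2 5
                  (use reducible247 "01254367")
                  (split 2 6
                   (use reducible247 "01263457")
                   (split 2 7
                    (split 3 5 (use reducible239 "01235674") (use reducible246 "01234567"))
                    (use reducible241 "01235467"))))))))))))))))))) tt

reducible249 : Reducible (setup 8 "01" "" "01 03 04 05 06" "02")
reducible249 = certify _
  (split 0 7 (use reducible228 "01273456") (use reducible248 "01234567")) tt

reducible250 : Reducible (setup 8 "01" "" "01 03 04 05" "02")
reducible250 = certify _
  (split 0 6 (use reducible229 "01263457") (use reducible249 "01234567")) tt

reducible251 : Reducible (setup 8 "01" "" "01 03 04" "02")
reducible251 = certify _
  (split 0 5 (use reducible230 "01253467") (use reducible250 "01234567")) tt

reducible252 : Reducible (setup 8 "01" "" "01 03" "02")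
reducible252 = certify _
  (split 0 4 (use reducible231 "01243567") (use reducible251 "01234567")) tt

-- Slot 1 is y. It is closed but not low, as it may be joined to all seven other slots.
reducible-adjacent : Reducible (setup 8 "01" "0" "01" "")
reducible-adjacent = certify _
  (split 0 2
   (split 0 3
    (split 0 4 (use reducible11 "0156723") (use reducible231 "01234567"))
    (use reducible252 "01234567"))
   (split 0 3
    (use reducible252 "01324567")
    (split 0 4
     (use reducible251 "01423567")
     (split 0 5
      (use reducible250 "01523467")
      (split 0 6
       (use reducible249 "01623457")
       (split 0 7 (use reducible248 "01723456") (use reducible122 "x01234567"))))))) tt

-- Elimination orderings

unique-⊆-length : ∀ {A : Set} {xs ys : List A} → Unique xs → (∀ {x} → x ∈ᴸ xs → x ∈ᴸ ys) →
                  length xs ≤ length ys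
unique-⊆-length {xs = xs} {ys} xs! xs⊆ys = ≮⇒≥ λ lt →
  let position = λ i → xs⊆ys (∈-lookup {xs = xs} i)
      i , j , i<j , same = pigeonhole lt (λ i → index (position i))
  in unique-lookup xs! i<j
       (trans (lookup-index (position i))
         (trans (cong (lookup ys) same) (sym (lookup-index (position j)))))

unique-Fin-length : ∀ {m} {xs : List (Fin m)} → Unique xs → length xs ≤ m
unique-Fin-length {m} xs! =
  ≤-trans (unique-⊆-length xs! (λ _ → ∈-allFin _)) (≤-reflexive (length-tabulate {n = m} (λ i → i)))

linked-prefix : ∀ {A : Set} {R : A → A → Set} xs {ys} → Linked R (xs ++ ys) → Linked R xs
linked-prefix []           _       = []
linked-prefix (x ∷ [])     _       = [-]
linked-prefix (x ∷ y ∷ xs) (r ∷ l) = r ∷ linked-prefix (y ∷ xs) l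

allPairs-prefix : ∀ {A : Set} {R : A → A → Set} xs {ys} → AllPairs R (xs ++ ys) → AllPairs R xs
allPairs-prefix []       _       = []
allPairs-prefix (x ∷ xs) (r ∷ p) = Allₚ.++⁻ˡ xs r ∷ allPairs-prefix xs p

module _ {m} (T : Graph m) where

  -- A path with head x , y closes a cycle as soon as x is adjacent to a further vertex of it.
  path-cycle : ∀ {x y z rest} → Unique (x ∷ y ∷ rest) → Linked (Adj T) (x ∷ y ∷ rest) →
               z ∈ᴸ rest → Adj T x z → ¬ Acyclic T
  path-cycle {x} {y} {z} unq lnk z∈ xz acyclic with ∈-∃++ z∈
  ... | ys , zs , refl = acyclic x y ys z
    ( allPairs-prefix (x ∷ y ∷ (ys ∷ʳ z)) (subst (λ l → Unique (x ∷ y ∷ l)) regroup unq)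
    , linked-prefix (x ∷ y ∷ (ys ∷ʳ z)) (subst (λ l → Linked (Adj T) (x ∷ y ∷ l)) regroup lnk)
    , symm T xz )
    where regroup = sym (++-assoc ys (z ∷ []) zs)

  -- Isolated vertices count as leaves, so the last vertex can be peeled too.
  LeafIn : List (Fin m) → Fin m → Set
  LeafIn W x = ∀ {y z} → y ∈ᴸ W → z ∈ᴸ W → Adj T x y → Adj T x z → y ≡ z

  data Peeling : List (Fin m) → Set where
    []  : Peeling []
    peel : ∀ {x W} → x ∉ᴸ W → LeafIn W x → Peeling W → Peeling (x ∷ W)

  module _ (acyclic : Acyclic T) where

    -- A path is prolonged at its head until the head has no other neighbour in `W`. It cannot
    -- return to itself in an acyclic graph, and `m` vertices bound its length, which makes `k`
    -- sufficient fuel.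
    leaf-beyond : ∀ W k {x y rest} → All (_∈ᴸ W) (x ∷ y ∷ rest) → Unique (x ∷ y ∷ rest) →
                  Linked (Adj T) (x ∷ y ∷ rest) → m < k + length (x ∷ y ∷ rest) →
                  ∃ λ z → z ∈ᴸ W × LeafIn W z
    leaf-beyond W zero in-W unq lnk m< = ⊥-elim (<-irrefl refl (≤-trans m< (unique-Fin-length unq)))
    leaf-beyond W (suc k) {x} {y} {rest} in-W unq lnk m<
      with Any.any? (λ z → adj? T x z ×-dec ¬? (z ≟ᶠ y)) W
    ... | no none = x , All.head in-W , λ a∈ b∈ xa xb → trans (only a∈ xa) (sym (only b∈ xb))
      where
      only : ∀ {a} → a ∈ᴸ W → Adj T x a → a ≡ y
      only {a} a∈ xa = decidable-stable (a ≟ᶠ y) λ a≢y → none (lose a∈ (xa , a≢y))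
    ... | yes some with find some
    ...   | z , z∈ , xz , z≢y with DecMembership._∈?_ _≟ᶠ_ z (x ∷ y ∷ rest)
    ...     | yes (here refl)           = ⊥-elim (irrefl T refl xz)
    ...     | yes (there (here refl))   = ⊥-elim (z≢y refl)
    ...     | yes (there (there z∈rest)) = ⊥-elim (path-cycle unq lnk z∈rest xz acyclic)
    ...     | no z∉path = leaf-beyond W k (z∈ ∷ in-W) (Allₚ.¬Any⇒All¬ _ z∉path ∷ unq)
                            (symm T xz ∷ lnk) (subst (m <_) (sym (+-suc k _)) m<)

    leaf-exists : ∀ x W → ∃ λ z → z ∈ᴸ x ∷ W × LeafIn (x ∷ W) z
    leaf-exists x W with Any.any? (adj? T x) (x ∷ W)
    ... | no none = x , here refl , λ y∈ _ xy _ → ⊥-elim (none (lose y∈ xy))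
    ... | yes some with find some
    ...   | y , y∈ , xy = leaf-beyond (x ∷ W) (suc m) (y∈ ∷ here refl ∷ [])
              (((λ { refl → irrefl T refl xy }) ∷ []) ∷ [] ∷ []) (symm T xy ∷ [-])
              (s≤s (m≤m+n m 2))

    peeling : ∀ k W → length W ≤ k →
              ∃ λ L → Peeling L × (∀ {x} → x ∈ᴸ W → x ∈ᴸ L) × (∀ {x} → x ∈ᴸ L → x ∈ᴸ W)
    peeling k       []      _ = [] , [] , (λ ()) , (λ ())
    peeling (suc k) (x ∷ W) W≤k
      with z , z∈ , leaf ← leaf-exists x W
      with L , L-peel , W⊆L , L⊆W ← peeling k (filter (λ y → ¬? (y ≟ᶠ z)) (x ∷ W))
             (s≤s⁻¹ (≤-trans (filter-notAll (λ y → ¬? (y ≟ᶠ z)) (x ∷ W)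
               (Any.map (λ { refl y≢y → y≢y refl }) z∈)) W≤k))
      = z ∷ L
      , peel (λ z∈L → proj₂ (back z∈L) refl)
             (λ a∈ b∈ → leaf (proj₁ (back a∈)) (proj₁ (back b∈))) L-peel
      , (λ {y} y∈ → forth y∈ (y ≟ᶠ z)) , λ { (here refl) → z∈ ; (there y∈) → proj₁ (back y∈) }
      where
      back : ∀ {y} → y ∈ᴸ L → y ∈ᴸ x ∷ W × y ≢ z
      back y∈ = ∈-filter⁻ (λ y → ¬? (y ≟ᶠ z)) (L⊆W y∈)
      forth : ∀ {y} → y ∈ᴸ x ∷ W → Dec (y ≡ z) → y ∈ᴸ z ∷ L
      forth y∈ (yes refl) = here refl
      forth y∈ (no y≢z)   = there (W⊆L (∈-filter⁺ (λ y → ¬? (y ≟ᶠ z)) y∈ y≢z))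

  module _ {n} (bag : Fin m → Subset n) where

    At : List (Fin m) → Fin n → Fin m → Set
    At L v i = i ∈ᴸ L × v ∈ bag i

    covered? : ∀ L v → Dec (Any (λ i → v ∈ bag i) L)
    covered? L v = Any.any? (λ i → v ∈? bag i) L

    -- The head of the list is peeled first. The home of `v` is its bag that is peeled last, and the
    -- rank counts the tree vertices from there to the end, so an earlier home means a larger rank.
    peelRank : List (Fin m) → Fin n → ℕ
    peelRank []      v = 0
    peelRank (x ∷ L) v with covered? L v
    ... | yes _ = peelRank L v
    ... | no _  = suc (length L)

    peelBag : List (Fin m) → Fin n → Subset n
    peelBag []      v = ∅
    peelBag (x ∷ L) v with covered? L v
    ... | yes _ = peelBag L v
    ... | no _  = bag x

    peelRank≤length : ∀ L v → peelRank L v ≤ length L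
    peelRank≤length []      v = z≤n
    peelRank≤length (x ∷ L) v with covered? L v
    ... | yes _ = m≤n⇒m≤1+n (peelRank≤length L v)
    ... | no _  = ≤-refl

    peelBag-bag : ∀ {L v} → Any (λ i → v ∈ bag i) L → ∃ λ i → i ∈ᴸ L × peelBag L v ≡ bag i
    peelBag-bag {x ∷ L} {v} a with covered? L v | a
    ... | yes cov | _       = let i , i∈ , eq = peelBag-bag cov in i , there i∈ , eq
    ... | no _    | _       = x , here refl , refl

    module _ {x L} (x∉L : x ∉ᴸ L) (leaf : LeafIn L x) where

      -- A walk through the leaf x enters and leaves it by the same neighbour.
      avoid-leaf : ∀ {v i j} → i ∈ᴸ L → j ∈ᴸ L →
                   Star (λ a b → At (x ∷ L) v a × At (x ∷ L) v b × Adj T a b) i j →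
                   Star (λ a b → At L v a × At L v b × Adj T a b) i j
      avoid-leaf i∈ j∈ ε = ε
      avoid-leaf i∈ j∈ (((_ , v∈i) , (there k∈ , v∈k) , ik) ◅ walk) =
        ((i∈ , v∈i) , (k∈ , v∈k) , ik) ◅ avoid-leaf k∈ j∈ walk
      avoid-leaf i∈ j∈ ((_ , (here refl , _) , ix) ◅ ε) = ⊥-elim (x∉L j∈)
      avoid-leaf i∈ j∈ ((_ , (here refl , _) , ix) ◅ ((_ , (here refl , _) , xx) ◅ _)) =
        ⊥-elim (irrefl T refl xx)
      avoid-leaf i∈ j∈ ((_ , (here refl , _) , ix) ◅ ((_ , (there k∈ , _) , xk) ◅ walk))
        with leaf i∈ k∈ (symm T ix) xk
      ... | refl = avoid-leaf i∈ j∈ walk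

      neighbour-at : ∀ {v} → ConnectedOn T (At (x ∷ L) v) → v ∈ bag x → Any (λ i → v ∈ bag i) L →
                     ∃ λ i → i ∈ᴸ L × v ∈ bag i × Adj T x i
      neighbour-at conn v∈x cov with find cov
      ... | j , j∈ , v∈j with conn (here refl , v∈x) (there j∈ , v∈j)
      ...   | ε = ⊥-elim (x∉L j∈)
      ...   | (_ , (here refl , _) , xx) ◅ _  = ⊥-elim (irrefl T refl xx)
      ...   | (_ , (there i∈ , v∈i) , xi) ◅ _ = _ , i∈ , v∈i , xi

    -- When the last bag of `v` is peeled, it is the common bag and holds `u`. Before that, a common
    -- bag about to be peeled can be exchanged: the bags of `u` and those of `v` are connected, and
    -- both continue through the only neighbour of the peeled leaf.
    ∈-peelBag : ∀ {L} → Peeling L → (∀ v → ConnectedOn T (At L v)) →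
             ∀ {i u v} → i ∈ᴸ L → u ∈ bag i → v ∈ bag i → peelRank L u ≤ peelRank L v → u ∈ peelBag L v
    ∈-peelBag (peel {x} {L} x∉L leaf peel-L) conn {i} {u} {v} i∈ u∈ v∈ ru≤rv
      with covered? L v | covered? L u | i∈
    ... | no ¬cov | _       | there i∈L = ⊥-elim (¬cov (lose i∈L v∈))
    ... | no _    | _       | here refl = u∈
    -- Here the home of `u` is peeled before that of `v`, so `u` would have the larger rank.
    ... | yes _   | no _    | _         = ⊥-elim (<-irrefl refl (≤-trans ru≤rv (peelRank≤length L v)))
    ... | yes cv  | yes cu  | i∈′       = inner i∈′
      where
      conn-L : ∀ v → ConnectedOn T (At L v)
      conn-L v (i∈ , v∈i) (j∈ , v∈j) =
        avoid-leaf x∉L leaf i∈ j∈ (conn v (there i∈ , v∈i) (there j∈ , v∈j))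
      inner : i ∈ᴸ x ∷ L → u ∈ peelBag L v
      inner (there i∈L) = ∈-peelBag peel-L conn-L i∈L u∈ v∈ ru≤rv
      inner (here refl)
        with neighbour-at x∉L leaf (conn u) u∈ cu | neighbour-at x∉L leaf (conn v) v∈ cv
      ... | j , j∈ , u∈j , xj | k , k∈ , v∈k , xk with leaf j∈ k∈ xj xk
      ...   | refl = ∈-peelBag peel-L conn-L j∈ u∈j v∈k ru≤rv

-- Decreasing rank is a perfect elimination ordering of the chordal graph in which vertices are
-- adjacent when they share a bag.
record Elimination {n} (G : Graph n) (k : ℕ) : Set where
  field
    rank    : Fin n → ℕ
    home    : Fin n → Subset n
    size≤    : ∀ v → ∣ home v ∣ ≤ k
    self     : ∀ v → v ∈ home v
    nbr      : ∀ {u v} → Adj G u v → rank u ≤ rank v → u ∈ home v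
    clique   : ∀ {u v w} → u ∈ home w → v ∈ home w → rank u ≤ rank v → u ∈ home v

≤-max : ∀ {x xs} → x ∈ᴸ xs → x ≤ foldr _⊔_ 0 xs
≤-max {xs = y ∷ xs} (here refl) = m≤m⊔n y _
≤-max {xs = y ∷ xs} (there x∈)  = ≤-trans (≤-max x∈) (m≤n⊔m y _)

bag≤ : ∀ {n} {G : Graph n} (D : TreeDecomposition G) {k} → width D ≤ k →
       ∀ i → ∣ TreeDecomposition.bag D i ∣ ≤ suc k
bag≤ D {k} w≤k i = ≤-trans (≤-max (∈-tabulate⁺ i)) (pred≤ w≤k)
  where
  pred≤ : ∀ {m} → m ∸ 1 ≤ k → m ≤ suc k
  -- The truncated subtraction loses information only here, where the bound holds anyway.
  pred≤ {zero}  _   = z≤n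
  pred≤ {suc m} m≤k = s≤s m≤k

module _ {n} {G : Graph n} {k} (D : TreeDecomposition G) (w≤k : width D ≤ k) where
  open TreeDecomposition D

  elimination : Elimination G (suc k)
  elimination
    with L , L-peel , all∈L , _ ← peeling tree (IsTree.acyclic isTree) size (allFin size)
           (≤-reflexive (length-tabulate {n = size} (λ i → i)))
    = record
    { rank  = peelRank tree bag L
    ; home  = peelBag tree bag L
    ; size≤  = λ v → subst (λ b → ∣ b ∣ ≤ suc k) (sym (proj₂ (proj₂ (home-of v)))) (bag≤ D w≤k _)
    ; self   = λ v → let i , v∈i = coversVertex v in ∈peelBag i v∈i v∈i ≤-refl
    ; nbr    = λ uv ru≤rv → let i , u∈i , v∈i = coversEdge uv in ∈peelBag i u∈i v∈i ru≤rv
    ; clique = λ {u} {v} {w} u∈ v∈ ru≤rv → let i , _ , eq = home-of w in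
                 ∈peelBag i (subst (u ∈_) eq u∈) (subst (v ∈_) eq v∈) ru≤rv
    }
    where
    home-of : ∀ v → ∃ λ i → i ∈ᴸ L × peelBag tree bag L v ≡ bag i
    home-of v = let i , v∈i = coversVertex v in peelBag-bag tree bag (lose (all∈L (∈-allFin i)) v∈i)
    connected-L : ∀ v → ConnectedOn tree (At tree bag L v)
    connected-L v (_ , v∈i) (_ , v∈j) =
      Star.map (λ (v∈a , v∈b , ab) → (all∈L (∈-allFin _) , v∈a) , (all∈L (∈-allFin _) , v∈b) , ab)
        (connectedAt v v∈i v∈j)
    ∈peelBag : ∀ i {u v} → u ∈ bag i → v ∈ bag i → peelRank tree bag L u ≤ peelRank tree bag L v →
            u ∈ peelBag tree bag L v
    ∈peelBag i = ∈-peelBag tree bag L-peel connected-L (all∈L (∈-allFin i))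

-- The local structure of a graph of treewidth at most six

elements : ∀ {n} → Subset n → List (Fin n)
elements []            = []
elements (inside  ∷ p) = zero ∷ map suc (elements p)
elements (outside ∷ p) = map suc (elements p)

length-elements : ∀ {n} (p : Subset n) → length (elements p) ≡ ∣ p ∣
length-elements []            = refl
length-elements (inside  ∷ p) = cong suc (trans (length-map suc (elements p)) (length-elements p))
length-elements (outside ∷ p) = trans (length-map suc (elements p)) (length-elements p)

∈-elements : ∀ {n x} {p : Subset n} → x ∈ p → x ∈ᴸ elements p
∈-elements {p = inside  ∷ p} here       = here refl
∈-elements {p = inside  ∷ p} (there x∈) = there (∈-map⁺ suc (∈-elements x∈))
∈-elements {p = outside ∷ p} (there x∈) = ∈-map⁺ suc (∈-elements x∈)

elements-unique : ∀ {n} (p : Subset n) → Unique (elements p)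
elements-unique []            = []
elements-unique (inside  ∷ p) =
  Allₚ.map⁺ (All.tabulate λ _ ()) ∷ Uniqueₚ.map⁺ suc-injective (elements-unique p)
elements-unique (outside ∷ p) = Uniqueₚ.map⁺ suc-injective (elements-unique p)

maximal : ∀ {n} {P : Fin n → Set} → Decidable P → (r : Fin n → ℕ) → ∃ P →
          ∃ λ y → P y × (∀ {z} → P z → r z ≤ r y)
maximal {n} {P} P? r (x , px) = y , argmax-all r px (Allₚ.all-filter P? (allFin n)) ,
  λ pz → All.lookup (f[xs]≤f[argmax] {f = r} x (filter P? (allFin n)))
                    (∈-filter⁺ P? (∈-allFin _) pz)
  where
  y = argmax r x (filter P? (allFin n))

nth : ∀ {A : Set} → List A → ℕ → Maybe A
nth []       _       = nothing
nth (x ∷ xs) zero    = just x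
nth (x ∷ xs) (suc i) = nth xs i

nth-< : ∀ {A : Set} (xs : List A) {i x} → nth xs i ≡ just x → i < length xs
nth-< (x ∷ xs) {zero}  _  = s≤s z≤n
nth-< (x ∷ xs) {suc i} eq = s≤s (nth-< xs eq)

nth-∈ : ∀ {A : Set} (xs : List A) i {x} → nth xs i ≡ just x → x ∈ᴸ xs
nth-∈ (x ∷ xs) zero    refl = here refl
nth-∈ (x ∷ xs) (suc i) eq   = there (nth-∈ xs i eq)

∈-nth : ∀ {A : Set} {xs : List A} {x} → x ∈ᴸ xs → ∃ λ i → nth xs i ≡ just x
∈-nth (here refl) = 0 , refl
∈-nth (there x∈)  = let i , eq = ∈-nth x∈ in suc i , eq

nth-injective : ∀ {A : Set} {xs : List A} → Unique xs → ∀ i j {x} →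
                nth xs i ≡ just x → nth xs j ≡ just x → i ≡ j
nth-injective {xs = x ∷ xs} _        zero    zero    _    _    = refl
nth-injective {xs = x ∷ xs} (x∉ ∷ _) zero    (suc j) refl eq   =
  ⊥-elim (All.lookup x∉ (nth-∈ xs j eq) refl)
nth-injective {xs = x ∷ xs} (x∉ ∷ _) (suc i) zero    eq   refl =
  ⊥-elim (All.lookup x∉ (nth-∈ xs i eq) refl)
nth-injective {xs = x ∷ xs} (_ ∷ xs!) (suc i) (suc j) eq eq′ =
  cong suc (nth-injective xs! i j eq eq′)

-- Filling the slots from a bag

module _ {n} (vs : List (Fin n)) (p : Subset n) where

  private
    _∈?ᴸ_ = DecMembership._∈?_ (_≟ᶠ_ {n})

  others : List (Fin n)
  others = filter (λ x → ¬? (x ∈?ᴸ vs)) (elements p)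

  arrangement : List (Fin n)
  arrangement = vs ++ others

  arrangement-unique : Unique vs → Unique arrangement
  arrangement-unique vs! = Uniqueₚ.++⁺ vs!
    (Uniqueₚ.filter⁺ (λ x → ¬? (x ∈?ᴸ vs)) (elements-unique p))
    λ (x∈vs , x∈o) → proj₂ (∈-filter⁻ (λ x → ¬? (x ∈?ᴸ vs)) {xs = elements p} x∈o) x∈vs

  -- `y` is both a named vertex and in the bag, so a bag of seven adds at most six slots. Two, three
  -- or four named vertices thus give the eight, nine or ten slots of the final lemmas.
  arrangement-length : ∀ {k y} → ∣ p ∣ ≤ suc k → y ∈ᴸ vs → y ∈ p →
                       length arrangement ≤ length vs + k
  arrangement-length ∣p∣≤ y∈vs y∈p = ≤-trans (≤-reflexive (length-++ vs)) (+-monoʳ-≤ (length vs)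
    (s≤s⁻¹ (≤-trans (filter-notAll (λ x → ¬? (x ∈?ᴸ vs)) (elements p)
        (Any.map (λ { refl y∉ → y∉ y∈vs }) (∈-elements y∈p)))
      (≤-trans (≤-reflexive (length-elements p)) ∣p∣≤))))

  ∈-arrangement : ∀ {x} → x ∈ᴸ vs ⊎ x ∈ p → x ∈ᴸ arrangement
  ∈-arrangement (inj₁ x∈) = ∈-++⁺ˡ x∈
  ∈-arrangement {x} (inj₂ x∈) with x ∈?ᴸ vs
  ... | yes x∈vs = ∈-++⁺ˡ x∈vs
  ... | no x∉vs  = ∈-++⁺ʳ vs (∈-filter⁺ (λ x → ¬? (x ∈?ᴸ vs)) (∈-elements x∈) x∉vs)

module _ {n} {G : Graph n} (E : Elimination G 7) where
  open Elimination E

  Deep : Fin n → Fin n → Set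
  Deep y v = Adj G y v × rank y < rank v

  deep? : ∀ y v → Dec (Deep y v)
  deep? y v = adj? G y v ×-dec (rank y <? rank v)

  Leaf : Fin n → Set
  Leaf v = ¬ ∃ (Deep v)

  leaf? : ∀ v → Dec (Leaf v)
  leaf? v = ¬? (any? (deep? v))

  leaf-≥ : ∀ {v w} → Leaf v → Adj G v w → rank w ≤ rank v
  leaf-≥ leaf vw = ≮⇒≥ λ lt → leaf (_ , vw , lt)

  -- All neighbours of a leaf lie in its home, which has at most seven elements including the leaf
  -- itself.
  leaf-degree : ∀ {v} → Leaf v → DegreeAtMost6 G v
  leaf-degree {v} leaf {ws} ws! adj = ≤-trans (unique-⊆-length ws! sub) (s≤s⁻¹ (≤-trans
      (filter-notAll (λ x → ¬? (x ≟ᶠ v)) (elements (home v))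
        (Any.map (λ { refl v≢v → v≢v refl }) (∈-elements (self v))))
      (≤-trans (≤-reflexive (length-elements (home v))) (size≤ v))))
    where
    sub : ∀ {w} → w ∈ᴸ ws → w ∈ᴸ filter (λ x → ¬? (x ≟ᶠ v)) (elements (home v))
    sub w∈ = let vw = All.lookup adj w∈ in
      ∈-filter⁺ (λ x → ¬? (x ≟ᶠ v)) (∈-elements (nbr (symm G vw) (leaf-≥ leaf vw)))
        λ { refl → irrefl G refl vw }

  module _ (vs : List (Fin n)) (p : Subset n) where

    Closed : Fin n → Set
    Closed v = ∀ {w} → Adj G v w → w ∈ᴸ vs ⊎ w ∈ p

    slots-closed : ∀ {v w} → Closed v → Adj G v w → ∃ λ j → nth (arrangement vs p) j ≡ just w
    slots-closed cl vw = ∈-nth (∈-arrangement vs p (cl vw))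

    slots-bounded : ∀ {k y i v} → ∣ p ∣ ≤ suc k → y ∈ᴸ vs → y ∈ p →
                    nth (arrangement vs p) i ≡ just v → i < length vs + k
    slots-bounded p≤ y∈ y∈p eq =
      ≤-trans (nth-< (arrangement vs p) eq) (arrangement-length vs p p≤ y∈ y∈p)

    slots-injective : Unique vs → ∀ {i j v} → nth (arrangement vs p) i ≡ just v →
                      nth (arrangement vs p) j ≡ just v → i ≡ j
    slots-injective vs! = nth-injective (arrangement-unique vs p vs!) _ _

  -- Stated without `y` being a leaf, so as to serve both two adjacent leaves and a `y` with a
  -- single neighbour of larger rank.
  adjacent-case : ∀ {v y p} → Leaf v → Adj G v y → ∣ p ∣ ≤ 7 → y ∈ p →
                  Closed (v ∷ y ∷ []) p v → Closed (v ∷ y ∷ []) p y → Reduction G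
  adjacent-case {v} {y} {p} leaf vy p≤ y∈p cv cy =
    reducible-adjacent G (nth (arrangement vs p)) record
    { bounded   = slots-bounded vs p p≤ (there (here refl)) y∈p
    ; injective = slots-injective vs p (((λ { refl → irrefl G refl vy }) ∷ []) ∷ [] ∷ [])
    ; isClosed  = λ { (here refl) refl vw → slots-closed vs p cv vw
                    ; (there (here refl)) refl vw → slots-closed vs p cy vw }
    ; isLow     = λ { (here refl) refl → leaf-degree leaf }
    ; isPresent = (v , y , refl , refl , vy) ∷ []
    ; isAbsent  = []
    }
    where vs = v ∷ y ∷ []

  two-case : ∀ {u v y p} → Leaf u → Leaf v → ¬ Adj G u v → u ≢ v → Adj G u y → Adj G v y →
             ∣ p ∣ ≤ 7 → y ∈ p →
             (∀ {x} → x ∈ᴸ u ∷ v ∷ y ∷ [] → Closed (u ∷ v ∷ y ∷ []) p x) → Reduction G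
  two-case {u} {v} {y} {p} leaf-u leaf-v ¬uv u≢v uy vy p≤ y∈p cl =
    reducible-two G (nth (arrangement vs p)) record
    { bounded   = slots-bounded vs p p≤ (there (there (here refl))) y∈p
    ; injective = slots-injective vs p
        ((u≢v ∷ (λ { refl → irrefl G refl uy }) ∷ []) ∷
         ((λ { refl → irrefl G refl vy }) ∷ []) ∷ [] ∷ [])
    ; isClosed  = λ { (here refl) refl → slots-closed vs p (cl (here refl))
                    ; (there (here refl)) refl → slots-closed vs p (cl (there (here refl)))
                    ; (there (there (here refl))) refl →
                        slots-closed vs p (cl (there (there (here refl)))) }
    ; isLow     = λ { (here refl) refl → leaf-degree leaf-u
                    ; (there (here refl)) refl → leaf-degree leaf-v }
    ; isPresent = (u , y , refl , refl , uy) ∷ (v , y , refl , refl , vy) ∷ []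
    ; isAbsent  = (λ { (_ , _ , refl , refl , uv) → ¬uv uv }) ∷ []
    }
    where vs = u ∷ v ∷ y ∷ []

  three-case : ∀ {u v w y p} → Leaf u → Leaf v → Leaf w →
               ¬ Adj G u v → ¬ Adj G u w → ¬ Adj G v w → u ≢ v → u ≢ w → v ≢ w →
               Adj G u y → Adj G v y → Adj G w y → ∣ p ∣ ≤ 7 → y ∈ p →
               (∀ {x} → x ∈ᴸ u ∷ v ∷ w ∷ [] → Closed (u ∷ v ∷ w ∷ y ∷ []) p x) → Reduction G
  three-case {u} {v} {w} {y} {p} leaf-u leaf-v leaf-w ¬uv ¬uw ¬vw u≢v u≢w v≢w uy vy wy p≤ y∈p cl =
    reducible-three G (nth (arrangement vs p)) record
    { bounded   = slots-bounded vs p p≤ (there (there (there (here refl)))) y∈p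
    ; injective = slots-injective vs p
        ((u≢v ∷ u≢w ∷ (λ { refl → irrefl G refl uy }) ∷ []) ∷
         (v≢w ∷ (λ { refl → irrefl G refl vy }) ∷ []) ∷
         ((λ { refl → irrefl G refl wy }) ∷ []) ∷ [] ∷ [])
    ; isClosed  = λ { (here refl) refl → slots-closed vs p (cl (here refl))
                    ; (there (here refl)) refl → slots-closed vs p (cl (there (here refl)))
                    ; (there (there (here refl))) refl →
                        slots-closed vs p (cl (there (there (here refl)))) }
    ; isLow     = λ { (here refl) refl → leaf-degree leaf-u
                    ; (there (here refl)) refl → leaf-degree leaf-v
                    ; (there (there (here refl))) refl → leaf-degree leaf-w }
    ; isPresent = (u , y , refl , refl , uy) ∷ (v , y , refl , refl , vy) ∷
                  (w , y , refl , refl , wy) ∷ []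
    ; isAbsent  = (λ { (_ , _ , refl , refl , uv) → ¬uv uv }) ∷
                  (λ { (_ , _ , refl , refl , uw) → ¬uw uw }) ∷
                  (λ { (_ , _ , refl , refl , vw) → ¬vw vw }) ∷ []
    }
    where vs = u ∷ v ∷ w ∷ y ∷ []

  -- Adjacent leaves have equal rank. The neighbours of `u` share the home of `u` with `v` and do
  -- not outrank it, so they lie in the home of `v`, which takes the part of `y`.
  adjacent-leaves : ∀ {u v} → Leaf u → Leaf v → Adj G u v → Reduction G
  adjacent-leaves {u} {v} leaf-u leaf-v uv = adjacent-case leaf-u uv (size≤ v) (self v)
    (λ uw → inj₂ (clique (nbr (symm G uw) (leaf-≥ leaf-u uw)) (nbr (symm G uv) (leaf-≥ leaf-u uv))
      (≤-trans (leaf-≥ leaf-u uw) (leaf-≥ leaf-v (symm G uv)))))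
    (λ vw → inj₂ (nbr (symm G vw) (leaf-≥ leaf-v vw)))

  module _ (¬leaves : ¬ ∃₂ λ u v → Adj G u v × Leaf u × Leaf v)
           {y} (¬leaf-y : ∃ (Deep y)) (top : ∀ {z} → ∃ (Deep z) → rank z ≤ rank y) where

    private
      p = home y

    -- Otherwise `v` would be a non-leaf ranked above `y`.
    deep-leaf : ∀ {v} → Deep y v → Leaf v
    deep-leaf (_ , y<v) deep = <-irrefl refl (≤-trans y<v (top deep))

    -- Both `w` and `y` lie in the home of the leaf `v`. Since `w` is next to a leaf, it is no leaf
    -- itself and does not outrank `y`, so `clique` moves it into the home of `y`.
    deep-closed : ∀ {v w} → Deep y v → Adj G v w → w ∈ p
    deep-closed {v} {w} yv@(adj , y<v) vw =
      clique (nbr (symm G vw) (leaf-≥ leaf-v vw)) (nbr adj (<⇒≤ y<v)) w≤y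
      where
      leaf-v = deep-leaf yv
      w≤y : rank w ≤ rank y
      w≤y with any? (deep? w)
      ... | yes deep = top deep
      ... | no ¬deep = ⊥-elim (¬leaves (v , w , vw , leaf-v , ¬deep))

    y-closed : ∀ {w} → Adj G y w → ¬ Deep y w → w ∈ p
    y-closed yw ¬deep = nbr (symm G yw) (≮⇒≥ λ lt → ¬deep (yw , lt))

    ¬deep-adj : ∀ {u v} → Deep y u → Deep y v → ¬ Adj G u v
    ¬deep-adj yu yv uv = ¬leaves (_ , _ , uv , deep-leaf yu , deep-leaf yv)

    deeps : List (Fin n)
    deeps = filter (deep? y) (allFin n)

    deeps-reduction : ∀ ds → Unique ds → (∀ {v} → v ∈ᴸ ds → Deep y v) →
                      (∀ {v} → Deep y v → v ∈ᴸ ds) → Reduction G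
    deeps-reduction [] _ _ all with all (proj₂ ¬leaf-y)
    ... | ()
    deeps-reduction (v ∷ []) _ deep all =
      adjacent-case (deep-leaf yv) (symm G (proj₁ yv)) (size≤ y) (self y)
        (λ vw → inj₂ (deep-closed yv vw)) closed-y
      where
      yv = deep (here refl)
      closed-y : ∀ {w} → Adj G y w → w ∈ᴸ v ∷ y ∷ [] ⊎ w ∈ p
      closed-y {w} yw with deep? y w
      ... | no ¬yw = inj₂ (y-closed yw ¬yw)
      ... | yes yw′ with all yw′
      ...   | here w≡v = inj₁ (here w≡v)
    deeps-reduction (u ∷ v ∷ []) ((u≢v ∷ []) ∷ _) deep all =
      two-case (deep-leaf yu) (deep-leaf yv) (¬deep-adj yu yv) u≢v
        (symm G (proj₁ yu)) (symm G (proj₁ yv)) (size≤ y) (self y)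
        λ { (here refl) uw → inj₂ (deep-closed yu uw)
          ; (there (here refl)) vw → inj₂ (deep-closed yv vw)
          ; (there (there (here refl))) → closed-y }
      where
      yu = deep (here refl)
      yv = deep (there (here refl))
      closed-y : ∀ {w} → Adj G y w → w ∈ᴸ u ∷ v ∷ y ∷ [] ⊎ w ∈ p
      closed-y {w} yw with deep? y w
      ... | no ¬yw = inj₂ (y-closed yw ¬yw)
      ... | yes yw′ with all yw′
      ...   | here w≡u         = inj₁ (here w≡u)
      ...   | there (here w≡v) = inj₁ (there (here w≡v))
    deeps-reduction (u ∷ v ∷ w ∷ _) ((u≢v ∷ u≢w ∷ _) ∷ (v≢w ∷ _) ∷ _) deep all =
      three-case (deep-leaf yu) (deep-leaf yv) (deep-leaf yw)
        (¬deep-adj yu yv) (¬deep-adj yu yw) (¬deep-adj yv yw) u≢v u≢w v≢w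
        (symm G (proj₁ yu)) (symm G (proj₁ yv)) (symm G (proj₁ yw)) (size≤ y) (self y)
        λ { (here refl) ux → inj₂ (deep-closed yu ux)
          ; (there (here refl)) vx → inj₂ (deep-closed yv vx)
          ; (there (there (here refl))) wx → inj₂ (deep-closed yw wx) }
      where
      yu = deep (here refl)
      yv = deep (there (here refl))
      yw = deep (there (there (here refl)))

    deep-reduction : Reduction G
    deep-reduction = deeps-reduction deeps
      (Uniqueₚ.filter⁺ (deep? y) (Uniqueₚ.allFin⁺ n))
      (λ v∈ → proj₂ (∈-filter⁻ (deep? y) {xs = allFin n} v∈))
      (λ yv → ∈-filter⁺ (deep? y) (∈-allFin _) yv)

  reduction : ∀ {a b} → Adj G a b → Reduction G
  reduction {a} {b} ab
    with any? (λ u → any? λ v → adj? G u v ×-dec leaf? u ×-dec leaf? v)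
  ... | yes (u , v , uv , leaf-u , leaf-v) = adjacent-leaves leaf-u leaf-v uv
  ... | no ¬leaves =
    let y , deep , top = maximal (λ y → any? (deep? y)) rank non-leaf
    in deep-reduction ¬leaves deep top
    where
    non-leaf : ∃ λ y → ∃ (Deep y)
    non-leaf with any? (deep? a) | any? (deep? b)
    ... | yes deep | _        = a , deep
    ... | no _     | yes deep = b , deep
    ... | no la    | no lb    = ⊥-elim (¬leaves (a , b , ab , la , lb))

-- Ranks and homes of the original graph stay valid after edges are deleted; only which vertices are
-- leaves changes. So one tree decomposition serves the whole induction.
Elimination-⊑ : ∀ {n} {G H : Graph n} {k} → H ⊑ G → Elimination G k → Elimination H k
Elimination-⊑ H⊑G E = record
  { rank = rank ; home = home ; size≤ = size≤ ; self = self
  ; nbr = λ uv → nbr (H⊑G uv) ; clique = clique }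
  where open Elimination E

theorem3p5 : (n : ℕ) (G : Graph n) → TreewidthAtMost 6 G → τ G ≤ 2 * ν G
theorem3p5 n G (D , w≤6) = Tuza⇒τ≤2ν G
  (reducible⇒Tuza G λ H H⊑G → reduction (Elimination-⊑ H⊑G (elimination D w≤6)))
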